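{- Let $P$ be a tree poset of height $k$. Then the number of induced $P$-free subfamilies of $\mathcal{B}_n$ is at most $2^{(k-1+o(1))\binom{n}{\lfloor n/2\rfloor}}$, where $o(1)\to 0$ as $n\to\infty$.
   Context: $\mathcal{B}_n$ is the family of all subsets of $[n]$ ordered by inclusion. A family $\mathcal{F}\subseteq\mathcal{B}_n$ is induced $P$-free if there is no injective map $f:P\to\mathcal{F}$ with $f(x)\subsetneq f(y)$ if and only if $x<_P y$. $P$ is a tree poset if its Hasse diagram (edges $xy$ with $x<y$ and nothing strictly between), viewed as an undirected graph, is a tree; the height of $P$ is the maximum size of a chain in $P$. -}

module Defs where

open import Level using (0ℓ)
open import Data.Nat using (ℕ; suc; _≤_; _+_; _*_; _^_; _/_)
open import Data.Nat.Combinatorics using (_C_)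
open import Data.Bool using (Bool; true)
open import Data.Fin using (Fin)
open import Data.Fin.Subset using (Subset; _⊂_)
open import Data.List using (List; []; _∷_; length; [_]; _++_)
open import Data.List.Relation.Unary.AllPairs using (AllPairs)
open import Data.List.Relation.Unary.Linked using (Linked)
open import Data.List.Relation.Unary.Unique.Propositional using (Unique)
open import Data.Product using (Σ; ∃; ∃-syntax; _×_)
open import Data.Sum using (_⊎_)
open import Relation.Nullary using (¬_)
open import Relation.Binary using (Rel; IsStrictPartialOrder)
open import Relation.Binary.PropositionalEquality using (_≡_)
open import Function.Definitions using (Injective)

record FinPoset : Set₁ where
  field
    size  : ℕ
    _<P_  : Rel (Fin size) 0ℓ
    isSPO : IsStrictPartialOrder _≡_ _<P_

module _ (P : FinPoset) where
  open FinPoset P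

  Covers : Fin size → Fin size → Set
  Covers x y = x <P y × ¬ (∃[ z ] (x <P z × z <P y))

  HasseAdj : Fin size → Fin size → Set
  HasseAdj x y = Covers x y ⊎ Covers y x

  data Walk : Fin size → Fin size → Set where
    here : ∀ {x} → Walk x x
    step : ∀ {x y z} → HasseAdj x y → Walk y z → Walk x z

  HasseConnected : Set
  HasseConnected = ∀ x y → Walk x y

  HasseCycle : Set
  HasseCycle = Σ (Fin size) λ v → Σ (List (Fin size)) λ xs →
    3 ≤ length (v ∷ xs) × Unique (v ∷ xs) × Linked HasseAdj (v ∷ xs ++ [ v ])

  IsTreePoset : Set
  IsTreePoset = 1 ≤ size × HasseConnected × ¬ HasseCycle

  IsChain : List (Fin size) → Set
  IsChain = AllPairs (λ x y → x <P y ⊎ y <P x)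

  HasHeight : ℕ → Set
  HasHeight k = (∃[ xs ] (IsChain xs × length xs ≡ k))
              × (∀ xs → IsChain xs → length xs ≤ k)

Family : ℕ → Set
Family n = Subset n → Bool

_∈F_ : ∀ {n} → Subset n → Family n → Set
S ∈F F = F S ≡ true

InducedCopy : (P : FinPoset) → ∀ {n} → Family n → Set
InducedCopy P {n} F =
  Σ (Fin size → Subset n) λ f →
    Injective _≡_ _≡_ f
    × (∀ x → f x ∈F F)
    × (∀ x y → (f x ⊂ f y → x <P y) × (x <P y → f x ⊂ f y))
  where open FinPoset P

InducedFree : (P : FinPoset) → ∀ {n} → Family n → Set
InducedFree P F = ¬ InducedCopy P F

DistinctFamilies : ∀ {n} → Family n → Family n → Set
DistinctFamilies F G = ¬ (∀ S → F S ≡ G S)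

-- a list of pairwise (extensionally) distinct induced P-free families of
-- subsets of [n]; the number of induced P-free families is the maximal
-- length of such a list
open import Data.List.Membership.Propositional using (_∈_)

DistinctInducedFreeList : FinPoset → (n : ℕ) → List (Family n) → Set
DistinctInducedFreeList P n Fs =
  AllPairs DistinctFamilies Fs × (∀ F → F ∈ Fs → InducedFree P F)

-- Weigh a set v by the number w v of maximal chains through it, out of n!.
-- Call v rich towards a family R if a random chain through v meets R within D
-- further steps with probability more than K D / n.  If every rank of the tree
-- poset could be played by sets that are rich towards the neighbouring ranks,
-- to any depth, then P could be embedded greedily along its Hasse tree: each
-- new element has to avoid boundedly many events of probability O(D / n).  So
-- in a P-free family F every set is poor at every rank, rank 0 only upwards and
-- rank k − 1 only downwards, and two consecutive ranks r, r + 1 are poor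
-- towards each other.  This splits F into k − 1 parts, and in each of them all
-- pairs at distance at most D together have weight O(D / n).
--
-- Such nearly-antichains have few containers.  After moving the few sets with
-- many close predecessors to an exceptional family, grow a fingerprint S ⊆ A
-- by sets whose chains meet the current container C above them often; a member
-- of C with too many chains into S cannot be in A.  When this stops, C has few
-- close pairs, hence weight at most about the number of slabs of height D.
-- Two rounds are needed: the first one, with short gaps D, reduces the √n
-- middle layers to a small power of n, the second one, with all gaps in the
-- middle layers, gives weight 1 + o(1) for each of the k − 1 parts.

module Submission where

open import Defs
open import Data.Bool as Bool using (Bool; true; false; not; _∧_; _∨_; if_then_else_)
open import Data.Empty using (⊥-elim)
open import Data.Fin using (Fin; zero; suc; toℕ)
import Data.Fin.Properties as Finₚ
open import Data.Fin.Subset using (Subset; inside; outside; _∈_; _∉_; _⊆_; _⊂_; ∣_∣)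
open import Data.Fin.Subset.Properties using (_∈?_; _⊆?_; anySubset?; ∣p∣≤n; p⊆q⇒∣p∣≤∣q∣; drop-there; drop-∷-⊆; s⊆s; ⊆-refl; ⊆-trans)
open import Data.List as List using (List; []; _∷_; [_]; _++_; length; map; concatMap; filter; cartesianProductWith; allFin)
open import Data.List.Membership.Propositional using (find; lose) renaming (_∈_ to _∈ˡ_; _∉_ to _∉ˡ_)
open import Data.List.Membership.Propositional.Properties using (∈-map⁺; ∈-map⁻; ∈-++⁺ˡ; ∈-++⁺ʳ; ∈-allFin; ∈-filter⁺; ∈-lookup)
open import Data.List.Properties using (length-++; length-map; length-filter)
open import Data.List.Relation.Unary.All as All using (All; []; _∷_)
open import Data.List.Relation.Unary.AllPairs as AllPairs using (AllPairs; []; _∷_)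
open import Data.List.Relation.Unary.Any as Any using (Any; here; there)
open import Data.List.Relation.Unary.Linked as Linked using (Linked; []; [-]; _∷_)
open import Data.List.Relation.Unary.Unique.Propositional using (Unique)
open import Data.Nat
open import Data.Nat.Combinatorics using (nCk≡n!/k![n-k]!; k![n∸k]!∣n!)
open import Data.Nat.DivMod
open import Data.Nat.Properties
open import Data.Nat.Tactic.RingSolver using (solve-∀)
open import Data.Product using (∃; ∃-syntax; _×_; _,_; proj₁; proj₂)
open import Data.Sum using (_⊎_; inj₁; inj₂; [_,_]′)
open import Data.Unit using (⊤; tt)
open import Data.Vec using (Vec; []; _∷_; here; there)
open import Function using (_∘_; id; case_of_)
open import Relation.Binary.Definitions using (Tri; tri<; tri≈; tri>)
open import Relation.Binary.PropositionalEquality hiding ([_])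
open import Relation.Nullary using (¬_; Dec; yes; no; does; contradiction; ¬?; _×-dec_; _⊎-dec_; _→-dec_)
open import Relation.Nullary.Decidable using (¬¬-excluded-middle; decidable-stable; dec-true; dec-false)
open import Data.List.Relation.Unary.All.Properties using (all-filter) renaming (++⁺ to all-++; map⁺ to all-map; filter⁺ to all-filter⁺)
open import Data.List.Relation.Unary.AllPairs.Properties using () renaming (filter⁺ to pairs-filter⁺)
open import Data.List.Relation.Unary.Any.Properties using () renaming (++⁺ˡ to any-++ˡ; ++⁺ʳ to any-++ʳ; map⁺ to any-map; cartesianProductWith⁺ to any-product)

-- Finite sums

-- Probabilities are counts over the list `Ω n` of the `n !` maximal chains, with all denominators
-- cleared. The central layer has the least weight, `n !` over the central binomial coefficient `N`,
-- so a family of mass `x * n !` has at most `x * N` members. The obstacle is the size of the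
-- fingerprints. They are chosen among `2 ^ n` sets, so each of their members costs about log n
-- bits, and they must have o(N / log n) members. When gaps up to `D` are treated inside a family
-- `C`, the argument allows about `N * D * mass C / (n * n !)` members, up to a constant and a small
-- power of n. With `D` and `mass C / n !` both of order √n that is too much; in each of the two
-- rounds only one of the two factors is large. A second difficulty is that a set is poor at a rank
-- only with respect to the depth at which it fails there, and this depth varies from set to set.
-- For a close pair in one part the two depths are compared: the set that survives longer is still
-- present at the depth where the other one is poor, so the pair is counted on at least one of its
-- two sides.

variable
  A B : Set

∑ : List A → (A → ℕ) → ℕ
∑ []       f = 0
∑ (x ∷ xs) f = f x + ∑ xs f

∑-cong : ∀ (xs : List A) {f g : A → ℕ} → (∀ x → f x ≡ g x) → ∑ xs f ≡ ∑ xs g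
∑-cong []       f≡g = refl
∑-cong (x ∷ xs) f≡g = cong₂ _+_ (f≡g x) (∑-cong xs f≡g)

∑-mono∈ : ∀ (xs : List A) {f g : A → ℕ} → (∀ x → x ∈ˡ xs → f x ≤ g x) → ∑ xs f ≤ ∑ xs g
∑-mono∈ []       f≤g = z≤n
∑-mono∈ (x ∷ xs) f≤g = +-mono-≤ (f≤g x (here refl)) (∑-mono∈ xs (λ y y∈ → f≤g y (there y∈)))

∑-mono : ∀ (xs : List A) {f g : A → ℕ} → (∀ x → f x ≤ g x) → ∑ xs f ≤ ∑ xs g
∑-mono xs f≤g = ∑-mono∈ xs (λ x _ → f≤g x)

∑-+ : ∀ (xs : List A) (f g : A → ℕ) → ∑ xs (λ x → f x + g x) ≡ ∑ xs f + ∑ xs g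
∑-+ []       f g = refl
∑-+ (x ∷ xs) f g rewrite ∑-+ xs f g = interchange (f x) (g x) (∑ xs f) (∑ xs g)
  where
  interchange : ∀ a b c d → a + b + (c + d) ≡ a + c + (b + d)
  interchange = solve-∀

∑-*ˡ : ∀ (xs : List A) a (f : A → ℕ) → ∑ xs (λ x → a * f x) ≡ a * ∑ xs f
∑-*ˡ []       a f = sym (*-zeroʳ a)
∑-*ˡ (x ∷ xs) a f = trans (cong (a * f x +_) (∑-*ˡ xs a f)) (sym (*-distribˡ-+ a (f x) (∑ xs f)))

∑-*ʳ : ∀ (xs : List A) a (f : A → ℕ) → ∑ xs (λ x → f x * a) ≡ ∑ xs f * a
∑-*ʳ xs a f = trans (∑-cong xs (λ x → *-comm (f x) a)) (trans (∑-*ˡ xs a f) (*-comm a _))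

∑-zero : ∀ (xs : List A) → ∑ xs (λ _ → 0) ≡ 0
∑-zero []       = refl
∑-zero (x ∷ xs) = ∑-zero xs

∑-const : ∀ (xs : List A) a → ∑ xs (λ _ → a) ≡ length xs * a
∑-const []       a = refl
∑-const (x ∷ xs) a = cong (a +_) (∑-const xs a)

∑-swap : ∀ (xs : List A) (ys : List B) (f : A → B → ℕ) →
         ∑ xs (λ x → ∑ ys (f x)) ≡ ∑ ys (λ y → ∑ xs (λ x → f x y))
∑-swap []       ys f = sym (∑-zero ys)
∑-swap (x ∷ xs) ys f = trans (cong (∑ ys (f x) +_) (∑-swap xs ys f))
                             (sym (∑-+ ys (f x) (λ y → ∑ xs (λ z → f z y))))

∑-++ : ∀ (xs ys : List A) (f : A → ℕ) → ∑ (xs ++ ys) f ≡ ∑ xs f + ∑ ys f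
∑-++ []       ys f = refl
∑-++ (x ∷ xs) ys f = trans (cong (f x +_) (∑-++ xs ys f)) (sym (+-assoc (f x) _ _))

∑-map : ∀ (h : A → B) (xs : List A) (f : B → ℕ) → ∑ (map h xs) f ≡ ∑ xs (f ∘ h)
∑-map h []       f = refl
∑-map h (x ∷ xs) f = cong (f (h x) +_) (∑-map h xs f)

∑-concatMap : ∀ (h : A → List B) (xs : List A) (f : B → ℕ) →
              ∑ (concatMap h xs) f ≡ ∑ xs (λ x → ∑ (h x) f)
∑-concatMap h []       f = refl
∑-concatMap h (x ∷ xs) f = trans (∑-++ (h x) (concatMap h xs) f)
                                 (cong (∑ (h x) f +_) (∑-concatMap h xs f))

∑-≥ : ∀ {xs : List A} {x} (f : A → ℕ) → x ∈ˡ xs → f x ≤ ∑ xs f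
∑-≥ f (here refl) = m≤m+n _ _
∑-≥ f (there x∈)  = ≤-trans (∑-≥ f x∈) (m≤n+m _ _)

∑-<⇒∃ : ∀ (xs : List A) {f g : A → ℕ} → ∑ xs f < ∑ xs g → ∃ λ x → f x < g x
∑-<⇒∃ (x ∷ xs) {f} {g} lt with f x <? g x
... | yes fx<gx = x , fx<gx
... | no  fx≮gx = ∑-<⇒∃ xs (+-cancelˡ-< (g x) _ _ (≤-<-trans (+-monoˡ-≤ (∑ xs f) (≮⇒≥ fx≮gx)) lt))

variable
  P P′ P″ P‴ : Set

𝟙 : Dec P → ℕ
𝟙 (yes _) = 1
𝟙 (no _)  = 0

𝟙-yes : (d : Dec P) → P → 𝟙 d ≡ 1
𝟙-yes (yes _) p = refl
𝟙-yes (no ¬p) p = contradiction p ¬p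

𝟙-no : (d : Dec P) → ¬ P → 𝟙 d ≡ 0
𝟙-no (yes p) ¬p = contradiction p ¬p
𝟙-no (no _)  ¬p = refl

𝟙-pos : (d : Dec P) → 0 < 𝟙 d → P
𝟙-pos (yes p) _ = p

𝟙≤1 : (d : Dec P) → 𝟙 d ≤ 1
𝟙≤1 (yes _) = ≤-refl
𝟙≤1 (no _)  = z≤n

𝟙≤ : (d : Dec P) {a : ℕ} → (P → 1 ≤ a) → 𝟙 d ≤ a
𝟙≤ (yes p) h = h p
𝟙≤ (no _)  h = z≤n

𝟙-mono : (d : Dec P) (e : Dec P′) → (P → P′) → 𝟙 d ≤ 𝟙 e
𝟙-mono d e f = 𝟙≤ d (λ p → ≤-reflexive (sym (𝟙-yes e (f p))))

𝟙-cong : (d : Dec P) (e : Dec P′) → (P → P′) → (P′ → P) → 𝟙 d ≡ 𝟙 e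
𝟙-cong d e f g = ≤-antisym (𝟙-mono d e f) (𝟙-mono e d g)

𝟙-× : (d : Dec P) (e : Dec P′) → 𝟙 (d ×-dec e) ≡ 𝟙 d * 𝟙 e
𝟙-× (yes _) (yes _) = refl
𝟙-× (yes _) (no _)  = refl
𝟙-× (no _)  _       = refl

𝟙-⊎ : (d : Dec P) (e : Dec P′) (f : Dec P‴) → (P → P′ ⊎ P‴) → 𝟙 d ≤ 𝟙 e + 𝟙 f
𝟙-⊎ d e f h = 𝟙≤ d λ p → case h p of λ where
  (inj₁ q) → ≤-trans (≤-reflexive (sym (𝟙-yes e q))) (m≤m+n _ _)
  (inj₂ r) → ≤-trans (≤-reflexive (sym (𝟙-yes f r))) (m≤n+m _ _)

-- The tool for charging: when the condition determines the object that fits it, a sum over all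
-- candidates costs no more than the indicator of what the condition implies.
∑𝟙≤ : ∀ {xs : List A} → Unique xs → {P : A → Set} (P? : ∀ x → Dec (P x)) (q? : Dec P′) →
      (∀ {x} → P x → P′) → (∀ {x y} → P x → P y → x ≡ y) → ∑ xs (λ x → 𝟙 (P? x)) ≤ 𝟙 q?
∑𝟙≤ [] P? q? imp uniq = z≤n
∑𝟙≤ {xs = x ∷ xs} (x∉ ∷ xs!) {P} P? q? imp uniq with P? x
... | no  _  = ∑𝟙≤ xs! P? q? imp uniq
... | yes px = ≤-trans (≤-reflexive (cong suc rest≡0)) (≤-reflexive (sym (𝟙-yes q? (imp px))))
  where
  rest≡0 : ∑ xs (λ y → 𝟙 (P? y)) ≡ 0
  rest≡0 = n≤0⇒n≡0 (≤-trans (∑-mono∈ xs (λ y y∈ → 𝟙≤ (P? y) (λ py → ⊥-elim (All.lookup x∉ y∈ (uniq px py)))))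
                            (≤-reflexive (∑-zero xs)))

∑𝟙≡0 : ∀ (xs : List A) {P : A → Set} (P? : ∀ x → Dec (P x)) → (∀ x → ¬ P x) → ∑ xs (λ x → 𝟙 (P? x)) ≡ 0
∑𝟙≡0 xs P? ¬P = trans (∑-cong xs (λ x → 𝟙-no (P? x) (¬P x))) (∑-zero xs)

*∑𝟙≤ : ∀ (xs : List A) {P : A → Set} (P? : ∀ x → Dec (P x)) a {b} → (∀ x → ¬ P x) → a * ∑ xs (λ x → 𝟙 (P? x)) ≤ b
*∑𝟙≤ xs P? a ¬P rewrite ∑𝟙≡0 xs P? ¬P | *-zeroʳ a = z≤n

does⇒ : (d : Dec P) → does d ≡ true → P
does⇒ (yes p) _ = p

∧-true : ∀ {a b} → a ∧ b ≡ true → a ≡ true × b ≡ true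
∧-true {true} {true} _ = refl , refl

-- Maximal chains

∑-tabulate : ∀ {n} (h : Fin n → A) (f : A → ℕ) → ∑ (List.tabulate h) f ≡ ∑ (allFin n) (f ∘ h)
∑-tabulate {n = zero}  h f = refl
∑-tabulate {n = suc n} h f = cong (f (h zero) +_)
  (trans (∑-tabulate (h ∘ suc) f) (sym (∑-tabulate suc (f ∘ h))))

∑-allFin : ∀ n (f : Fin (suc n) → ℕ) → ∑ (allFin (suc n)) f ≡ f zero + ∑ (allFin n) (f ∘ suc)
∑-allFin n f = cong (f zero +_) (∑-tabulate suc f)

#≥ : ∀ m a → ∑ (allFin m) (λ i → 𝟙 (a ≤? toℕ i)) ≡ m ∸ a
#≥ zero    a       = sym (0∸n≡0 a)
#≥ (suc m) zero    = trans (∑-allFin m (λ i → 𝟙 (0 ≤? toℕ i))) (cong suc (#≥ m zero))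
#≥ (suc m) (suc a) = trans (∑-allFin m (λ i → 𝟙 (suc a ≤? toℕ i)))
  (trans (∑-cong (allFin m) (λ i → 𝟙-cong (suc a ≤? suc (toℕ i)) (a ≤? toℕ i) s≤s⁻¹ s≤s)) (#≥ m a))

#< : ∀ m a → a ≤ m → ∑ (allFin m) (λ i → 𝟙 (toℕ i <? a)) ≡ a
#< m       zero    a≤m = trans (∑-cong (allFin m) (λ i → 𝟙-no (toℕ i <? 0) (λ ()))) (∑-zero (allFin m))
#< (suc m) (suc a) a≤m = trans (∑-allFin m (λ i → 𝟙 (toℕ i <? suc a)))
  (cong suc (trans (∑-cong (allFin m) (λ i → 𝟙-cong (suc (toℕ i) <? suc a) (toℕ i <? a) s≤s⁻¹ s≤s)) (#< m a (s≤s⁻¹ a≤m))))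

-- A maximal chain of subsets of [n] is the order in which the n elements
-- enter: (i , c) inserts the first element at position i of the order c.
Chain : ℕ → Set
Chain zero    = ⊤
Chain (suc n) = Fin (suc n) × Chain n

Ω : ∀ n → List (Chain n)
Ω zero    = tt ∷ []
Ω (suc n) = concatMap (λ i → map (i ,_) (Ω n)) (allFin (suc n))

∑-Ω : ∀ n (f : Chain (suc n) → ℕ) → ∑ (Ω (suc n)) f ≡ ∑ (allFin (suc n)) (λ i → ∑ (Ω n) (λ c → f (i , c)))
∑-Ω n f = trans (∑-concatMap (λ i → map (i ,_) (Ω n)) (allFin (suc n)) f)
                (∑-cong (allFin (suc n)) (λ i → ∑-map (i ,_) (Ω n) f))

∑-Ω-* : ∀ n (f : Fin (suc n) → ℕ) (g : Chain n → ℕ) →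
        ∑ (Ω (suc n)) (λ c → f (proj₁ c) * g (proj₂ c)) ≡ ∑ (allFin (suc n)) f * ∑ (Ω n) g
∑-Ω-* n f g = trans (∑-Ω n _) (trans (∑-cong (allFin (suc n)) (λ i → ∑-*ˡ (Ω n) (f i) g))
                                     (∑-*ʳ (allFin (suc n)) (∑ (Ω n) g) f))

-- Coordinate zero enters at position `i`, so it is absent while `j ≤ toℕ i`. Afterwards it is one
-- of the `j` elements, and the other coordinates have made only `j ∸ 1` steps.
at : ∀ {n} → Chain n → ℕ → Subset n
at {zero}  _       j = []
at {suc n} (i , c) j with j ≤? toℕ i
... | yes _ = outside ∷ at c j
... | no _  = inside ∷ at c (j ∸ 1)

module _ {n} {i : Fin (suc n)} {c : Chain n} {j : ℕ} where

  at-≤ : j ≤ toℕ i → at (i , c) j ≡ outside ∷ at c j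
  at-≤ j≤i with j ≤? toℕ i
  ... | yes _   = refl
  ... | no  j≰i = contradiction j≤i j≰i

  at-> : ¬ j ≤ toℕ i → at (i , c) j ≡ inside ∷ at c (j ∸ 1)
  at-> j≰i with j ≤? toℕ i
  ... | yes j≤i = contradiction j≤i j≰i
  ... | no  _   = refl

∣at∣ : ∀ {n} (c : Chain n) j → j ≤ n → ∣ at c j ∣ ≡ j
∣at∣ {zero}  c       zero z≤n = refl
∣at∣ {suc n} (i , c) j j≤n with j ≤? toℕ i
... | yes j≤i = ∣at∣ c j (≤-trans j≤i (Finₚ.toℕ≤pred[n] i))
∣at∣ {suc n} (i , c) zero    j≤n | no j≰i = contradiction z≤n j≰i
∣at∣ {suc n} (i , c) (suc j) j≤n | no j≰i = cong suc (∣at∣ c j (s≤s⁻¹ j≤n))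

at-mono : ∀ {n} (c : Chain n) {i j} → i ≤ j → at c i ⊆ at c j
at-mono {zero}  c       i≤j = λ ()
at-mono {suc n} (k , c) {i} {j} i≤j with i ≤? toℕ k | j ≤? toℕ k
... | yes _   | yes _   = s⊆s (at-mono c i≤j)
... | yes i≤k | no  j≰k = λ { (there x∈) → there (at-mono c (≤-trans i≤k (∸-monoˡ-≤ 1 (≰⇒> j≰k))) x∈) }
... | no  i≰k | yes j≤k = contradiction (≤-trans i≤j j≤k) i≰k
... | no  _   | no  _   = s⊆s (at-mono c (∸-monoˡ-≤ 1 i≤j))

On : ∀ {n} → Chain n → Subset n → Set
On c v = at c ∣ v ∣ ≡ v

_≟ₛ_ : ∀ {n} (u v : Subset n) → Dec (u ≡ v)
_≟ₛ_ = ≡-dec Bool._≟_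
  where open import Data.Vec.Properties using (≡-dec)

On? : ∀ {n} (c : Chain n) v → Dec (On c v)
On? c v = at c ∣ v ∣ ≟ₛ v

module _ {n} {i : Fin (suc n)} {c : Chain n} {v : Subset n} where

  On-out : On (i , c) (outside ∷ v) → ∣ v ∣ ≤ toℕ i × On c v
  On-out on with ∣ v ∣ ≤? toℕ i
  ... | yes v≤i = v≤i , cong Data.Vec.tail on
  ... | no  _   = contradiction on λ ()

  out-On : ∣ v ∣ ≤ toℕ i → On c v → On (i , c) (outside ∷ v)
  out-On v≤i on = trans (at-≤ v≤i) (cong (outside ∷_) on)

  On-in : On (i , c) (inside ∷ v) → toℕ i < suc ∣ v ∣ × On c v
  On-in on with suc ∣ v ∣ ≤? toℕ i
  ... | yes _   = contradiction on λ ()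
  ... | no  v≮i = ≰⇒> v≮i , cong Data.Vec.tail on

  in-On : toℕ i < suc ∣ v ∣ → On c v → On (i , c) (inside ∷ v)
  in-On i≤v on = trans (at-> (<⇒≱ i≤v)) (cong (inside ∷_) on)

On-⊆ : ∀ {n} (c : Chain n) {u v} → On c u → On c v → ∣ u ∣ ≤ ∣ v ∣ → u ⊆ v
On-⊆ c {u} {v} onu onv le = subst₂ _⊆_ onu onv (at-mono c le)

On-≡ : ∀ {n} (c : Chain n) {u v} → On c u → On c v → ∣ u ∣ ≡ ∣ v ∣ → u ≡ v
On-≡ c onu onv eq = trans (sym onu) (trans (cong (at c) eq) onv)

w : ∀ {n} → Subset n → ℕ
w {n} v = ∑ (Ω n) (λ c → 𝟙 (On? c v))

-- A chain through `outside ∷ v` is a chain through `v` together with a position for the new element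
-- behind all of `v`, and there are `suc (n ∸ ∣ v ∣)` such positions.
w-out : ∀ {n} (v : Subset n) → w (outside ∷ v) ≡ suc (n ∸ ∣ v ∣) * w v
w-out {n} v = begin
  w (outside ∷ v) ≡⟨ ∑-cong (Ω (suc n)) (λ (i , c) → trans
       (𝟙-cong (On? (i , c) (outside ∷ v)) (∣ v ∣ ≤? toℕ i ×-dec On? c v) On-out (λ (le , on) → out-On le on))
       (𝟙-× (∣ v ∣ ≤? toℕ i) (On? c v))) ⟩
  _ ≡⟨ ∑-Ω-* n (λ i → 𝟙 (∣ v ∣ ≤? toℕ i)) (λ c → 𝟙 (On? c v)) ⟩
  _ ≡⟨ cong (_* w v) (trans (#≥ (suc n) ∣ v ∣) (+-∸-assoc 1 (∣p∣≤n v))) ⟩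
  _ ∎
  where open ≡-Reasoning

w-in : ∀ {n} (v : Subset n) → w (inside ∷ v) ≡ suc ∣ v ∣ * w v
w-in {n} v = begin
  w (inside ∷ v) ≡⟨ ∑-cong (Ω (suc n)) (λ (i , c) → trans
       (𝟙-cong (On? (i , c) (inside ∷ v)) (toℕ i <? suc ∣ v ∣ ×-dec On? c v) On-in (λ (le , on) → in-On le on))
       (𝟙-× (toℕ i <? suc ∣ v ∣) (On? c v))) ⟩
  _ ≡⟨ ∑-Ω-* n (λ i → 𝟙 (toℕ i <? suc ∣ v ∣)) (λ c → 𝟙 (On? c v)) ⟩
  _ ≡⟨ cong (_* w v) (#< (suc n) (suc ∣ v ∣) (s≤s (∣p∣≤n v))) ⟩
  _ ∎
  where open ≡-Reasoning

w≡ : ∀ {n} (v : Subset n) → w v ≡ ∣ v ∣ ! * (n ∸ ∣ v ∣) !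
w≡ []            = refl
w≡ {suc n} (outside ∷ v) rewrite w-out v | w≡ v | +-∸-assoc 1 (∣p∣≤n v) =
  lemma (suc (n ∸ ∣ v ∣)) (∣ v ∣ !) ((n ∸ ∣ v ∣) !)
  where
  lemma : ∀ a b c → a * (b * c) ≡ b * (a * c)
  lemma = solve-∀
w≡ {suc n} (inside ∷ v) rewrite w-in v | w≡ v = sym (*-assoc (suc ∣ v ∣) (∣ v ∣ !) ((n ∸ ∣ v ∣) !))

length-Ω : ∀ n → length (Ω n) ≡ n !
length-Ω n = trans (sym (trans (∑-const (Ω n) 1) (*-identityʳ _))) (go n)
  where
  go : ∀ n → ∑ (Ω n) (λ _ → 1) ≡ n !
  go zero    = refl
  go (suc n) = trans (∑-Ω-* n (λ _ → 1) (λ _ → 1))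
    (cong₂ _*_ (#≥ (suc n) 0) (go n))

-- Random chains through a set: picking up an element within `d` steps above it, losing one within
-- `d` steps below it

U : ∀ {n} → Subset n → Fin n → ℕ → ℕ
U {n} v e d = ∑ (Ω n) (λ c → 𝟙 (On? c v ×-dec e ∈? at c (∣ v ∣ + d)))

V : ∀ {n} → Subset n → Fin n → ℕ → ℕ
V {n} v e d = ∑ (Ω n) (λ c → 𝟙 (On? c v ×-dec ¬? (e ∈? at c (∣ v ∣ ∸ d))))

-- The induction step shared by both directions. Of the `suc m` positions of the new element, `x`
-- leave the window of `d` steps untouched, so that `X` applies, and `y` occupy a place in it, which
-- leaves `d ∸ 1` steps and `Y`. If `y ≡ d` with `d` positive, the estimate closes exactly because
-- `x + (d ∸ 1)` is `m`; if the window covers all positions, the trivial `Y ≤ w` is enough.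
combine : ∀ {d m x y X Y w} → 1 ≤ m → x + y ≡ suc m → y ≤ d → (y ≡ d ⊎ x ≡ 0) →
          m * X ≤ d * w → m * Y ≤ (d ∸ 1) * w → Y ≤ w → suc m * (x * X + y * Y) ≤ d * (suc m * w)
combine {d} {m} {x} {y} {X} {Y} {w} 1≤m x+y≡ y≤d split mX≤ mY≤ Y≤w = begin
  suc m * (x * X + y * Y) ≤⟨ *-monoʳ-≤ (suc m) (core split) ⟩
  suc m * (d * w) ≡⟨ comm3 (suc m) d w ⟩
  d * (suc m * w) ∎
  where
  open ≤-Reasoning
  comm3 : ∀ a b c → a * (b * c) ≡ b * (a * c)
  comm3 = solve-∀
  main : ∀ d → x + d ≡ suc m → m * X ≤ d * w → m * Y ≤ (d ∸ 1) * w → m * (x * X + d * Y) ≤ m * (d * w)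
  main zero eq hX hY = begin
    m * (x * X + 0) ≡⟨ cong (m *_) (+-identityʳ _) ⟩
    m * (x * X) ≡⟨ comm3 m x X ⟩
    x * (m * X) ≤⟨ *-monoʳ-≤ x hX ⟩
    x * 0 ≡⟨ *-zeroʳ x ⟩
    0 ≤⟨ z≤n ⟩
    m * 0 ∎
  main (suc d) eq hX hY = begin
    m * (x * X + suc d * Y) ≡⟨ distr m x X (suc d) Y ⟩
    x * (m * X) + suc d * (m * Y) ≤⟨ +-mono-≤ (*-monoʳ-≤ x hX) (*-monoʳ-≤ (suc d) hY) ⟩
    x * (suc d * w) + suc d * (d * w) ≡⟨ collect x (suc d) d w ⟩
    (x + d) * (suc d * w) ≡⟨ cong (_* (suc d * w)) (suc-injective (trans (sym (+-suc x d)) eq)) ⟩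
    m * (suc d * w) ∎
    where
    distr : ∀ m x X d Y → m * (x * X + d * Y) ≡ x * (m * X) + d * (m * Y)
    distr = solve-∀
    collect : ∀ x s d w → x * (s * w) + s * (d * w) ≡ (x + d) * (s * w)
    collect = solve-∀
  core : y ≡ d ⊎ x ≡ 0 → x * X + y * Y ≤ d * w
  core (inj₁ refl) = *-cancelˡ-≤ m {{>-nonZero 1≤m}} (main d x+y≡ mX≤ mY≤)
  core (inj₂ refl) = *-mono-≤ y≤d Y≤w

U≤w : ∀ {n} (v : Subset n) e d → U v e d ≤ w v
U≤w {n} v e d = ∑-mono (Ω n) (λ c → 𝟙-mono (On? c v ×-dec e ∈? at c (∣ v ∣ + d)) (On? c v) proj₁)

V≤w : ∀ {n} (v : Subset n) e d → V v e d ≤ w v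
V≤w {n} v e d = ∑-mono (Ω n) (λ c → 𝟙-mono (On? c v ×-dec ¬? (e ∈? at c (∣ v ∣ ∸ d))) (On? c v) proj₁)

e∉v⇒∣v∣<n : ∀ {n} {e : Fin n} {v} → e ∉ v → ∣ v ∣ < n
e∉v⇒∣v∣<n {n} {e} {v} e∉v = ≤∧≢⇒< (∣p∣≤n v) (λ eq → e∉v (subst (e ∈_) (sym (∣p∣≡n⇒p≡⊤ eq)) ∈⊤))
  where open import Data.Fin.Subset.Properties using (∣p∣≡n⇒p≡⊤; ∈⊤)

e∈v⇒0<∣v∣ : ∀ {n} {e : Fin n} {v} → e ∈ v → 0 < ∣ v ∣
e∈v⇒0<∣v∣ {v = inside  ∷ v} _          = s≤s z≤n
e∈v⇒0<∣v∣ {v = outside ∷ v} (there e∈) = e∈v⇒0<∣v∣ e∈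

window : ∀ {M d x y} → x ≡ M ∸ d → x + y ≡ M → y ≤ d × (y ≡ d ⊎ x ≡ 0)
window {M} {d} {x} {y} x≡ x+y≡M with ≤-total d M
... | inj₁ d≤M = ≤-reflexive y≡d , inj₁ y≡d
  where
  y≡d : y ≡ d
  y≡d = +-cancelˡ-≡ x y d (trans x+y≡M (sym (trans (cong (_+ d) x≡) (m∸n+n≡m d≤M))))
... | inj₂ M≤d = ≤-trans (m≤n+m y x) (≤-trans (≤-reflexive x+y≡M) M≤d) , inj₂ (trans x≡ (m≤n⇒m∸n≡0 M≤d))

comm3 : ∀ a b c → a * (b * c) ≡ b * (a * c)
comm3 = solve-∀

module _ {n : ℕ} (v : Subset n) (d : ℕ) where

  private
    late? : ∀ i → Dec (∣ v ∣ + d ≤ toℕ {suc n} i)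
    late? i = ∣ v ∣ + d ≤? toℕ i

    early? : ∀ i → Dec (∣ v ∣ ≤ toℕ {suc n} i × toℕ i < ∣ v ∣ + d)
    early? i = ∣ v ∣ ≤? toℕ i ×-dec toℕ i <? ∣ v ∣ + d

    m x y : ℕ
    m = n ∸ ∣ v ∣
    x = suc n ∸ (∣ v ∣ + d)
    y = ∑ (allFin (suc n)) (λ i → 𝟙 (early? i))

    late+early : ∀ i → 𝟙 (late? i) + 𝟙 (early? i) ≡ 𝟙 (∣ v ∣ ≤? toℕ i)
    late+early i with ∣ v ∣ + d ≤? toℕ i
    ... | yes le rewrite 𝟙-no (early? i) (λ (_ , lt) → <⇒≱ lt le) =
          sym (𝟙-yes (∣ v ∣ ≤? toℕ i) (≤-trans (m≤m+n _ d) le))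
    ... | no ¬le = 𝟙-cong (early? i) (∣ v ∣ ≤? toℕ i) proj₁ (λ v≤i → v≤i , ≰⇒> ¬le)

    x+y≡ : x + y ≡ suc m
    x+y≡ = begin
      x + y ≡⟨ cong (_+ y) (#≥ (suc n) (∣ v ∣ + d)) ⟨
      _ ≡⟨ ∑-+ (allFin (suc n)) (λ i → 𝟙 (late? i)) (λ i → 𝟙 (early? i)) ⟨
      _ ≡⟨ ∑-cong (allFin (suc n)) late+early ⟩
      _ ≡⟨ #≥ (suc n) ∣ v ∣ ⟩
      _ ≡⟨ +-∸-assoc 1 (∣p∣≤n v) ⟩
      suc m ∎
      where open ≡-Reasoning

    win : y ≤ d × (y ≡ d ⊎ x ≡ 0)
    win = window (trans (sym (∸-+-assoc (suc n) ∣ v ∣ d)) (cong (_∸ d) (+-∸-assoc 1 (∣p∣≤n v)))) x+y≡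

  U-out-zero : U (outside ∷ v) zero d ≤ d * w v
  U-out-zero = begin
    U (outside ∷ v) zero d ≤⟨ ∑-mono (Ω (suc n)) (λ (i , c) → ≤-trans
      (𝟙-mono (On? (i , c) (outside ∷ v) ×-dec zero ∈? at (i , c) (∣ v ∣ + d)) (early? i ×-dec On? c v)
         (λ (on , 0∈) → (proj₁ (On-out on) , ≰⇒> (λ le → case subst (zero ∈_) (at-≤ le) 0∈ of λ ())) , proj₂ (On-out on)))
      (≤-reflexive (𝟙-× (early? i) (On? c v)))) ⟩
    _ ≡⟨ ∑-Ω-* n (λ i → 𝟙 (early? i)) (λ c → 𝟙 (On? c v)) ⟩
    _ ≤⟨ *-monoˡ-≤ (w v) (proj₁ win) ⟩
    d * w v ∎
    where open ≤-Reasoning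

  module _ (e : Fin n) where

    U-in : U (inside ∷ v) (suc e) d ≤ suc ∣ v ∣ * U v e d
    U-in = begin
      U (inside ∷ v) (suc e) d ≤⟨ ∑-mono (Ω (suc n)) (λ (i , c) → ≤-trans
        (𝟙-mono (On? (i , c) (inside ∷ v) ×-dec suc e ∈? at (i , c) (suc ∣ v ∣ + d))
                (toℕ i <? suc ∣ v ∣ ×-dec (On? c v ×-dec e ∈? at c (∣ v ∣ + d))) impl)
        (≤-reflexive (𝟙-× (toℕ i <? suc ∣ v ∣) (On? c v ×-dec e ∈? at c (∣ v ∣ + d))))) ⟩
      _ ≡⟨ ∑-Ω-* n (λ i → 𝟙 (toℕ i <? suc ∣ v ∣)) (λ c → 𝟙 (On? c v ×-dec e ∈? at c (∣ v ∣ + d))) ⟩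
      _ ≡⟨ cong (_* U v e d) (#< (suc n) (suc ∣ v ∣) (s≤s (∣p∣≤n v))) ⟩
      suc ∣ v ∣ * U v e d ∎
      where
      open ≤-Reasoning
      impl : ∀ {i c} → On (i , c) (inside ∷ v) × suc e ∈ at (i , c) (suc ∣ v ∣ + d) →
             toℕ i < suc ∣ v ∣ × (On c v × e ∈ at c (∣ v ∣ + d))
      impl (on , e∈) with On-in on
      ... | i< , on′ = i< , on′ , drop-there (subst (suc e ∈_) (at-> (<⇒≱ (≤-trans i< (m≤m+n _ d)))) e∈)

    U-out : U (outside ∷ v) (suc e) d ≤ x * U v e d + y * U v e (d ∸ 1)
    U-out = begin
      U (outside ∷ v) (suc e) d ≤⟨ ∑-mono (Ω (suc n)) (λ (i , c) →
        𝟙-⊎ (On? (i , c) (outside ∷ v) ×-dec suc e ∈? at (i , c) (∣ v ∣ + d))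
            (late? i ×-dec hit? d c) (early? i ×-dec hit? (d ∸ 1) c) (cases i c)) ⟩
      _ ≡⟨ ∑-cong (Ω (suc n)) (λ (i , c) → cong₂ _+_ (𝟙-× (late? i) (hit? d c)) (𝟙-× (early? i) (hit? (d ∸ 1) c))) ⟩
      _ ≡⟨ ∑-+ (Ω (suc n)) (λ (i , c) → 𝟙 (late? i) * 𝟙 (hit? d c)) (λ (i , c) → 𝟙 (early? i) * 𝟙 (hit? (d ∸ 1) c)) ⟩
      _ ≡⟨ cong₂ _+_ (∑-Ω-* n (λ i → 𝟙 (late? i)) (λ c → 𝟙 (hit? d c)))
                     (∑-Ω-* n (λ i → 𝟙 (early? i)) (λ c → 𝟙 (hit? (d ∸ 1) c))) ⟩
      _ ≡⟨ cong (λ z → z * U v e d + y * U v e (d ∸ 1)) (#≥ (suc n) (∣ v ∣ + d)) ⟩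
      x * U v e d + y * U v e (d ∸ 1) ∎
      where
      open ≤-Reasoning
      hit? : ∀ d (c : Chain n) → Dec (On c v × e ∈ at c (∣ v ∣ + d))
      hit? d c = On? c v ×-dec e ∈? at c (∣ v ∣ + d)
      cases : ∀ i c → On (i , c) (outside ∷ v) × suc e ∈ at (i , c) (∣ v ∣ + d) →
              (∣ v ∣ + d ≤ toℕ i × On c v × e ∈ at c (∣ v ∣ + d)) ⊎
              ((∣ v ∣ ≤ toℕ i × toℕ i < ∣ v ∣ + d) × On c v × e ∈ at c (∣ v ∣ + (d ∸ 1)))
      cases i c (on , e∈) with On-out on
      ... | v≤i , on′ with ∣ v ∣ + d ≤? toℕ i
      ...   | yes le = inj₁ (le , on′ , drop-there e∈)
      ...   | no ¬le = inj₂ ((v≤i , ≰⇒> ¬le) , on′ , subst (λ j → e ∈ at c j) (shift d (≤-<-trans v≤i (≰⇒> ¬le))) (drop-there e∈))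
        where
        shift : ∀ d → ∣ v ∣ < ∣ v ∣ + d → ∣ v ∣ + d ∸ 1 ≡ ∣ v ∣ + (d ∸ 1)
        shift zero    lt = contradiction (≤-reflexive (+-identityʳ ∣ v ∣)) (<⇒≱ lt)
        shift (suc d) lt = cong (_∸ 1) (+-suc ∣ v ∣ d)

    U-out-bound : e ∉ v → m * U v e d ≤ d * w v → m * U v e (d ∸ 1) ≤ (d ∸ 1) * w v →
                  suc m * U (outside ∷ v) (suc e) d ≤ d * (suc m * w v)
    U-out-bound e∉v ih ih′ = ≤-trans (*-monoʳ-≤ (suc m) U-out)
      (combine {d = d} {x = x} (m<n⇒0<n∸m (e∉v⇒∣v∣<n e∉v)) x+y≡ (proj₁ win) (proj₂ win) ih ih′ (U≤w v e (d ∸ 1)))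

-- On a random chain through v, a given element outside v is among the next d
-- ones with probability at most d / (n − |v|).
hit-up : ∀ {n} (v : Subset n) e d → e ∉ v → (n ∸ ∣ v ∣) * U v e d ≤ d * w v
hit-up {suc n} (inside ∷ v) zero d e∉ = contradiction here e∉
hit-up {suc n} (outside ∷ v) zero d e∉
  rewrite w-out v | +-∸-assoc 1 (∣p∣≤n v) = begin
  suc (n ∸ ∣ v ∣) * U (outside ∷ v) zero d ≤⟨ *-monoʳ-≤ (suc (n ∸ ∣ v ∣)) (U-out-zero v d) ⟩
  suc (n ∸ ∣ v ∣) * (d * w v) ≡⟨ comm3 (suc (n ∸ ∣ v ∣)) d (w v) ⟩
  d * (suc (n ∸ ∣ v ∣) * w v) ∎
  where open ≤-Reasoning
hit-up {suc n} (inside ∷ v) (suc e) d e∉ rewrite w-in v = begin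
  (n ∸ ∣ v ∣) * U (inside ∷ v) (suc e) d ≤⟨ *-monoʳ-≤ (n ∸ ∣ v ∣) (U-in v d e) ⟩
  (n ∸ ∣ v ∣) * (suc ∣ v ∣ * U v e d) ≡⟨ comm3 (n ∸ ∣ v ∣) (suc ∣ v ∣) (U v e d) ⟩
  suc ∣ v ∣ * ((n ∸ ∣ v ∣) * U v e d) ≤⟨ *-monoʳ-≤ (suc ∣ v ∣) (hit-up v e d (e∉ ∘ there)) ⟩
  suc ∣ v ∣ * (d * w v) ≡⟨ comm3 (suc ∣ v ∣) d (w v) ⟩
  d * (suc ∣ v ∣ * w v) ∎
  where open ≤-Reasoning
hit-up {suc n} (outside ∷ v) (suc e) d e∉ rewrite w-out v | +-∸-assoc 1 (∣p∣≤n v) =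
  U-out-bound v d e (e∉ ∘ there) (hit-up v e d (e∉ ∘ there)) (hit-up v e (d ∸ 1) (e∉ ∘ there))

module _ {n : ℕ} (v : Subset n) (d : ℕ) where

  private
    m x y : ℕ
    m = ∣ v ∣

    low? : ∀ i → Dec (toℕ {suc n} i < suc m ∸ d)
    low? i = toℕ i <? suc m ∸ d

    high? : ∀ i → Dec (suc m ∸ d ≤ toℕ {suc n} i × toℕ i < suc m)
    high? i = suc m ∸ d ≤? toℕ i ×-dec toℕ i <? suc m

    x = suc m ∸ d
    y = ∑ (allFin (suc n)) (λ i → 𝟙 (high? i))

    low+high : ∀ i → 𝟙 (low? i) + 𝟙 (high? i) ≡ 𝟙 (toℕ i <? suc m)
    low+high i with suc m ∸ d ≤? toℕ i
    ... | yes le rewrite 𝟙-no (low? i) (≤⇒≯ le) = 𝟙-cong (yes le ×-dec toℕ i <? suc m) (toℕ i <? suc m) proj₂ (le ,_)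
    ... | no ¬le = trans (+-identityʳ _) (𝟙-cong (low? i) (toℕ i <? suc m) (λ lt → ≤-trans lt (m∸n≤m (suc m) d)) (λ _ → ≰⇒> ¬le))

    #low : ∑ (allFin (suc n)) (λ i → 𝟙 (low? i)) ≡ x
    #low = #< (suc n) (suc m ∸ d) (≤-trans (m∸n≤m (suc m) d) (s≤s (∣p∣≤n v)))

    x+y≡ : x + y ≡ suc m
    x+y≡ = begin
      x + y ≡⟨ cong (_+ y) #low ⟨
      _ ≡⟨ ∑-+ (allFin (suc n)) (λ i → 𝟙 (low? i)) (λ i → 𝟙 (high? i)) ⟨
      _ ≡⟨ ∑-cong (allFin (suc n)) low+high ⟩
      _ ≡⟨ #< (suc n) (suc m) (s≤s (∣p∣≤n v)) ⟩
      suc m ∎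
      where open ≡-Reasoning

    win : y ≤ d × (y ≡ d ⊎ x ≡ 0)
    win = window refl x+y≡

  V-in-zero : V (inside ∷ v) zero d ≤ d * w v
  V-in-zero = begin
    V (inside ∷ v) zero d ≤⟨ ∑-mono (Ω (suc n)) (λ (i , c) → ≤-trans
      (𝟙-mono (On? (i , c) (inside ∷ v) ×-dec ¬? (zero ∈? at (i , c) (suc m ∸ d))) (high? i ×-dec On? c v)
         (λ (on , 0∉) → (≮⇒≥ (λ lt → 0∉ (subst (zero ∈_) (sym (at-> (<⇒≱ lt))) here)) , proj₁ (On-in on)) , proj₂ (On-in on)))
      (≤-reflexive (𝟙-× (high? i) (On? c v)))) ⟩
    _ ≡⟨ ∑-Ω-* n (λ i → 𝟙 (high? i)) (λ c → 𝟙 (On? c v)) ⟩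
    _ ≤⟨ *-monoˡ-≤ (w v) (proj₁ win) ⟩
    d * w v ∎
    where open ≤-Reasoning

  module _ (e : Fin n) where

    private
      miss? : ∀ d (c : Chain n) → Dec (On c v × e ∉ at c (m ∸ d))
      miss? d c = On? c v ×-dec ¬? (e ∈? at c (m ∸ d))

    V-out : V (outside ∷ v) (suc e) d ≤ suc (n ∸ m) * V v e d
    V-out = begin
      V (outside ∷ v) (suc e) d ≤⟨ ∑-mono (Ω (suc n)) (λ (i , c) → ≤-trans
        (𝟙-mono (On? (i , c) (outside ∷ v) ×-dec ¬? (suc e ∈? at (i , c) (m ∸ d)))
                (m ≤? toℕ i ×-dec miss? d c) impl)
        (≤-reflexive (𝟙-× (m ≤? toℕ i) (miss? d c)))) ⟩
      _ ≡⟨ ∑-Ω-* n (λ i → 𝟙 (m ≤? toℕ i)) (λ c → 𝟙 (miss? d c)) ⟩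
      _ ≡⟨ cong (_* V v e d) (trans (#≥ (suc n) m) (+-∸-assoc 1 (∣p∣≤n v))) ⟩
      suc (n ∸ m) * V v e d ∎
      where
      open ≤-Reasoning
      impl : ∀ {i c} → On (i , c) (outside ∷ v) × suc e ∉ at (i , c) (m ∸ d) →
             m ≤ toℕ i × (On c v × e ∉ at c (m ∸ d))
      impl (on , e∉) with On-out on
      ... | m≤i , on′ = m≤i , on′ , (λ e∈ → e∉ (subst (suc e ∈_) (sym (at-≤ (≤-trans (m∸n≤m m d) m≤i))) (there e∈)))

    V-in : V (inside ∷ v) (suc e) d ≤ x * V v e d + y * V v e (d ∸ 1)
    V-in = begin
      V (inside ∷ v) (suc e) d ≤⟨ ∑-mono (Ω (suc n)) (λ (i , c) →
        𝟙-⊎ (On? (i , c) (inside ∷ v) ×-dec ¬? (suc e ∈? at (i , c) (suc m ∸ d)))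
            (low? i ×-dec miss? d c) (high? i ×-dec miss? (d ∸ 1) c) (cases i c)) ⟩
      _ ≡⟨ ∑-cong (Ω (suc n)) (λ (i , c) → cong₂ _+_ (𝟙-× (low? i) (miss? d c)) (𝟙-× (high? i) (miss? (d ∸ 1) c))) ⟩
      _ ≡⟨ ∑-+ (Ω (suc n)) (λ (i , c) → 𝟙 (low? i) * 𝟙 (miss? d c)) (λ (i , c) → 𝟙 (high? i) * 𝟙 (miss? (d ∸ 1) c)) ⟩
      _ ≡⟨ cong₂ _+_ (∑-Ω-* n (λ i → 𝟙 (low? i)) (λ c → 𝟙 (miss? d c)))
                     (∑-Ω-* n (λ i → 𝟙 (high? i)) (λ c → 𝟙 (miss? (d ∸ 1) c))) ⟩
      _ ≡⟨ cong (λ z → z * V v e d + y * V v e (d ∸ 1)) #low ⟩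
      x * V v e d + y * V v e (d ∸ 1) ∎
      where
      open ≤-Reasoning
      cases : ∀ i c → On (i , c) (inside ∷ v) × suc e ∉ at (i , c) (suc m ∸ d) →
              (toℕ i < suc m ∸ d × On c v × e ∉ at c (m ∸ d)) ⊎
              ((suc m ∸ d ≤ toℕ i × toℕ i < suc m) × On c v × e ∉ at c (m ∸ (d ∸ 1)))
      cases i c (on , e∉) with On-in on
      ... | i≤m , on′ with suc m ∸ d ≤? toℕ i
      ...   | no ¬le = inj₁ (≰⇒> ¬le , on′ , λ e∈ → e∉ (there (subst (λ j → e ∈ at c j) (sym (shift d)) e∈)))
        where
        shift : ∀ d → suc m ∸ d ∸ 1 ≡ m ∸ d
        shift d = trans (∸-+-assoc (suc m) d 1) (cong (suc m ∸_) (+-comm d 1))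
      ...   | yes le = inj₂ ((le , i≤m) , on′ , λ e∈ → e∉ (there (subst (λ j → e ∈ at c j) (sym (shift d (≤-<-trans le i≤m))) e∈)))
        where
        shift : ∀ d → suc m ∸ d < suc m → suc m ∸ d ≡ m ∸ (d ∸ 1)
        shift zero    lt = contradiction lt (<-irrefl refl)
        shift (suc d) lt = refl

    V-in-bound : e ∈ v → m * V v e d ≤ d * w v → m * V v e (d ∸ 1) ≤ (d ∸ 1) * w v →
                 suc m * V (inside ∷ v) (suc e) d ≤ d * (suc m * w v)
    V-in-bound e∈v ih ih′ = ≤-trans (*-monoʳ-≤ (suc m) V-in)
      (combine {d = d} {x = x} (e∈v⇒0<∣v∣ e∈v) x+y≡ (proj₁ win) (proj₂ win) ih ih′ (V≤w v e (d ∸ 1)))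

-- The mirror image of `hit-up`: the same induction, with the window formed by the last `d` elements
-- that entered before `v` was complete.
hit-down : ∀ {n} (v : Subset n) e d → e ∈ v → ∣ v ∣ * V v e d ≤ d * w v
hit-down {suc n} (inside ∷ v) zero d e∈ rewrite w-in v =
  ≤-trans (*-monoʳ-≤ (suc ∣ v ∣) (V-in-zero v d)) (≤-reflexive (comm3 (suc ∣ v ∣) d (w v)))
hit-down {suc n} (outside ∷ v) (suc e) d (there e∈) rewrite w-out v = begin
  ∣ v ∣ * V (outside ∷ v) (suc e) d ≤⟨ *-monoʳ-≤ ∣ v ∣ (V-out v d e) ⟩
  ∣ v ∣ * (suc (n ∸ ∣ v ∣) * V v e d) ≡⟨ comm3 ∣ v ∣ (suc (n ∸ ∣ v ∣)) (V v e d) ⟩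
  suc (n ∸ ∣ v ∣) * (∣ v ∣ * V v e d) ≤⟨ *-monoʳ-≤ (suc (n ∸ ∣ v ∣)) (hit-down v e d e∈) ⟩
  suc (n ∸ ∣ v ∣) * (d * w v) ≡⟨ comm3 (suc (n ∸ ∣ v ∣)) d (w v) ⟩
  d * (suc (n ∸ ∣ v ∣) * w v) ∎
  where open ≤-Reasoning
hit-down {suc n} (inside ∷ v) (suc e) d (there e∈) rewrite w-in v =
  V-in-bound v d e e∈ (hit-down v e d e∈) (hit-down v e (d ∸ 1) e∈)

-- Families, weights and close pairs

subsets : ∀ n → List (Subset n)
subsets zero    = [] ∷ []
subsets (suc n) = map (outside ∷_) (subsets n) ++ map (inside ∷_) (subsets n)

∈-subsets : ∀ {n} (v : Subset n) → v ∈ˡ subsets n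
∈-subsets []            = here refl
∈-subsets (outside ∷ v) = ∈-++⁺ˡ (∈-map⁺ (outside ∷_) (∈-subsets v))
∈-subsets (inside  ∷ v) = ∈-++⁺ʳ _ (∈-map⁺ (inside ∷_) (∈-subsets v))

subsets-unique : ∀ n → Unique (subsets n)
subsets-unique zero    = [] ∷ []
subsets-unique (suc n) = ++⁺ (map⁺ (cong Data.Vec.tail) (subsets-unique n)) (map⁺ (cong Data.Vec.tail) (subsets-unique n)) disjoint
  where
  open import Data.List.Relation.Unary.Unique.Propositional.Properties using (++⁺; map⁺)
  disjoint : ∀ {v} → ¬ (v ∈ˡ map (outside ∷_) (subsets n) × v ∈ˡ map (inside ∷_) (subsets n))
  disjoint (v∈ , v∈′) with ∈-map⁻ (outside ∷_) v∈ | ∈-map⁻ (inside ∷_) v∈′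
  ... | _ , _ , refl | _ , _ , ()

length-subsets : ∀ n → length (subsets n) ≡ 2 ^ n
length-subsets zero    = refl
length-subsets (suc n) = begin
  length (map (outside ∷_) (subsets n) ++ map (inside ∷_) (subsets n)) ≡⟨ length-++ (map (outside ∷_) (subsets n)) ⟩
  _ ≡⟨ cong₂ _+_ (length-map (outside ∷_) (subsets n)) (length-map (inside ∷_) (subsets n)) ⟩
  length (subsets n) + length (subsets n) ≡⟨ cong₂ _+_ (length-subsets n) (trans (length-subsets n) (sym (+-identityʳ _))) ⟩
  2 ^ n + (2 ^ n + 0) ∎
  where open ≡-Reasoning

_∈F?_ : ∀ {n} (v : Subset n) (C : Family n) → Dec (v ∈F C)
v ∈F? C = C v Bool.≟ true

_⊆F_ : ∀ {n} → Family n → Family n → Set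
C ⊆F C′ = ∀ {v} → v ∈F C → v ∈F C′

_∪F_ _∩F_ : ∀ {n} → Family n → Family n → Family n
(C ∪F C′) v = C v ∨ C′ v
(C ∩F C′) v = C v ∧ C′ v

∨-true⁻ : ∀ {a b} → a ∨ b ≡ true → a ≡ true ⊎ b ≡ true
∨-true⁻ {true}  _ = inj₁ refl
∨-true⁻ {false} h = inj₂ h

∨-trueˡ : ∀ {a b} → a ≡ true → a ∨ b ≡ true
∨-trueˡ refl = refl

∨-trueʳ : ∀ {a b} → b ≡ true → a ∨ b ≡ true
∨-trueʳ {true}  refl = refl
∨-trueʳ {false} refl = refl

∧-true⁺ : ∀ {a b} → a ≡ true → b ≡ true → a ∧ b ≡ true
∧-true⁺ refl refl = refl

∑ᶠ : ∀ {n} → Family n → (Subset n → ℕ) → ℕ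
∑ᶠ {n} C f = ∑ (subsets n) (λ v → 𝟙 (v ∈F? C) * f v)

module _ {n : ℕ} where

  private
    S = subsets n

  ∑ᶠ-mono : ∀ (C : Family n) {f g : Subset n → ℕ} → (∀ v → v ∈F C → f v ≤ g v) → ∑ᶠ C f ≤ ∑ᶠ C g
  ∑ᶠ-mono C {f} {g} f≤g = ∑-mono S λ v → lemma v
    where
    lemma : ∀ v → 𝟙 (v ∈F? C) * f v ≤ 𝟙 (v ∈F? C) * g v
    lemma v with v ∈F? C
    ... | yes v∈ = *-monoʳ-≤ 1 (f≤g v v∈)
    ... | no _   = z≤n

  ∑ᶠ-⊆ : ∀ {C C′ : Family n} (f : Subset n → ℕ) → C ⊆F C′ → ∑ᶠ C f ≤ ∑ᶠ C′ f
  ∑ᶠ-⊆ {C} {C′} f C⊆C′ = ∑-mono S (λ v → *-monoˡ-≤ (f v) (𝟙-mono (v ∈F? C) (v ∈F? C′) C⊆C′))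

  ∑ᶠ-+ : ∀ (C : Family n) (f g : Subset n → ℕ) → ∑ᶠ C (λ v → f v + g v) ≡ ∑ᶠ C f + ∑ᶠ C g
  ∑ᶠ-+ C f g = trans (∑-cong S (λ v → *-distribˡ-+ (𝟙 (v ∈F? C)) (f v) (g v))) (∑-+ S _ _)

  ∑ᶠ-*ˡ : ∀ (C : Family n) a (f : Subset n → ℕ) → ∑ᶠ C (λ v → a * f v) ≡ a * ∑ᶠ C f
  ∑ᶠ-*ˡ C a f = trans (∑-cong S (λ v → comm3 (𝟙 (v ∈F? C)) a (f v))) (∑-*ˡ S a _)

  ∑ᶠ-swap : ∀ (C : Family n) (xs : List A) (f : Subset n → A → ℕ) →
            ∑ᶠ C (λ v → ∑ xs (f v)) ≡ ∑ xs (λ x → ∑ᶠ C (λ v → f v x))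
  ∑ᶠ-swap C xs f = trans (∑-cong S (λ v → sym (∑-*ˡ xs (𝟙 (v ∈F? C)) (f v))))
                         (∑-swap S xs (λ v x → 𝟙 (v ∈F? C) * f v x))

  ∑ᶠ-∪ : ∀ (C C′ : Family n) (f : Subset n → ℕ) → ∑ᶠ (C ∪F C′) f ≤ ∑ᶠ C f + ∑ᶠ C′ f
  ∑ᶠ-∪ C C′ f = begin
    ∑ᶠ (C ∪F C′) f ≤⟨ ∑-mono S (λ v → *-monoˡ-≤ (f v) (𝟙-⊎ (v ∈F? (C ∪F C′)) (v ∈F? C) (v ∈F? C′) ∨-true⁻)) ⟩
    _ ≡⟨ ∑-cong S (λ v → *-distribʳ-+ (f v) (𝟙 (v ∈F? C)) (𝟙 (v ∈F? C′))) ⟩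
    _ ≡⟨ ∑-+ S _ _ ⟩
    ∑ᶠ C f + ∑ᶠ C′ f ∎
    where open ≤-Reasoning

-- `mass C` divided by `n !` is the Lubell function of `C`, the expected number of members of `C` on
-- a random maximal chain.
mass count : ∀ {n} → Family n → ℕ
mass  C = ∑ᶠ C w
count C = ∑ᶠ C (λ _ → 1)

Close : ∀ {n} → ℕ → Subset n → Subset n → Set
Close D v y = ∣ v ∣ < ∣ y ∣ × ∣ y ∣ ≤ ∣ v ∣ + D

Close? : ∀ {n} D (v y : Subset n) → Dec (Close D v y)
Close? D v y = ∣ v ∣ <? ∣ y ∣ ×-dec ∣ y ∣ ≤? ∣ v ∣ + D

module _ {n : ℕ} (D : ℕ) (R : Family n) (c : Chain n) (v : Subset n) where

  Above Below : Set
  Above = ∃ λ y → y ∈F R × On c y × Close D v y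
  Below = ∃ λ y → y ∈F R × On c y × Close D y v

  Above? : Dec Above
  Above? = anySubset? (λ y → y ∈F? R ×-dec On? c y ×-dec Close? D v y)

  Below? : Dec Below
  Below? = anySubset? (λ y → y ∈F? R ×-dec On? c y ×-dec Close? D y v)

#above #below : ∀ {n} → ℕ → Family n → Subset n → ℕ
#above {n} D R v = ∑ (Ω n) (λ c → 𝟙 (On? c v ×-dec Above? D R c v))
#below {n} D R v = ∑ (Ω n) (λ c → 𝟙 (On? c v ×-dec Below? D R c v))

mass-Ω : ∀ {n} (C : Family n) → mass C ≡ ∑ (Ω n) (λ c → ∑ᶠ C (λ v → 𝟙 (On? c v)))
mass-Ω {n} C = ∑ᶠ-swap C (Ω n) (λ v c → 𝟙 (On? c v))

-- Members of C on a chain that lie in the same class of sl are close, so all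
-- but one of each class have a close predecessor.
mass-≤-classes : ∀ {n} D M (sl : ℕ → ℕ) (C : Family n) →
  (∀ {y} → y ∈F C → sl ∣ y ∣ < M) →
  (∀ {v y} → v ∈F C → y ∈F C → ∣ v ∣ < ∣ y ∣ → sl ∣ v ∣ ≡ sl ∣ y ∣ → ∣ y ∣ ≤ ∣ v ∣ + D) →
  mass C ≤ M * length (Ω n) + ∑ᶠ C (#below D C)
mass-≤-classes {n} D M sl C sl<M same = begin
  mass C ≡⟨ mass-Ω C ⟩
  _ ≤⟨ ∑-mono (Ω n) on-chain ⟩
  _ ≡⟨ ∑-+ (Ω n) (λ _ → M) (λ c → ∑ᶠ C (λ y → 𝟙 (On? c y ×-dec Below? D C c y))) ⟩
  _ ≡⟨ cong₂ _+_ (trans (∑-const (Ω n) M) (*-comm _ M))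
                      (sym (∑ᶠ-swap C (Ω n) (λ y c → 𝟙 (On? c y ×-dec Below? D C c y)))) ⟩
  M * length (Ω n) + ∑ᶠ C (#below D C) ∎
  where
  open ≤-Reasoning
  module _ (c : Chain n) where
    Lonely : Fin M → Subset n → Set
    Lonely s y = (y ∈F C × On c y) × ¬ Below D C c y × toℕ s ≡ sl ∣ y ∣
    Lonely? : ∀ s y → Dec (Lonely s y)
    Lonely? s y = (y ∈F? C ×-dec On? c y) ×-dec ¬? (Below? D C c y) ×-dec toℕ s ≟ sl ∣ y ∣
    lonely-unique : ∀ {s y y′} → Lonely s y → Lonely s y′ → y ≡ y′
    lonely-unique {s} {y} {y′} ((y∈ , on) , ¬b , s≡) ((y′∈ , on′) , ¬b′ , s≡′) with <-cmp ∣ y ∣ ∣ y′ ∣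
    ... | tri< lt _ _ = contradiction (y , y∈ , on , lt , same y∈ y′∈ lt (trans (sym s≡) s≡′)) ¬b′
    ... | tri≈ _ eq _ = On-≡ c on on′ eq
    ... | tri> _ _ gt = contradiction (y′ , y′∈ , on′ , gt , same y′∈ y∈ gt (trans (sym s≡′) s≡)) ¬b
    split : ∀ y → 𝟙 (y ∈F? C) * 𝟙 (On? c y) ≤
                  ∑ (allFin M) (λ s → 𝟙 (Lonely? s y)) + 𝟙 (y ∈F? C) * 𝟙 (On? c y ×-dec Below? D C c y)
    split y = ≤-trans (≤-reflexive (sym (𝟙-× (y ∈F? C) (On? c y)))) (𝟙≤ (y ∈F? C ×-dec On? c y) bound)
      where
      bound : y ∈F C × On c y → 1 ≤ ∑ (allFin M) (λ s → 𝟙 (Lonely? s y)) + 𝟙 (y ∈F? C) * 𝟙 (On? c y ×-dec Below? D C c y)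
      bound (y∈ , on) with Below? D C c y in eq
      ... | yes b rewrite 𝟙-yes (y ∈F? C) y∈ | 𝟙-yes (On? c y ×-dec yes b) (on , b) = m≤n+m 1 _
      ... | no ¬b = ≤-trans (≤-trans (≤-reflexive (sym (𝟙-yes ((y ∈F? C ×-dec On? c y) ×-dec ¬? (no ¬b) ×-dec toℕ s ≟ sl ∣ y ∣)
                               ((y∈ , on) , ¬b , Finₚ.toℕ-fromℕ< (sl<M y∈)))))
                             (∑-≥ (λ s → 𝟙 ((y ∈F? C ×-dec On? c y) ×-dec ¬? (no ¬b) ×-dec toℕ s ≟ sl ∣ y ∣)) (∈-allFin s)))
                        (m≤m+n _ _)
        where s = Data.Fin.fromℕ< (sl<M y∈)
    on-chain : ∑ᶠ C (λ y → 𝟙 (On? c y)) ≤ M + ∑ᶠ C (λ y → 𝟙 (On? c y ×-dec Below? D C c y))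
    on-chain = begin
      _ ≤⟨ ∑-mono (subsets n) split ⟩
      _ ≡⟨ ∑-+ (subsets n) (λ y → ∑ (allFin M) (λ s → 𝟙 (Lonely? s y))) _ ⟩
      _ ≡⟨ cong (_+ _) (∑-swap (subsets n) (allFin M) (λ y s → 𝟙 (Lonely? s y))) ⟩
      _ ≤⟨ +-monoˡ-≤ _ (∑-mono (allFin M) (λ s → ∑𝟙≤ (subsets-unique n) (Lonely? s) (yes tt) (λ _ → tt) lonely-unique)) ⟩
      _ ≡⟨ cong (_+ _) (trans (∑-const (allFin M) 1) (trans (*-identityʳ _) (Data.List.Properties.length-tabulate {n = M} id))) ⟩
      M + ∑ᶠ C (λ y → 𝟙 (On? c y ×-dec Below? D C c y)) ∎

module _ {n : ℕ} (D κ : ℕ) (A : Family n) (U L : Subset n → Family n)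
  (pair : ∀ {c v y} → v ∈F A → y ∈F A → On c v → On c y → Close D v y → y ∈F U v ⊎ v ∈F L y)
  (few-above : ∀ {v} → v ∈F A → n * #above D (U v) v ≤ κ * w v)
  (few-below : ∀ {v} → v ∈F A → n * #below D (L v) v ≤ κ * w v) where

  private
    module OnChain (c : Chain n) where
      -- Only neighbours among the members of `A` on the chain are charged. Each of them determines
      -- the other, so every member pays at most once as the lower and once as the upper one.
      Consecutive : Subset n → Subset n → Set
      Consecutive v y = (v ∈F A × On c v) × (y ∈F A × On c y) × Close D v y ×
                        ¬ (∃ λ u → u ∈F A × On c u × ∣ v ∣ < ∣ u ∣ × ∣ u ∣ < ∣ y ∣)
      Consecutive? : ∀ v y → Dec (Consecutive v y)
      Consecutive? v y = (v ∈F? A ×-dec On? c v) ×-dec (y ∈F? A ×-dec On? c y) ×-dec Close? D v y ×-dec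
        ¬? (anySubset? (λ u → u ∈F? A ×-dec On? c u ×-dec ∣ v ∣ <? ∣ u ∣ ×-dec ∣ u ∣ <? ∣ y ∣))

      predecessor : ∀ fuel v y → ∣ y ∣ ≤ ∣ v ∣ + fuel → v ∈F A × On c v → y ∈F A × On c y → Close D v y →
                    ∃ λ v → Consecutive v y
      predecessor zero v y le _ _ (lt , _) = contradiction (≤-trans le (≤-reflexive (+-identityʳ _))) (<⇒≱ lt)
      predecessor (suc f) v y le pv py cl@(lt , le′)
        with anySubset? (λ u → u ∈F? A ×-dec On? c u ×-dec ∣ v ∣ <? ∣ u ∣ ×-dec ∣ u ∣ <? ∣ y ∣)
      ... | no none = v , pv , py , cl , none
      ... | yes (u , u∈ , onu , v<u , u<y) = predecessor f u y
              (≤-trans le (≤-trans (≤-reflexive (+-suc ∣ v ∣ f)) (+-monoˡ-≤ f v<u)))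
              (u∈ , onu) py (u<y , ≤-trans le′ (+-monoˡ-≤ D (<⇒≤ v<u)))

      unique-pred : ∀ {v v′ y} → Consecutive v y → Consecutive v′ y → v ≡ v′
      unique-pred {v} {v′} ((v∈ , on) , _ , (lt , _) , no-u) ((v′∈ , on′) , _ , (lt′ , _) , no-u′) with <-cmp ∣ v ∣ ∣ v′ ∣
      ... | tri< v< _ _ = contradiction (v′ , v′∈ , on′ , v< , lt′) no-u
      ... | tri≈ _ eq _ = On-≡ c on on′ eq
      ... | tri> _ _ v> = contradiction (v , v∈ , on , v> , lt) no-u′

      unique-succ : ∀ {v y y′} → Consecutive v y → Consecutive v y′ → y ≡ y′
      unique-succ {v} {y} {y′} (_ , (y∈ , on) , (lt , _) , no-u) (_ , (y′∈ , on′) , (lt′ , _) , no-u′) with <-cmp ∣ y ∣ ∣ y′ ∣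
      ... | tri< y< _ _ = contradiction (y , y∈ , on , lt , y<) no-u′
      ... | tri≈ _ eq _ = On-≡ c on on′ eq
      ... | tri> _ _ y> = contradiction (y′ , y′∈ , on′ , lt′ , y>) no-u

      S = subsets n
      up? : ∀ v → Dec (v ∈F A × On c v × Above D (U v) c v)
      up? v = v ∈F? A ×-dec On? c v ×-dec Above? D (U v) c v
      down? : ∀ y → Dec (y ∈F A × On c y × Below D (L y) c y)
      down? y = y ∈F? A ×-dec On? c y ×-dec Below? D (L y) c y

      on-chain : ∑ᶠ A (λ y → 𝟙 (On? c y ×-dec Below? D A c y)) ≤
                 ∑ᶠ A (λ v → 𝟙 (On? c v ×-dec Above? D (U v) c v)) + ∑ᶠ A (λ y → 𝟙 (On? c y ×-dec Below? D (L y) c y))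
      on-chain = begin
        _ ≤⟨ ∑-mono S (λ y → ≤-trans (≤-reflexive (sym (𝟙-× (y ∈F? A) (On? c y ×-dec Below? D A c y)))) (𝟙≤ _ (has-pred y))) ⟩
        _ ≤⟨ ∑-mono S (λ y → ∑-mono S (λ v → 𝟙-⊎ (Consecutive? v y) (Consecutive? v y ×-dec up? v) (Consecutive? v y ×-dec down? y) charge)) ⟩
        _ ≡⟨ ∑-cong S (λ y → ∑-+ S (λ v → 𝟙 (Consecutive? v y ×-dec up? v)) (λ v → 𝟙 (Consecutive? v y ×-dec down? y))) ⟩
        _ ≡⟨ ∑-+ S (λ y → ∑ S (λ v → 𝟙 (Consecutive? v y ×-dec up? v))) (λ y → ∑ S (λ v → 𝟙 (Consecutive? v y ×-dec down? y))) ⟩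
        _ ≡⟨ cong (_+ ∑ S (λ y → ∑ S (λ v → 𝟙 (Consecutive? v y ×-dec down? y)))) (∑-swap S S (λ y v → 𝟙 (Consecutive? v y ×-dec up? v))) ⟩
        _ ≤⟨ +-mono-≤
               (∑-mono S (λ v → ∑𝟙≤ (subsets-unique n) (λ y → Consecutive? v y ×-dec up? v) (up? v) proj₂ (λ (p , _) (q , _) → unique-succ p q)))
               (∑-mono S (λ y → ∑𝟙≤ (subsets-unique n) (λ v → Consecutive? v y ×-dec down? y) (down? y) proj₂ (λ (p , _) (q , _) → unique-pred p q))) ⟩
        _ ≡⟨ cong₂ _+_ (∑-cong S (λ v → 𝟙-× (v ∈F? A) (On? c v ×-dec Above? D (U v) c v)))
                       (∑-cong S (λ y → 𝟙-× (y ∈F? A) (On? c y ×-dec Below? D (L y) c y))) ⟩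
        _ ∎
        where
        open ≤-Reasoning
        has-pred : ∀ y → y ∈F A × On c y × Below D A c y → 1 ≤ ∑ S (λ v → 𝟙 (Consecutive? v y))
        has-pred y (y∈ , on , v , v∈ , onv , cl) with predecessor ∣ y ∣ v y (m≤n+m _ _) (v∈ , onv) (y∈ , on) cl
        ... | v′ , cons = ≤-trans (≤-reflexive (sym (𝟙-yes (Consecutive? v′ y) cons)))
                                  (∑-≥ (λ v → 𝟙 (Consecutive? v y)) (∈-subsets v′))
        charge : ∀ {v y} → Consecutive v y →
                 (Consecutive v y × v ∈F A × On c v × Above D (U v) c v) ⊎ (Consecutive v y × y ∈F A × On c y × Below D (L y) c y)
        charge {v} {y} cons@((v∈ , onv) , (y∈ , ony) , cl , _) with pair v∈ y∈ onv ony cl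
        ... | inj₁ y∈U = inj₁ (cons , v∈ , onv , y , y∈U , ony , cl)
        ... | inj₂ v∈L = inj₂ (cons , y∈ , ony , v , v∈L , onv , cl)

  -- Each chain element of A with a close predecessor is charged either to that
  -- predecessor or to itself.
  close-pairs : n * ∑ᶠ A (#below D A) ≤ 2 * κ * mass A
  close-pairs = begin
    n * ∑ᶠ A (#below D A) ≡⟨ cong (n *_) (∑ᶠ-swap A (Ω n) (λ y c → 𝟙 (On? c y ×-dec Below? D A c y))) ⟩
    _ ≤⟨ *-monoʳ-≤ n (∑-mono (Ω n) OnChain.on-chain) ⟩
    _ ≡⟨ cong (n *_) (∑-+ (Ω n) (λ c → ∑ᶠ A (λ v → 𝟙 (On? c v ×-dec Above? D (U v) c v)))
                                 (λ c → ∑ᶠ A (λ v → 𝟙 (On? c v ×-dec Below? D (L v) c v)))) ⟩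
    _ ≡⟨ cong (n *_) (cong₂ _+_ (∑ᶠ-swap A (Ω n) (λ v c → 𝟙 (On? c v ×-dec Above? D (U v) c v)))
                                (∑ᶠ-swap A (Ω n) (λ v c → 𝟙 (On? c v ×-dec Below? D (L v) c v)))) ⟨
    n * (∑ᶠ A (λ v → #above D (U v) v) + ∑ᶠ A (λ v → #below D (L v) v)) ≡⟨ *-distribˡ-+ n _ _ ⟩
    _ ≡⟨ cong₂ _+_ (∑ᶠ-*ˡ A n (λ v → #above D (U v) v)) (∑ᶠ-*ˡ A n (λ v → #below D (L v) v)) ⟨
    ∑ᶠ A (λ v → n * #above D (U v) v) + ∑ᶠ A (λ v → n * #below D (L v) v)
      ≤⟨ +-mono-≤ (∑ᶠ-mono A (λ v → few-above)) (∑ᶠ-mono A (λ v → few-below)) ⟩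
    _ ≡⟨ cong₂ _+_ (∑ᶠ-*ˡ A κ w) (∑ᶠ-*ˡ A κ w) ⟩
    κ * mass A + κ * mass A ≡⟨ double κ (mass A) ⟩
    2 * κ * mass A ∎
    where
    open ≤-Reasoning
    double : ∀ a b → a * b + a * b ≡ 2 * a * b
    double = solve-∀

⊈⇒∃ : ∀ {n} {p q : Subset n} → ¬ (p ⊆ q) → ∃ λ e → e ∈ p × e ∉ q
⊈⇒∃ {p = p} {q} p⊈q with Finₚ.any? (λ e → e ∈? p ×-dec ¬? (e ∈? q))
... | yes ∃e = ∃e
... | no  ∄e = contradiction (λ {e} e∈p → decidable-stable (e ∈? q) (λ e∉q → ∄e (e , e∈p , e∉q))) p⊈q

#diff : ∀ {n} (v z : Subset n) → v ⊆ z → ∑ (allFin n) (λ e → 𝟙 (e ∈? z ×-dec ¬? (e ∈? v))) + ∣ v ∣ ≡ ∣ z ∣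
#diff []      []      _   = refl
#diff {suc n} (a ∷ v) (b ∷ z) v⊆z = trans (cong (_+ ∣ a ∷ v ∣) (trans (∑-allFin n (λ e → 𝟙 (e ∈? (b ∷ z) ×-dec ¬? (e ∈? (a ∷ v)))))
    (cong (𝟙 (zero ∈? (b ∷ z) ×-dec ¬? (zero ∈? (a ∷ v))) +_) (∑-cong (allFin n) (λ e →
      𝟙-cong (suc e ∈? (b ∷ z) ×-dec ¬? (suc e ∈? (a ∷ v))) (e ∈? z ×-dec ¬? (e ∈? v))
        (λ (p , q) → drop-there p , q ∘ there) (λ (p , q) → there p , q ∘ drop-there))))))
    (head a b v⊆z (#diff v z (drop-∷-⊆ v⊆z)))
  where
  head : ∀ a b {x} → a ∷ v ⊆ b ∷ z → x + ∣ v ∣ ≡ ∣ z ∣ →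
         𝟙 (zero ∈? (b ∷ z) ×-dec ¬? (zero ∈? (a ∷ v))) + x + ∣ a ∷ v ∣ ≡ ∣ b ∷ z ∣
  head true  true  _ eq = trans (+-suc _ _) (cong suc eq)
  head true  false h eq = case h here of λ ()
  head false true  _ eq = cong suc eq
  head false false _ eq = eq

module _ {n : ℕ} (v z : Subset n) where

  -- The next element of the chain has to be one of the `∣ z ∣ ∸ ∣ v ∣` elements that `z` has beyond
  -- `v`, and `hit-up` with `d = 1` bounds the probability of each.
  first-up : v ⊆ z → (n ∸ ∣ v ∣) * ∑ (Ω n) (λ c → 𝟙 (On? c v ×-dec at c (suc ∣ v ∣) ⊆? z)) ≤ (∣ z ∣ ∸ ∣ v ∣) * w v
  first-up v⊆z with ∣ v ∣ <? n
  ... | no ≮ rewrite m≤n⇒m∸n≡0 (≮⇒≥ ≮) = z≤n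
  ... | yes v<n = begin
    (n ∸ ∣ v ∣) * _ ≤⟨ *-monoʳ-≤ (n ∸ ∣ v ∣) (∑-mono (Ω n) (λ c → 𝟙≤ (On? c v ×-dec at c (suc ∣ v ∣) ⊆? z) (new c))) ⟩
    _ ≡⟨ cong ((n ∸ ∣ v ∣) *_) (∑-swap (Ω n) (allFin n) _) ⟩
    _ ≡⟨ ∑-*ˡ (allFin n) (n ∸ ∣ v ∣) _ ⟨
    _ ≤⟨ ∑-mono (allFin n) term ⟩
    _ ≡⟨ ∑-*ʳ (allFin n) (w v) (λ e → 𝟙 (new? e)) ⟩
    ∑ (allFin n) (λ e → 𝟙 (new? e)) * w v ≡⟨ cong (_* w v) (sym (trans (cong (_∸ ∣ v ∣) (sym (#diff v z v⊆z))) (m+n∸n≡m _ ∣ v ∣))) ⟩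
    (∣ z ∣ ∸ ∣ v ∣) * w v ∎
    where
    open ≤-Reasoning
    new? : ∀ e → Dec (e ∈ z × e ∉ v)
    new? e = e ∈? z ×-dec ¬? (e ∈? v)
    hit? : ∀ e c → Dec (On c v × e ∈ at c (∣ v ∣ + 1))
    hit? e c = On? c v ×-dec e ∈? at c (∣ v ∣ + 1)
    new : ∀ c → On c v × at c (suc ∣ v ∣) ⊆ z → 1 ≤ ∑ (allFin n) (λ e → 𝟙 (new? e) * 𝟙 (hit? e c))
    new c (on , at⊆z) with ⊈⇒∃ {p = at c (suc ∣ v ∣)} {v}
             (λ sub → 1+n≰n (≤-trans (≤-reflexive (sym (∣at∣ c (suc ∣ v ∣) v<n))) (p⊆q⇒∣p∣≤∣q∣ sub)))
    ... | e , e∈ , e∉ = ≤-trans (≤-reflexive (sym (cong₂ _*_ (𝟙-yes (new? e) (at⊆z e∈ , e∉))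
                           (𝟙-yes (hit? e c) (on , subst (λ j → e ∈ at c j) (+-comm 1 ∣ v ∣) e∈)))))
                         (∑-≥ (λ e → 𝟙 (new? e) * 𝟙 (hit? e c)) (∈-allFin e))
    term : ∀ e → (n ∸ ∣ v ∣) * ∑ (Ω n) (λ c → 𝟙 (new? e) * 𝟙 (hit? e c)) ≤ 𝟙 (new? e) * w v
    term e with new? e
    ... | no _ = ≤-reflexive (trans (cong ((n ∸ ∣ v ∣) *_) (∑-zero (Ω n))) (*-zeroʳ (n ∸ ∣ v ∣)))
    ... | yes (_ , e∉) = ≤-trans (≤-reflexive (cong ((n ∸ ∣ v ∣) *_) (∑-cong (Ω n) (λ c → +-identityʳ _)))) (hit-up v e 1 e∉)

  first-down : z ⊆ v → ∣ v ∣ * ∑ (Ω n) (λ c → 𝟙 (On? c v ×-dec z ⊆? at c (∣ v ∣ ∸ 1))) ≤ (∣ v ∣ ∸ ∣ z ∣) * w v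
  first-down z⊆v with 0 <? ∣ v ∣
  ... | no ≮ rewrite n≤0⇒n≡0 (≮⇒≥ ≮) = z≤n
  ... | yes 0<v = begin
    ∣ v ∣ * _ ≤⟨ *-monoʳ-≤ ∣ v ∣ (∑-mono (Ω n) (λ c → 𝟙≤ (On? c v ×-dec z ⊆? at c (∣ v ∣ ∸ 1)) (lost c))) ⟩
    _ ≡⟨ cong (∣ v ∣ *_) (∑-swap (Ω n) (allFin n) _) ⟩
    _ ≡⟨ ∑-*ˡ (allFin n) ∣ v ∣ _ ⟨
    _ ≤⟨ ∑-mono (allFin n) term ⟩
    _ ≡⟨ ∑-*ʳ (allFin n) (w v) (λ e → 𝟙 (lost? e)) ⟩
    ∑ (allFin n) (λ e → 𝟙 (lost? e)) * w v ≡⟨ cong (_* w v) (sym (trans (cong (_∸ ∣ z ∣) (sym (#diff z v z⊆v))) (m+n∸n≡m _ ∣ z ∣))) ⟩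
    (∣ v ∣ ∸ ∣ z ∣) * w v ∎
    where
    open ≤-Reasoning
    lost? : ∀ e → Dec (e ∈ v × e ∉ z)
    lost? e = e ∈? v ×-dec ¬? (e ∈? z)
    miss? : ∀ e c → Dec (On c v × e ∉ at c (∣ v ∣ ∸ 1))
    miss? e c = On? c v ×-dec ¬? (e ∈? at c (∣ v ∣ ∸ 1))
    lost : ∀ c → On c v × z ⊆ at c (∣ v ∣ ∸ 1) → 1 ≤ ∑ (allFin n) (λ e → 𝟙 (lost? e) * 𝟙 (miss? e c))
    lost c (on , z⊆at) with ⊈⇒∃ {p = v} {at c (∣ v ∣ ∸ 1)}
             (λ sub → <⇒≱ (∸-monoʳ-< {∣ v ∣} {1} {0} (s≤s z≤n) 0<v)
                (≤-trans (p⊆q⇒∣p∣≤∣q∣ sub) (≤-reflexive (∣at∣ c (∣ v ∣ ∸ 1) (≤-trans (m∸n≤m ∣ v ∣ 1) (∣p∣≤n v))))))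
    ... | e , e∈ , e∉ = ≤-trans (≤-reflexive (sym (cong₂ _*_ (𝟙-yes (lost? e) (e∈ , e∉ ∘ z⊆at)) (𝟙-yes (miss? e c) (on , e∉)))))
                         (∑-≥ (λ e → 𝟙 (lost? e) * 𝟙 (miss? e c)) (∈-allFin e))
    term : ∀ e → ∣ v ∣ * ∑ (Ω n) (λ c → 𝟙 (lost? e) * 𝟙 (miss? e c)) ≤ 𝟙 (lost? e) * w v
    term e with lost? e
    ... | no _ = ≤-reflexive (trans (cong (∣ v ∣ *_) (∑-zero (Ω n))) (*-zeroʳ ∣ v ∣))
    ... | yes (e∈ , _) = ≤-trans (≤-reflexive (cong (∣ v ∣ *_) (∑-cong (Ω n) (λ c → +-identityʳ _)))) (hit-down v e 1 e∈)

-- Rich sets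

module Levels {n : ℕ} (D t k : ℕ) (F : Family n)
  (mid : ∀ {v} → v ∈F F → n ≤ 3 * (n ∸ ∣ v ∣) × n ≤ 3 * ∣ v ∣) where

  -- K D / n bounds the probability that, within D steps, a chain through v does
  -- something that conflicts with one of t sets at distance at most k D.
  K : ℕ
  K = 3 * (t * suc k)

  UpRich DownRich : Subset n → Family n → Set
  UpRich   v R = K * D * w v < n * #above D R v
  DownRich v R = K * D * w v < n * #below D R v

  UpRich? : ∀ v R → Dec (UpRich v R)
  UpRich? v R = K * D * w v <? n * #above D R v

  DownRich? : ∀ v R → Dec (DownRich v R)
  DownRich? v R = K * D * w v <? n * #below D R v

  -- A union bound over `Q`. In `K`, the 3 passes from `m` to `n`, `t` is the number of sets in `Q`,
  -- and `suc k` bounds the conflict with a single set in units of `D / m`. Richness exceeds the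
  -- total, so some chain is good and conflicts with no set of `Q`.
  avoid : ∀ {v : Subset n} m (Q : List (Subset n)) {Good : Chain n → Set} (Good? : ∀ c → Dec (Good c))
          {Bad : Subset n → Chain n → Set} (Bad? : ∀ z c → Dec (Bad z c)) →
          n ≤ 3 * m → length Q ≤ t →
          (∀ {z} → z ∈ˡ Q → m * ∑ (Ω n) (λ c → 𝟙 (Bad? z c)) ≤ suc k * D * w v) →
          K * D * w v < n * ∑ (Ω n) (λ c → 𝟙 (Good? c)) →
          ∃ λ c → Good c × (∀ {z} → z ∈ˡ Q → ¬ Bad z c)
  avoid {v} m Q {Good} Good? {Bad} Bad? n≤3m ∣Q∣≤t bad≤ good> =
    conclude (∑-<⇒∃ (Ω n) {λ c → ∑ Q (λ z → 𝟙 (Bad? z c))} {λ c → 𝟙 (Good? c)} (*-cancelˡ-< n _ _ (≤-<-trans total good>)))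
    where
    open ≤-Reasoning
    rearrange : ∀ t s D w → 3 * (t * (s * D * w)) ≡ 3 * (t * s) * D * w
    rearrange = solve-∀
    total : n * ∑ (Ω n) (λ c → ∑ Q (λ z → 𝟙 (Bad? z c))) ≤ K * D * w v
    total = begin
      n * ∑ (Ω n) (λ c → ∑ Q (λ z → 𝟙 (Bad? z c))) ≡⟨ cong (n *_) (∑-swap (Ω n) Q (λ c z → 𝟙 (Bad? z c))) ⟩
      n * ∑ Q (λ z → ∑ (Ω n) (λ c → 𝟙 (Bad? z c))) ≤⟨ *-monoˡ-≤ _ n≤3m ⟩
      3 * m * ∑ Q (λ z → ∑ (Ω n) (λ c → 𝟙 (Bad? z c))) ≡⟨ *-assoc 3 m _ ⟩
      3 * (m * ∑ Q (λ z → ∑ (Ω n) (λ c → 𝟙 (Bad? z c)))) ≡⟨ cong (3 *_) (∑-*ˡ Q m _) ⟨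
      3 * ∑ Q (λ z → m * ∑ (Ω n) (λ c → 𝟙 (Bad? z c))) ≤⟨ *-monoʳ-≤ 3 (∑-mono∈ Q (λ z → bad≤)) ⟩
      3 * ∑ Q (λ z → suc k * D * w v) ≡⟨ cong (3 *_) (∑-const Q _) ⟩
      3 * (length Q * (suc k * D * w v)) ≤⟨ *-monoʳ-≤ 3 (*-monoˡ-≤ (suc k * D * w v) ∣Q∣≤t) ⟩
      3 * (t * (suc k * D * w v)) ≡⟨ rearrange t (suc k) D (w v) ⟩
      K * D * w v ∎
    conclude : (∃ λ c → ∑ Q (λ z → 𝟙 (Bad? z c)) < 𝟙 (Good? c)) → ∃ λ c → Good c × (∀ {z} → z ∈ˡ Q → ¬ Bad z c)
    conclude (c , lt) = c , 𝟙-pos (Good? c) (≤-<-trans z≤n lt) , λ {z} z∈ bad →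
        <⇒≱ (<-≤-trans lt (𝟙≤1 (Good? c)))
            (≤-trans (≤-reflexive (sym (𝟙-yes (Bad? z c) bad))) (∑-≥ (λ z → 𝟙 (Bad? z c)) z∈))

  -- Two conflicts are excluded for each `z`. Absorbing a `z` that is not below `v` means hitting a
  -- fixed element of `z` within `D` steps. Staying inside a `z` above `v` already requires the
  -- first step to stay inside, which is unlikely because `z` exceeds `v` by at most `k * D`
  -- elements. These are the summands 1 and `k` of `suc k`.
  step-up : ∀ {v R} (Q : List (Subset n)) → n ≤ 3 * (n ∸ ∣ v ∣) → length Q ≤ t →
            (∀ {z} → z ∈ˡ Q → v ⊆ z → ∣ z ∣ ≤ ∣ v ∣ + k * D) → UpRich v R →
            ∃ λ y → y ∈F R × v ⊆ y × ∣ v ∣ < ∣ y ∣ × ∣ y ∣ ≤ ∣ v ∣ + D ×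
                    (∀ {z} → z ∈ˡ Q → (z ⊆ y → z ⊆ v) × ¬ (y ⊆ z))
  step-up {v} {R} Q m ∣Q∣≤t near rich =
    conclude (avoid {v} (n ∸ ∣ v ∣) Q (λ c → On? c v ×-dec Above? D R c v) Bad? m ∣Q∣≤t bad≤ rich)
    where
    engulf? : ∀ z c → Dec (On c v × ¬ (z ⊆ v) × z ⊆ at c (∣ v ∣ + D))
    engulf? z c = On? c v ×-dec ¬? (z ⊆? v) ×-dec z ⊆? at c (∣ v ∣ + D)
    enter? : ∀ z c → Dec (On c v × v ⊆ z × at c (suc ∣ v ∣) ⊆ z)
    enter? z c = On? c v ×-dec v ⊆? z ×-dec at c (suc ∣ v ∣) ⊆? z
    Bad : Subset n → Chain n → Set
    Bad z c = (On c v × ¬ (z ⊆ v) × z ⊆ at c (∣ v ∣ + D)) ⊎ (On c v × v ⊆ z × at c (suc ∣ v ∣) ⊆ z)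
    Bad? : ∀ z c → Dec (Bad z c)
    Bad? z c = engulf? z c ⊎-dec enter? z c
    open ≤-Reasoning
    engulf≤ : ∀ z → (n ∸ ∣ v ∣) * ∑ (Ω n) (λ c → 𝟙 (engulf? z c)) ≤ D * w v
    engulf≤ z = case z ⊆? v of λ where
      (yes z⊆v) → *∑𝟙≤ (Ω n) (engulf? z) (n ∸ ∣ v ∣) (λ _ (_ , z⊈v , _) → z⊈v z⊆v)
      (no z⊈v) → let (e , e∈z , e∉v) = ⊈⇒∃ z⊈v in
        ≤-trans (*-monoʳ-≤ (n ∸ ∣ v ∣) (∑-mono (Ω n) (λ c →
          𝟙-mono (engulf? z c) (On? c v ×-dec e ∈? at c (∣ v ∣ + D)) (λ (on , _ , z⊆) → on , z⊆ e∈z))))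
        (hit-up v e D e∉v)
    enter≤ : ∀ {z} → z ∈ˡ Q → (n ∸ ∣ v ∣) * ∑ (Ω n) (λ c → 𝟙 (enter? z c)) ≤ k * D * w v
    enter≤ {z} z∈ = case v ⊆? z of λ where
      (no v⊈z) → *∑𝟙≤ (Ω n) (enter? z) (n ∸ ∣ v ∣) (λ _ (_ , v⊆z , _) → v⊈z v⊆z)
      (yes v⊆z) → ≤-trans (*-monoʳ-≤ (n ∸ ∣ v ∣) (∑-mono (Ω n) (λ c →
          𝟙-mono (enter? z c) (On? c v ×-dec at c (suc ∣ v ∣) ⊆? z) (λ (on , _ , ⊆z) → on , ⊆z))))
        (≤-trans (first-up v z v⊆z) (*-monoˡ-≤ (w v) (m≤n+o⇒m∸n≤o ∣ z ∣ ∣ v ∣ (near z∈ v⊆z))))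
    bad≤ : ∀ {z} → z ∈ˡ Q → (n ∸ ∣ v ∣) * ∑ (Ω n) (λ c → 𝟙 (Bad? z c)) ≤ suc k * D * w v
    bad≤ {z} z∈ = begin
      (n ∸ ∣ v ∣) * ∑ (Ω n) (λ c → 𝟙 (Bad? z c))
        ≤⟨ *-monoʳ-≤ (n ∸ ∣ v ∣) (∑-mono (Ω n) (λ c → 𝟙-⊎ (Bad? z c) (engulf? z c) (enter? z c) id)) ⟩
      _ ≡⟨ cong ((n ∸ ∣ v ∣) *_) (∑-+ (Ω n) (λ c → 𝟙 (engulf? z c)) (λ c → 𝟙 (enter? z c))) ⟩
      _ ≡⟨ *-distribˡ-+ (n ∸ ∣ v ∣) _ _ ⟩
      _ ≤⟨ +-mono-≤ (engulf≤ z) (enter≤ z∈) ⟩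
      D * w v + k * D * w v ≡⟨ *-distribʳ-+ (w v) D (k * D) ⟨
      suc k * D * w v ∎
    conclude : (∃ λ c → (On c v × Above D R c v) × (∀ {z} → z ∈ˡ Q → ¬ Bad z c)) →
               ∃ λ y → y ∈F R × v ⊆ y × ∣ v ∣ < ∣ y ∣ × ∣ y ∣ ≤ ∣ v ∣ + D × (∀ {z} → z ∈ˡ Q → (z ⊆ y → z ⊆ v) × ¬ (y ⊆ z))
    conclude (c , (on , y , y∈ , ony , lt , le) , good) =
        y , y∈ , v⊆y , lt , le , λ {z} z∈ →
          (λ z⊆y → decidable-stable (z ⊆? v) (λ z⊈v → good z∈ (inj₁ (on , z⊈v , ⊆-trans z⊆y (subst (_⊆ at c (∣ v ∣ + D)) ony (at-mono c le)))))) ,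
          (λ y⊆z → good z∈ (inj₂ (on , (λ {e} e∈ → y⊆z (v⊆y e∈)) , ⊆-trans (subst (at c (suc ∣ v ∣) ⊆_) ony (at-mono c lt)) y⊆z)))
        where
        v⊆y : v ⊆ y
        v⊆y = On-⊆ c on ony (<⇒≤ lt)

  step-down : ∀ {v R} (Q : List (Subset n)) → n ≤ 3 * ∣ v ∣ → length Q ≤ t →
            (∀ {z} → z ∈ˡ Q → z ⊆ v → ∣ v ∣ ≤ ∣ z ∣ + k * D) → DownRich v R →
            ∃ λ y → y ∈F R × y ⊆ v × ∣ y ∣ < ∣ v ∣ × ∣ v ∣ ≤ ∣ y ∣ + D ×
                    (∀ {z} → z ∈ˡ Q → (y ⊆ z → v ⊆ z) × ¬ (z ⊆ y))
  step-down {v} {R} Q m ∣Q∣≤t near rich =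
    conclude (avoid {v} ∣ v ∣ Q (λ c → On? c v ×-dec Below? D R c v) Bad? m ∣Q∣≤t bad≤ rich)
    where
    engulf? : ∀ z c → Dec (On c v × ¬ (v ⊆ z) × at c (∣ v ∣ ∸ D) ⊆ z)
    engulf? z c = On? c v ×-dec ¬? (v ⊆? z) ×-dec at c (∣ v ∣ ∸ D) ⊆? z
    enter? : ∀ z c → Dec (On c v × z ⊆ v × z ⊆ at c (∣ v ∣ ∸ 1))
    enter? z c = On? c v ×-dec z ⊆? v ×-dec z ⊆? at c (∣ v ∣ ∸ 1)
    Bad : Subset n → Chain n → Set
    Bad z c = (On c v × ¬ (v ⊆ z) × at c (∣ v ∣ ∸ D) ⊆ z) ⊎ (On c v × z ⊆ v × z ⊆ at c (∣ v ∣ ∸ 1))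
    Bad? : ∀ z c → Dec (Bad z c)
    Bad? z c = engulf? z c ⊎-dec enter? z c
    open ≤-Reasoning
    engulf≤ : ∀ z → ∣ v ∣ * ∑ (Ω n) (λ c → 𝟙 (engulf? z c)) ≤ D * w v
    engulf≤ z = case v ⊆? z of λ where
      (yes v⊆z) → *∑𝟙≤ (Ω n) (engulf? z) ∣ v ∣ (λ _ (_ , v⊈z , _) → v⊈z v⊆z)
      (no v⊈z) → let (e , e∈v , e∉z) = ⊈⇒∃ v⊈z in
        ≤-trans (*-monoʳ-≤ ∣ v ∣ (∑-mono (Ω n) (λ c →
          𝟙-mono (engulf? z c) (On? c v ×-dec ¬? (e ∈? at c (∣ v ∣ ∸ D))) (λ (on , _ , ⊆z) → on , λ e∈ → e∉z (⊆z e∈)))))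
        (hit-down v e D e∈v)
    enter≤ : ∀ {z} → z ∈ˡ Q → ∣ v ∣ * ∑ (Ω n) (λ c → 𝟙 (enter? z c)) ≤ k * D * w v
    enter≤ {z} z∈ = case z ⊆? v of λ where
      (no z⊈v) → *∑𝟙≤ (Ω n) (enter? z) ∣ v ∣ (λ _ (_ , z⊆v , _) → z⊈v z⊆v)
      (yes z⊆v) → ≤-trans (*-monoʳ-≤ ∣ v ∣ (∑-mono (Ω n) (λ c →
          𝟙-mono (enter? z c) (On? c v ×-dec z ⊆? at c (∣ v ∣ ∸ 1)) (λ (on , _ , z⊆) → on , z⊆))))
        (≤-trans (first-down v z z⊆v) (*-monoˡ-≤ (w v) (m≤n+o⇒m∸n≤o ∣ v ∣ ∣ z ∣ (near z∈ z⊆v))))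
    bad≤ : ∀ {z} → z ∈ˡ Q → ∣ v ∣ * ∑ (Ω n) (λ c → 𝟙 (Bad? z c)) ≤ suc k * D * w v
    bad≤ {z} z∈ = begin
      ∣ v ∣ * ∑ (Ω n) (λ c → 𝟙 (Bad? z c))
        ≤⟨ *-monoʳ-≤ ∣ v ∣ (∑-mono (Ω n) (λ c → 𝟙-⊎ (Bad? z c) (engulf? z c) (enter? z c) id)) ⟩
      _ ≡⟨ cong (∣ v ∣ *_) (∑-+ (Ω n) (λ c → 𝟙 (engulf? z c)) (λ c → 𝟙 (enter? z c))) ⟩
      _ ≡⟨ *-distribˡ-+ ∣ v ∣ _ _ ⟩
      _ ≤⟨ +-mono-≤ (engulf≤ z) (enter≤ z∈) ⟩
      D * w v + k * D * w v ≡⟨ *-distribʳ-+ (w v) D (k * D) ⟨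
      suc k * D * w v ∎
    conclude : (∃ λ c → (On c v × Below D R c v) × (∀ {z} → z ∈ˡ Q → ¬ Bad z c)) →
               ∃ λ y → y ∈F R × y ⊆ v × ∣ y ∣ < ∣ v ∣ × ∣ v ∣ ≤ ∣ y ∣ + D × (∀ {z} → z ∈ˡ Q → (y ⊆ z → v ⊆ z) × ¬ (z ⊆ y))
    conclude (c , (on , y , y∈ , ony , lt , le) , good) =
        y , y∈ , y⊆v , lt , le , λ {z} z∈ →
          (λ y⊆z → decidable-stable (v ⊆? z) (λ v⊈z → good z∈ (inj₁ (on , v⊈z , ⊆-trans
             (subst (at c (∣ v ∣ ∸ D) ⊆_) ony (at-mono c (m≤n+o⇒m∸n≤o ∣ v ∣ D (≤-trans le (≤-reflexive (+-comm ∣ y ∣ D)))))) y⊆z)))) ,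
          (λ z⊆y → good z∈ (inj₂ (on , (λ {e} e∈ → y⊆v (z⊆y e∈)) , ⊆-trans z⊆y (subst (_⊆ at c (∣ v ∣ ∸ 1)) ony (at-mono c (m+n≤o⇒m≤o∸n ∣ y ∣ (≤-trans (≤-reflexive (+-comm ∣ y ∣ 1)) lt)))))))
        where
        y⊆v : y ⊆ v
        y⊆v = On-⊆ c ony on (<⇒≤ lt)

  -- v ∈ R r j : v can play a node of rank r in every tree poset of height k
  -- whose nodes are within j steps from it.
  opaque
    R : ℕ → ℕ → Family n
    R r zero      = F
    R r (suc j) v = F v ∧ does ((suc r <? k →-dec UpRich? v (R (suc r) j)) ×-dec (0 <? r →-dec DownRich? v (R (pred r) j)))

    R-zero : ∀ r {v} → v ∈F F → v ∈F R r 0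
    R-zero r v∈ = v∈

    R⊆F : ∀ r j → R r j ⊆F F
    R⊆F r zero    v∈ = v∈
    R⊆F r (suc j) v∈ = proj₁ (∧-true v∈)

    R-rich : ∀ {r j v} → v ∈F R r (suc j) →
             (suc r < k → UpRich v (R (suc r) j)) × (0 < r → DownRich v (R (pred r) j))
    R-rich {r} {j} {v} v∈ =
      does⇒ ((suc r <? k →-dec UpRich? v (R (suc r) j)) ×-dec (0 <? r →-dec DownRich? v (R (pred r) j))) (proj₂ (∧-true {F v} v∈))

    R-poor : ∀ {r j v} → v ∈F F → ¬ v ∈F R r (suc j) →
             (suc r < k × ¬ UpRich v (R (suc r) j)) ⊎ (0 < r × ¬ DownRich v (R (pred r) j))
    R-poor {r} {j} {v} v∈ v∉ = decide (suc r <? k) (UpRich? v (R (suc r) j)) (0 <? r) (DownRich? v (R (pred r) j))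
      (λ rich → v∉ (∧-true⁺ v∈ (dec-true ((suc r <? k →-dec UpRich? v (R (suc r) j)) ×-dec (0 <? r →-dec DownRich? v (R (pred r) j))) rich)))
      where
      decide : Dec P → Dec P′ → Dec P″ → Dec P‴ → ¬ ((P → P′) × (P″ → P‴)) → (P × ¬ P′) ⊎ (P″ × ¬ P‴)
      decide p?      q?      (yes p) (no ¬q) h = inj₂ (p , ¬q)
      decide (yes p) (no ¬q) _       _       h = inj₁ (p , ¬q)
      decide (no ¬p) _       (no ¬p′) _      h = contradiction ((λ p → contradiction p ¬p) , (λ p → contradiction p ¬p′)) h
      decide (no ¬p) _       _       (yes q) h = contradiction ((λ p → contradiction p ¬p) , (λ _ → q)) h
      decide _       (yes q) (no ¬p) _       h = contradiction ((λ _ → q) , (λ p → contradiction p ¬p)) h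
      decide _       (yes q) _       (yes q′) h = contradiction ((λ _ → q) , (λ _ → q′)) h

  Above-by Below-by : ℕ → Family n → Subset n → List (Subset n) → Set
  Above-by d R v Q = ∃ λ y → y ∈F R × v ⊆ y × ∣ v ∣ < ∣ y ∣ × ∣ y ∣ ≤ ∣ v ∣ + d ×
                             (∀ {z} → z ∈ˡ Q → (z ⊆ y → z ⊆ v) × ¬ (y ⊆ z))
  Below-by d R v Q = ∃ λ y → y ∈F R × y ⊆ v × ∣ y ∣ < ∣ v ∣ × ∣ v ∣ ≤ ∣ y ∣ + d ×
                             (∀ {z} → z ∈ˡ Q → (y ⊆ z → v ⊆ z) × ¬ (z ⊆ y))

  -- Richness links neighbouring ranks only, while an edge of the Hasse tree may skip ranks. The
  -- sets in between are passed through and dropped. After one step no set of `Q` lies above the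
  -- current one, so the nearness hypothesis holds vacuously from then on.
  reach-up : ∀ m r j {v} (Q : List (Subset n)) → r + suc m < k → v ∈F R r (suc m + j) → length Q ≤ t →
             (∀ {z} → z ∈ˡ Q → v ⊆ z → ∣ z ∣ ≤ ∣ v ∣ + k * D) → Above-by (suc m * D) (R (r + suc m) j) v Q
  reach-up-from : ∀ m r j {v} (Q : List (Subset n)) → r + suc m < k → length Q ≤ t →
                  Above-by D (R (suc r) (m + j)) v Q → Above-by (suc m * D) (R (r + suc m) j) v Q
  reach-up m r j {v} Q r+m<k v∈ ∣Q∣≤t near = reach-up-from m r j Q r+m<k ∣Q∣≤t
    (step-up {v} {R (suc r) (m + j)} Q (proj₁ (mid (R⊆F r (suc m + j) v∈))) ∣Q∣≤t near
      (proj₁ (R-rich {r} {m + j} v∈) (≤-<-trans (≤-trans (m≤m+n (suc r) m) (≤-reflexive (sym (+-suc r m)))) r+m<k)))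
  reach-up-from zero r j {v} Q r+m<k ∣Q∣≤t (y , y∈ , v⊆y , lt , le , good) =
    y , subst (λ r → y ∈F R r j) (+-comm 1 r) y∈ , v⊆y , lt , subst (λ d → ∣ y ∣ ≤ ∣ v ∣ + d) (sym (+-identityʳ D)) le , good
  reach-up-from (suc m) r j {v} Q r+m<k ∣Q∣≤t (y , y∈ , v⊆y , lt , le , good) =
    let (x , x∈ , y⊆x , lt′ , le′ , good′) =
          reach-up m (suc r) j Q (subst (_< k) (+-suc r (suc m)) r+m<k) y∈ ∣Q∣≤t (λ z∈ y⊆z → ⊥-elim (proj₂ (good z∈) y⊆z))
    in x , subst (λ r → x ∈F R r j) (sym (+-suc r (suc m))) x∈ , ⊆-trans v⊆y y⊆x , <-trans lt lt′ ,
       ≤-trans le′ (≤-trans (+-monoˡ-≤ (suc m * D) le) (≤-reflexive (+-assoc ∣ v ∣ D (suc m * D)))) ,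
       λ z∈ → (λ z⊆x → proj₁ (good z∈) (proj₁ (good′ z∈) z⊆x)) , proj₂ (good′ z∈)

  reach-down : ∀ m r j {v} (Q : List (Subset n)) → v ∈F R (r + suc m) (suc m + j) → length Q ≤ t →
               (∀ {z} → z ∈ˡ Q → z ⊆ v → ∣ v ∣ ≤ ∣ z ∣ + k * D) → Below-by (suc m * D) (R r j) v Q
  reach-down-from : ∀ m r j {v} (Q : List (Subset n)) → length Q ≤ t →
                    Below-by D (R (r + m) (m + j)) v Q → Below-by (suc m * D) (R r j) v Q
  reach-down m r j {v} Q v∈ ∣Q∣≤t near = reach-down-from m r j Q ∣Q∣≤t
    (step-down {v} {R (r + m) (m + j)} Q (proj₂ (mid (R⊆F (r + suc m) (suc m + j) v∈))) ∣Q∣≤t near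
      (proj₂ (R-rich {suc (r + m)} {m + j} (subst (λ r → v ∈F R r (suc m + j)) (+-suc r m) v∈)) (s≤s z≤n)))
  reach-down-from zero r j {v} Q ∣Q∣≤t (y , y∈ , y⊆v , lt , le , good) =
    y , subst (λ r → y ∈F R r j) (+-identityʳ r) y∈ , y⊆v , lt , subst (λ d → ∣ v ∣ ≤ ∣ y ∣ + d) (sym (+-identityʳ D)) le , good
  reach-down-from (suc m) r j {v} Q ∣Q∣≤t (y , y∈ , y⊆v , lt , le , good) =
    let (x , x∈ , x⊆y , lt′ , le′ , good′) = reach-down m r j Q y∈ ∣Q∣≤t (λ z∈ z⊆y → ⊥-elim (proj₂ (good z∈) z⊆y))
    in x , x∈ , ⊆-trans x⊆y y⊆v , <-trans lt′ lt ,
       ≤-trans le (≤-trans (+-monoˡ-≤ D le′) (≤-reflexive (trans (+-assoc ∣ x ∣ (suc m * D) D) (cong (∣ x ∣ +_) (+-comm (suc m * D) D))))) ,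
       λ z∈ → (λ x⊆z → proj₁ (good z∈) (proj₁ (good′ z∈) x⊆z)) , proj₂ (good′ z∈)

-- Tree posets

module Tree (P : FinPoset) (_<P?_ : ∀ x y → Dec (FinPoset._<P_ P x y)) where

  open FinPoset P

  open import Relation.Binary using (IsStrictPartialOrder)
  open IsStrictPartialOrder isSPO using () renaming (trans to <P-trans; irrefl to <P-irrefl)

  data Path : Fin size → List (Fin size) → Fin size → Set where
    nil  : ∀ {a} → Path a [] a
    cons : ∀ {a b c xs} → HasseAdj P a b → Path b xs c → Path a (b ∷ xs) c

  infixr 5 _∙_
  _∙_ : ∀ {a b c xs ys} → Path a xs b → Path b ys c → Path a (xs ++ ys) c
  nil        ∙ q = q
  cons adj p ∙ q = cons adj (p ∙ q)

  closed : ∀ {a b v xs} → Path a xs b → HasseAdj P b v → Linked (HasseAdj P) (a ∷ xs ++ [ v ])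
  closed nil          adj = adj ∷ [-]
  closed (cons adj p) bv  = adj ∷ closed p bv

  adj-sym : ∀ {a b} → HasseAdj P a b → HasseAdj P b a
  adj-sym (inj₁ c) = inj₂ c
  adj-sym (inj₂ c) = inj₁ c

  -- The paths are simple and stay inside `ns`, so that an excursion outside `ns` can be closed up
  -- to a cycle without repeated nodes.
  Connected : List (Fin size) → Set
  Connected ns = ∀ {a b} → a ∈ˡ ns → b ∈ˡ ns → ∃ λ xs → Path a xs b × Unique (a ∷ xs) × All (_∈ˡ ns) (a ∷ xs)

  _∈?ns_ : ∀ (x : Fin size) ns → Dec (x ∈ˡ ns)
  x ∈?ns ns = Any.any? (x Finₚ.≟_) ns

  singleton-connected : ∀ x → Connected [ x ]
  singleton-connected x (here refl) (here refl) = [] , nil , [] ∷ [] , here refl ∷ []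

  open import Data.List.Relation.Unary.Unique.Propositional.Properties using () renaming (++⁺ to unique-++)

  connected-∷ : ∀ {ns q y} → Connected ns → q ∈ˡ ns → HasseAdj P q y → ¬ y ∈ˡ ns → Connected (y ∷ ns)
  connected-∷ conn q∈ adj y∉ (here refl) (here refl) = [] , nil , [] ∷ [] , here refl ∷ []
  connected-∷ {ns} {q} {y} conn q∈ adj y∉ (here refl) (there b∈) with conn q∈ b∈
  ... | xs , p , uniq , xs∈ = q ∷ xs , cons (adj-sym adj) p ,
        All.map (λ x∈ y≡x → y∉ (subst (_∈ˡ ns) (sym y≡x) x∈)) xs∈ ∷ uniq , here refl ∷ All.map there xs∈
  connected-∷ {ns} {q} {y} conn q∈ adj y∉ (there a∈) (here refl) with conn a∈ q∈
  ... | xs , p , uniq , xs∈ = xs ++ [ y ] , p ∙ cons adj nil ,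
        unique-++ uniq ([] ∷ []) (λ { (x∈ , here refl) → y∉ (All.lookup xs∈ x∈) }) ,
        all-++ (All.map there xs∈) (here refl ∷ [])
  connected-∷ conn q∈ adj y∉ (there a∈) (there b∈) with conn a∈ b∈
  ... | xs , p , uniq , xs∈ = xs , p , uniq , All.map there xs∈

  crossing : ∀ {ns a b} → Walk P a b → a ∈ˡ ns → ¬ b ∈ˡ ns →
             ∃ λ q → ∃ λ y → q ∈ˡ ns × ¬ (y ∈ˡ ns) × HasseAdj P q y
  crossing here a∈ b∉ = contradiction a∈ b∉
  crossing {ns} {a} (step {y = c} adj walk) a∈ b∉ with c ∈?ns ns
  ... | yes c∈ = crossing walk c∈ b∉
  ... | no  c∉ = a , c , a∈ , c∉ , adj

  -- Used for the order and for its reverse. `next` is the first Hasse edge of a monotone walk from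
  -- `x` to `p`, and `h` bounds the length of such a walk.
  module Direction (_≺_ : Fin size → Fin size → Set)
    (≺-trans : ∀ {x y z} → x ≺ y → y ≺ z → x ≺ z) (≺-irrefl : ∀ {x} → ¬ x ≺ x)
    (h : Fin size → ℕ) (h-anti : ∀ {x y} → x ≺ y → h y < h x)
    (next : ∀ {x p} → x ≺ p → ∃ λ z → HasseAdj P x z × x ≺ z × (z ≡ p ⊎ z ≺ p))
    (acyclic : ¬ HasseCycle P) where

    Ascent : List (Fin size) → Fin size → Set
    Ascent ns z = ∃ λ os → ∃ λ b → b ∈ˡ ns × All (_∉ˡ ns) (z ∷ os) × AllPairs _≺_ (z ∷ os) × Path z (os ++ [ b ]) b

    ascend : ∀ {ns p} fuel z → h z < fuel → ¬ z ∈ˡ ns → z ≺ p → p ∈ˡ ns → Ascent ns z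
    ascend {ns} (suc f) z le z∉ z≺p p∈ with next z≺p
    ... | z′ , adj , z≺z′ , z′≼p with z′ ∈?ns ns
    ...   | yes z′∈ = [] , z′ , z′∈ , z∉ ∷ [] , [] ∷ [] , cons adj nil
    ...   | no  z′∉ with z′≼p
    ...     | inj₁ refl = contradiction p∈ z′∉
    ...     | inj₂ z′≺p with ascend f z′ (<-≤-trans (h-anti z≺z′) (s≤s⁻¹ le)) z′∉ z′≺p p∈
    ...       | os , b , b∈ , os∉ , mono@(z′≺os ∷ _) , path =
                z′ ∷ os , b , b∈ , z∉ ∷ os∉ , (z≺z′ ∷ All.map (≺-trans z≺z′) z′≺os) ∷ mono , cons adj path

    -- A monotone walk that leaves y other than through q and comes back to
    -- the connected set ns would close a cycle through q.
    gate : ∀ {ns q y p} → Connected ns → q ∈ˡ ns → ¬ (y ∈ˡ ns) → HasseAdj P q y → p ∈ˡ ns → y ≺ p →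
           y ≺ q × (q ≡ p ⊎ q ≺ p)
    gate {ns} {q} {y} {p} conn q∈ y∉ adj p∈ y≺p with next y≺p
    ... | z , yz , y≺z , z≼p with z Finₚ.≟ q
    ...   | yes refl = y≺z , z≼p
    ...   | no  z≢q with z ∈?ns ns
    ...     | yes z∈ with conn z∈ q∈
    ...       | [] , nil , _ , _ = contradiction refl z≢q
    ...       | x ∷ xs , path , uniq , xs∈ = contradiction
                (y , z ∷ x ∷ xs , s≤s (s≤s (s≤s z≤n)) ,
                 All.map (λ x∈ y≡x → y∉ (subst (_∈ˡ ns) (sym y≡x) x∈)) xs∈ ∷ uniq ,
                 closed (cons yz path) adj) acyclic
    gate {ns} {q} {y} {p} conn q∈ y∉ adj p∈ y≺p | z , yz , y≺z , inj₁ refl | no z≢q | no z∉ = contradiction p∈ z∉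
    gate {ns} {q} {y} {p} conn q∈ y∉ adj p∈ y≺p | z , yz , y≺z , inj₂ z≺p | no z≢q | no z∉
      with ascend (suc (h z)) z ≤-refl z∉ z≺p p∈
    ... | os , b , b∈ , os∉ , mono@(z≺os ∷ _) , path with conn b∈ q∈
    ...   | xs , path′ , uniq , xs∈ = contradiction
            (y , z ∷ (os ++ [ b ]) ++ xs , s≤s (s≤s (long os)) ,
             subst Unique (cong (λ l → y ∷ z ∷ l) (sym (++-assoc os [ b ] xs)))
               (unique-++ (AllPairs.map (λ x≺y x≡y → ≺-irrefl (subst (_≺ _) x≡y x≺y)) ((y≺z ∷ All.map (≺-trans y≺z) z≺os) ∷ mono)) uniq
                  (λ (x∈ , x∈′) → All.lookup (y∉ ∷ os∉) x∈ (All.lookup xs∈ x∈′))) ,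
             closed (cons yz (path ∙ path′)) adj) acyclic
      where
      open import Data.List.Properties using (++-assoc)
      long : ∀ os → 1 ≤ length ((os ++ [ b ]) ++ xs)
      long []       = s≤s z≤n
      long (_ ∷ os) = s≤s z≤n

  Ht : ℕ → Fin size → Set
  Ht zero    x = ⊤
  Ht (suc j) x = ∃ λ y → y <P x × Ht j y

  Ht? : ∀ j x → Dec (Ht j x)
  Ht? zero    x = yes tt
  Ht? (suc j) x = Finₚ.any? (λ y → y <P? x ×-dec Ht? j y)

  Ht⇒chain : ∀ j x → Ht j x → ∃ λ xs → IsChain P xs × length xs ≡ suc j × All (λ z → z ≡ x ⊎ z <P x) xs
  Ht⇒chain zero    x _ = [ x ] , [] ∷ [] , refl , inj₁ refl ∷ []
  Ht⇒chain (suc j) x (y , y<x , ht) with Ht⇒chain j y ht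
  ... | xs , chain , len , below = x ∷ xs , All.map inj₂ below′ ∷ chain , cong suc len , inj₁ refl ∷ All.map inj₂ below′
    where
    below′ : All (_<P x) xs
    below′ = All.map [ (λ { refl → y<x }) , (λ z<y → <P-trans z<y y<x) ]′ below

  module Ranked (k : ℕ) (short : ∀ xs → IsChain P xs → length xs ≤ k) where

    rank≤ : ℕ → Fin size → ℕ
    rank≤ zero    x = 0
    rank≤ (suc b) x with Ht? (suc b) x
    ... | yes _ = suc b
    ... | no  _ = rank≤ b x

    Ht-rank : ∀ b x → Ht (rank≤ b x) x
    Ht-rank zero    x = tt
    Ht-rank (suc b) x with Ht? (suc b) x
    ... | yes ht = ht
    ... | no  _  = Ht-rank b x

    rank-max : ∀ b x {j} → j ≤ b → Ht j x → j ≤ rank≤ b x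
    rank-max zero    x j≤b ht = j≤b
    rank-max (suc b) x j≤b ht with Ht? (suc b) x
    ... | yes _  = j≤b
    ... | no ¬ht = rank-max b x (s≤s⁻¹ (≤∧≢⇒< j≤b (λ { refl → ¬ht ht }))) ht

    Ht⇒< : ∀ {j x} → Ht j x → j < k
    Ht⇒< {j} {x} ht with Ht⇒chain j x ht
    ... | xs , chain , len , _ = subst (_≤ k) len (short xs chain)

    -- The number of elements in a longest chain strictly below `x`. It is less than `k` by `Ht⇒<`,
    -- so the search bound `k` cuts nothing off. A cover can raise this rank by more than one.
    ρ : Fin size → ℕ
    ρ = rank≤ k

    ρ<k : ∀ x → ρ x < k
    ρ<k x = Ht⇒< (Ht-rank k x)

    ρ-mono : ∀ {x y} → x <P y → ρ x < ρ y
    ρ-mono {x} {y} x<y = rank-max k y (<⇒≤ (Ht⇒< ht)) ht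
      where
      ht : Ht (suc (ρ x)) y
      ht = x , x<y , Ht-rank k x

    between? : ∀ x y → Dec (∃ λ z → x <P z × z <P y)
    between? x y = Finₚ.any? (λ z → x <P? z ×-dec z <P? y)

    cover-above : ∀ fuel {x p} → ρ p < fuel → x <P p → ∃ λ z → Covers P x z × (z ≡ p ⊎ z <P p)
    cover-above (suc f) {x} {p} le x<p with between? x p
    ... | no none = p , (x<p , none) , inj₁ refl
    ... | yes (y , x<y , y<p) with cover-above f (<-≤-trans (ρ-mono y<p) (s≤s⁻¹ le)) x<y
    ...   | z , cov , inj₁ refl = z , cov , inj₂ y<p
    ...   | z , cov , inj₂ z<y  = z , cov , inj₂ (<P-trans z<y y<p)

    cover-below : ∀ fuel {x p} → k ∸ ρ p < fuel → p <P x → ∃ λ z → Covers P z x × (z ≡ p ⊎ p <P z)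
    cover-below (suc f) {x} {p} le p<x with between? p x
    ... | no none = p , (p<x , none) , inj₁ refl
    ... | yes (y , p<y , y<x) with cover-below f (<-≤-trans (∸-monoʳ-< (ρ-mono p<y) (<⇒≤ (ρ<k y))) (s≤s⁻¹ le)) y<x
    ...   | z , cov , inj₁ refl = z , cov , inj₂ p<y
    ...   | z , cov , inj₂ y<z  = z , cov , inj₂ (<P-trans p<y y<z)

    next-up : ∀ {x p} → x <P p → ∃ λ z → HasseAdj P x z × x <P z × (z ≡ p ⊎ z <P p)
    next-up x<p = let (z , cov , z≤p) = cover-above _ ≤-refl x<p in z , inj₁ cov , proj₁ cov , z≤p

    next-down : ∀ {x p} → p <P x → ∃ λ z → HasseAdj P x z × z <P x × (z ≡ p ⊎ p <P z)
    next-down p<x = let (z , cov , z≥p) = cover-below _ ≤-refl p<x in z , inj₂ cov , proj₁ cov , z≥p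

    module _ (acyclic : ¬ HasseCycle P) where

      module Up = Direction _<P_ <P-trans (<P-irrefl refl) (λ x → k ∸ ρ x)
        (λ x<y → ∸-monoʳ-< (ρ-mono x<y) (<⇒≤ (ρ<k _))) next-up acyclic

      module Down = Direction (λ x y → y <P x) (λ y<x z<y → <P-trans z<y y<x) (<P-irrefl refl) ρ ρ-mono next-down acyclic

-- Embedding a tree poset

-- Stopping at the first failure, rather than relying on monotonicity of the levels in the depth,
-- makes `p` true at every index up to the result.
first-failure : (ℕ → Bool) → ℕ → ℕ
first-failure p zero    = 0
first-failure p (suc b) = if p 1 then suc (first-failure (p ∘ suc) b) else 0

first-failure-true : ∀ (p : ℕ → Bool) b → p 0 ≡ true → ∀ {i} → i ≤ first-failure p b → p i ≡ true
first-failure-true p zero    p0 z≤n = p0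
first-failure-true p (suc b) p0 {i} i≤ with p 1 in eq
first-failure-true p (suc b) p0 {zero}  i≤ | true = p0
first-failure-true p (suc b) p0 {suc i} i≤ | true = first-failure-true (p ∘ suc) b eq (s≤s⁻¹ i≤)
first-failure-true p (suc b) p0 z≤n | false = p0

first-failure-false : ∀ (p : ℕ → Bool) b → ¬ p (suc b) ≡ true → ¬ p (suc (first-failure p b)) ≡ true
first-failure-false p zero    ¬p = ¬p
first-failure-false p (suc b) ¬p with p 1 in eq
... | true  = first-failure-false (p ∘ suc) b ¬p
... | false = λ p1 → case trans (sym eq) p1 of λ ()

unique-length : ∀ {m} {xs : List (Fin m)} → Unique xs → length xs ≤ m
unique-length {xs = xs} uniq = Finₚ.injective⇒≤ (λ {i} {j} → injective uniq i j)
  where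
  open import Data.List using (lookup)
  injective : ∀ {m} {xs : List (Fin m)} → Unique xs → ∀ i j → lookup xs i ≡ lookup xs j → i ≡ j
  injective (_ ∷ _)    zero    zero    _  = refl
  injective (x∉ ∷ _)   zero    (suc j) eq = contradiction eq (All.lookup x∉ (∈-lookup j))
  injective (x∉ ∷ _)   (suc i) zero    eq = contradiction (sym eq) (All.lookup x∉ (∈-lookup i))
  injective (_ ∷ uniq) (suc i) (suc j) eq = cong suc (injective uniq i j eq)

module Embedding (P : FinPoset) (_<P?_ : ∀ x y → Dec (FinPoset._<P_ P x y))
  (tree : IsTreePoset P) (k : ℕ) (short : ∀ xs → IsChain P xs → length xs ≤ k)
  {n : ℕ} (D : ℕ) (F : Family n) (mid : ∀ {v} → v ∈F F → n ≤ 3 * (n ∸ ∣ v ∣) × n ≤ 3 * ∣ v ∣) where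

  open FinPoset P

  open import Relation.Binary using (IsStrictPartialOrder)
  open IsStrictPartialOrder isSPO using () renaming (trans to <P-trans; irrefl to <P-irrefl)
  open Tree P _<P?_
  open Ranked k short
  open Levels D size k F mid public

  private
    acyclic = proj₂ (proj₂ tree)

  -- A node of `P`, the set that plays it, and a depth to which this set is rich at the rank of the
  -- node.
  Entry : Set
  Entry = Fin size × Subset n × ℕ

  node : Entry → Fin size
  node = proj₁

  set : Entry → Subset n
  set = proj₁ ∘ proj₂

  -- The bound on the difference of sizes is carried along because it supplies the nearness
  -- hypothesis `k * D` when the next node is attached.
  Faithful : Entry → Entry → Set
  Faithful (p , X , _) (q , Y , _) =
    (X ⊆ Y → p ≡ q ⊎ p <P q) × (p ≡ q → X ≡ Y) ×
    (p <P q → X ⊆ Y × ∣ X ∣ < ∣ Y ∣ × ∣ Y ∣ ≤ ∣ X ∣ + (ρ q ∸ ρ p) * D)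

  -- `f` nodes are still missing. Attaching one of them takes at most `k` rank steps and each step
  -- uses up one level, so every placed set keeps `f * k` levels in reserve.
  record Partial (f : ℕ) (es : List Entry) : Set where
    field
      faithful  : ∀ {e e′} → e ∈ˡ es → e′ ∈ˡ es → Faithful e e′
      level     : ∀ {p X j} → (p , X , j) ∈ˡ es → X ∈F R (ρ p) j × f * k ≤ j
      connected : Connected (map node es)
      unique    : Unique (map node es)
      total     : length es + f ≡ size

  open Partial

  rank-gap : ∀ {x y} → x <P y → ρ x + suc (ρ y ∸ suc (ρ x)) ≡ ρ y
  rank-gap {x} {y} x<y = trans (+-suc (ρ x) _) (m+[n∸m]≡n (ρ-mono x<y))

  gap-≤k : ∀ {x y} → x <P y → suc (ρ y ∸ suc (ρ x)) ≤ k
  gap-≤k {x} {y} x<y = ≤-trans (m≤n+m _ (ρ x)) (≤-trans (≤-reflexive (rank-gap x<y)) (<⇒≤ (ρ<k y)))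

  gap≡ : ∀ {x y} → x <P y → ρ y ∸ ρ x ≡ suc (ρ y ∸ suc (ρ x))
  gap≡ {x} {y} x<y = trans (cong (_∸ ρ x) (sym (rank-gap x<y))) (m+n∸m≡n (ρ x) _)

  gap-trans : ∀ {x y z a b c} → x <P y → y <P z → b ≤ a + (ρ y ∸ ρ x) * D → c ≤ b + (ρ z ∸ ρ y) * D →
              c ≤ a + (ρ z ∸ ρ x) * D
  gap-trans {x} {y} {z} {a} {b} {c} x<y y<z b≤ c≤ = begin
    c ≤⟨ c≤ ⟩
    b + (ρ z ∸ ρ y) * D ≤⟨ +-monoˡ-≤ _ b≤ ⟩
    a + (ρ y ∸ ρ x) * D + (ρ z ∸ ρ y) * D ≡⟨ +-assoc a _ _ ⟩
    a + ((ρ y ∸ ρ x) * D + (ρ z ∸ ρ y) * D) ≡⟨ cong (a +_) (*-distribʳ-+ D (ρ y ∸ ρ x) _) ⟨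
    a + (ρ y ∸ ρ x + (ρ z ∸ ρ y)) * D ≡⟨ cong (λ g → a + g * D) (+-comm (ρ y ∸ ρ x) _) ⟩
    a + (ρ z ∸ ρ y + (ρ y ∸ ρ x)) * D ≡⟨ cong (λ g → a + g * D) (+-∸-assoc (ρ z ∸ ρ y) (<⇒≤ (ρ-mono x<y))) ⟨
    a + (ρ z ∸ ρ y + ρ y ∸ ρ x) * D ≡⟨ cong (λ g → a + (g ∸ ρ x) * D) (m∸n+n≡m (<⇒≤ (ρ-mono y<z))) ⟩
    a + (ρ z ∸ ρ x) * D ∎
    where open ≤-Reasoning

  extend : ∀ {f es q y Y j} → Partial (suc f) es → q ∈ˡ map node es → HasseAdj P q y → ¬ y ∈ˡ map node es →
           Y ∈F R (ρ y) j → f * k ≤ j →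
           (∀ {e} → e ∈ˡ es → Faithful e (y , Y , j)) → (∀ {e} → e ∈ˡ es → Faithful (y , Y , j) e) →
           Partial f ((y , Y , j) ∷ es)
  extend inv q∈ adj y∉ Y∈ fk≤j old-new new-old = record
    { faithful  = λ where
        (here refl) (here refl) → (λ _ → inj₁ refl) , (λ _ → refl) , (λ y<y → contradiction y<y (<P-irrefl refl))
        (here refl) (there e∈)  → new-old e∈
        (there e∈)  (here refl) → old-new e∈
        (there e∈)  (there e∈′) → faithful inv e∈ e∈′
    ; level     = λ where
        (here refl) → Y∈ , fk≤j
        (there e∈)  → proj₁ (level inv e∈) , ≤-trans (m≤n+m _ k) (proj₂ (level inv e∈))
    ; connected = connected-∷ (connected inv) q∈ adj y∉
    ; unique    = All.tabulate (λ x∈ y≡x → y∉ (subst (_∈ˡ _) (sym y≡x) x∈)) ∷ unique inv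
    ; total     = trans (sym (+-suc _ _)) (total inv)
    }

  few : ∀ {f es} → Partial f es → length (map set es) ≤ size
  few {f} {es} inv = ≤-trans (≤-reflexive (length-map set es)) (≤-trans (m≤m+n _ f) (≤-reflexive (total inv)))

  drop-level : ∀ {f j m} → suc f * k ≤ j → m ≤ k → (m + (j ∸ m) ≡ j) × f * k ≤ j ∸ m
  drop-level {f} {j} {m} le m≤k = m+[n∸m]≡n (≤-trans m≤k (≤-trans (m≤m+n k (f * k)) le)) ,
    ≤-trans (≤-reflexive (sym (m+n∸m≡n k (f * k)))) (∸-mono le m≤k)

  near-up : ∀ {f es q X j} → Partial f es → (q , X , j) ∈ˡ es →
            ∀ {z} → z ∈ˡ map set es → X ⊆ z → ∣ z ∣ ≤ ∣ X ∣ + k * D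
  near-up {es = es} {q} {X} inv e∈ z∈ X⊆z = at-entry (∈-map⁻ set z∈) X⊆z
    where
    at-entry : ∀ {z} → (∃ λ e → e ∈ˡ es × z ≡ set e) → X ⊆ z → ∣ z ∣ ≤ ∣ X ∣ + k * D
    at-entry ((p , Z , _) , e′∈ , refl) X⊆Z =
      let (reflects , same , preserves) = faithful inv e∈ e′∈ in
      [ (λ q≡p → ≤-trans (≤-reflexive (cong ∣_∣ (sym (same q≡p)))) (m≤m+n _ _)) ,
        (λ q<p → ≤-trans (proj₂ (proj₂ (preserves q<p)))
                   (+-monoʳ-≤ ∣ X ∣ (*-monoˡ-≤ D (≤-trans (m∸n≤m (ρ p) (ρ q)) (<⇒≤ (ρ<k p)))))) ]′ (reflects X⊆Z)

  near-down : ∀ {f es q X j} → Partial f es → (q , X , j) ∈ˡ es →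
              ∀ {z} → z ∈ˡ map set es → z ⊆ X → ∣ X ∣ ≤ ∣ z ∣ + k * D
  near-down {es = es} {q} {X} inv e∈ z∈ z⊆X = at-entry (∈-map⁻ set z∈) z⊆X
    where
    at-entry : ∀ {z} → (∃ λ e → e ∈ˡ es × z ≡ set e) → z ⊆ X → ∣ X ∣ ≤ ∣ z ∣ + k * D
    at-entry ((p , Z , _) , e′∈ , refl) Z⊆X =
      let (reflects , same , preserves) = faithful inv e′∈ e∈ in
      [ (λ p≡q → ≤-trans (≤-reflexive (cong ∣_∣ (sym (same p≡q)))) (m≤m+n _ _)) ,
        (λ p<q → ≤-trans (proj₂ (proj₂ (preserves p<q)))
                   (+-monoʳ-≤ ∣ Z ∣ (*-monoˡ-≤ D (≤-trans (m∸n≤m (ρ q) (ρ p)) (<⇒≤ (ρ<k q)))))) ]′ (reflects Z⊆X)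

  -- The new node is related to the placed ones only through `q`: by `gate`, a placed node below `y`
  -- is `q` or lies below `q`, and none lies above `y`. The sets behave in the same way: a placed
  -- set inside `Y` is inside `X`, and `Y` is inside no placed set.
  extend-up : ∀ {f es q X j y} → Partial (suc f) es → (q , X , j) ∈ˡ es → Covers P q y → ¬ y ∈ˡ map node es →
              ∃ λ e → Partial f (e ∷ es)
  extend-up {f} {es} {q} {X} {j} {y} inv e∈ cov@(q<y , _) y∉ = attach
    (reach-up (ρ y ∸ suc (ρ q)) (ρ q) j′ {X} (map set es) (subst (_< k) (sym (rank-gap q<y)) (ρ<k y))
      (subst (λ j → X ∈F R (ρ q) j) (sym (proj₁ levels)) (proj₁ (level inv e∈))) (few inv) (near-up inv e∈))
    where
    j′ : ℕ
    j′ = j ∸ suc (ρ y ∸ suc (ρ q))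
    levels : (suc (ρ y ∸ suc (ρ q)) + j′ ≡ j) × f * k ≤ j′
    levels = drop-level {f} {j} (proj₂ (level inv e∈)) (gap-≤k q<y)
    q∈ : q ∈ˡ map node es
    q∈ = ∈-map⁺ node e∈
    attach : Above-by (suc (ρ y ∸ suc (ρ q)) * D) (R (ρ q + suc (ρ y ∸ suc (ρ q))) j′) X (map set es) →
             ∃ λ e → Partial f (e ∷ es)
    attach (Y , Y∈ , X⊆Y , lt , le , good) =
      (y , Y , j′) , extend inv q∈ (inj₁ cov) y∉ (subst (λ r → Y ∈F R r j′) (rank-gap q<y) Y∈) (proj₂ levels) old-new new-old
      where
      le′ : ∣ Y ∣ ≤ ∣ X ∣ + (ρ y ∸ ρ q) * D
      le′ = subst (λ g → ∣ Y ∣ ≤ ∣ X ∣ + g * D) (sym (gap≡ q<y)) le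
      old-new : ∀ {e} → e ∈ˡ es → Faithful e (y , Y , j′)
      old-new {p , Z , _} e′∈ = reflects , (λ p≡y → contradiction (subst (_∈ˡ _) p≡y (∈-map⁺ node e′∈)) y∉) , preserves
        where
        reflects : Z ⊆ Y → p ≡ y ⊎ p <P y
        reflects Z⊆Y = [ (λ { refl → inj₂ q<y }) , (λ p<q → inj₂ (<P-trans p<q q<y)) ]′
          (proj₁ (faithful inv e′∈ e∈) (proj₁ (good (∈-map⁺ set e′∈)) Z⊆Y))
        from-gate : q ≡ p ⊎ p <P q → Z ⊆ Y × ∣ Z ∣ < ∣ Y ∣ × ∣ Y ∣ ≤ ∣ Z ∣ + (ρ y ∸ ρ p) * D
        from-gate (inj₁ refl) = subst (λ Z → Z ⊆ Y × ∣ Z ∣ < ∣ Y ∣ × ∣ Y ∣ ≤ ∣ Z ∣ + (ρ y ∸ ρ p) * D)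
          (proj₁ (proj₂ (faithful inv e∈ e′∈)) refl) (X⊆Y , lt , le′)
        from-gate (inj₂ p<q) = let (Z⊆X , Z<X , X≤) = proj₂ (proj₂ (faithful inv e′∈ e∈)) p<q in
          ⊆-trans Z⊆X X⊆Y , <-trans Z<X lt , gap-trans p<q q<y X≤ le′
        preserves : p <P y → Z ⊆ Y × ∣ Z ∣ < ∣ Y ∣ × ∣ Y ∣ ≤ ∣ Z ∣ + (ρ y ∸ ρ p) * D
        preserves p<y = from-gate (proj₂ (Down.gate acyclic (connected inv) q∈ y∉ (inj₁ cov) (∈-map⁺ node e′∈) p<y))
      new-old : ∀ {e} → e ∈ˡ es → Faithful (y , Y , j′) e
      new-old {p , Z , _} e′∈ =
        (λ Y⊆Z → ⊥-elim (proj₂ (good (∈-map⁺ set e′∈)) Y⊆Z)) ,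
        (λ y≡p → contradiction (subst (_∈ˡ _) (sym y≡p) (∈-map⁺ node e′∈)) y∉) ,
        (λ y<p → ⊥-elim (<P-irrefl refl (<P-trans q<y (proj₁ (Up.gate acyclic (connected inv) q∈ y∉ (inj₁ cov) (∈-map⁺ node e′∈) y<p)))))

  extend-down : ∀ {f es q X j y} → Partial (suc f) es → (q , X , j) ∈ˡ es → Covers P y q → ¬ y ∈ˡ map node es →
                ∃ λ e → Partial f (e ∷ es)
  extend-down {f} {es} {q} {X} {j} {y} inv e∈ cov@(y<q , _) y∉ = attach
    (reach-down (ρ q ∸ suc (ρ y)) (ρ y) j′ {X} (map set es)
      (subst₂ (λ r j → X ∈F R r j) (sym (rank-gap y<q)) (sym (proj₁ levels)) (proj₁ (level inv e∈))) (few inv) (near-down inv e∈))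
    where
    j′ : ℕ
    j′ = j ∸ suc (ρ q ∸ suc (ρ y))
    levels : (suc (ρ q ∸ suc (ρ y)) + j′ ≡ j) × f * k ≤ j′
    levels = drop-level {f} {j} (proj₂ (level inv e∈)) (gap-≤k y<q)
    q∈ : q ∈ˡ map node es
    q∈ = ∈-map⁺ node e∈
    attach : Below-by (suc (ρ q ∸ suc (ρ y)) * D) (R (ρ y) j′) X (map set es) → ∃ λ e → Partial f (e ∷ es)
    attach (Y , Y∈ , Y⊆X , lt , le , good) =
      (y , Y , j′) , extend inv q∈ (inj₂ cov) y∉ Y∈ (proj₂ levels) old-new new-old
      where
      le′ : ∣ X ∣ ≤ ∣ Y ∣ + (ρ q ∸ ρ y) * D
      le′ = subst (λ g → ∣ X ∣ ≤ ∣ Y ∣ + g * D) (sym (gap≡ y<q)) le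
      new-old : ∀ {e} → e ∈ˡ es → Faithful (y , Y , j′) e
      new-old {p , Z , _} e′∈ = reflects , (λ y≡p → contradiction (subst (_∈ˡ _) (sym y≡p) (∈-map⁺ node e′∈)) y∉) , preserves
        where
        reflects : Y ⊆ Z → y ≡ p ⊎ y <P p
        reflects Y⊆Z = [ (λ { refl → inj₂ y<q }) , (λ q<p → inj₂ (<P-trans y<q q<p)) ]′
          (proj₁ (faithful inv e∈ e′∈) (proj₁ (good (∈-map⁺ set e′∈)) Y⊆Z))
        from-gate : q ≡ p ⊎ q <P p → Y ⊆ Z × ∣ Y ∣ < ∣ Z ∣ × ∣ Z ∣ ≤ ∣ Y ∣ + (ρ p ∸ ρ y) * D
        from-gate (inj₁ refl) = subst (λ Z → Y ⊆ Z × ∣ Y ∣ < ∣ Z ∣ × ∣ Z ∣ ≤ ∣ Y ∣ + (ρ p ∸ ρ y) * D)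
          (proj₁ (proj₂ (faithful inv e∈ e′∈)) refl) (Y⊆X , lt , le′)
        from-gate (inj₂ q<p) = let (X⊆Z , X<Z , Z≤) = proj₂ (proj₂ (faithful inv e∈ e′∈)) q<p in
          ⊆-trans Y⊆X X⊆Z , <-trans lt X<Z , gap-trans y<q q<p le′ Z≤
        preserves : y <P p → Y ⊆ Z × ∣ Y ∣ < ∣ Z ∣ × ∣ Z ∣ ≤ ∣ Y ∣ + (ρ p ∸ ρ y) * D
        preserves y<p = from-gate (proj₂ (Up.gate acyclic (connected inv) q∈ y∉ (inj₂ cov) (∈-map⁺ node e′∈) y<p))
      old-new : ∀ {e} → e ∈ˡ es → Faithful e (y , Y , j′)
      old-new {p , Z , _} e′∈ =
        (λ Z⊆Y → ⊥-elim (proj₂ (good (∈-map⁺ set e′∈)) Z⊆Y)) ,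
        (λ p≡y → contradiction (subst (_∈ˡ _) p≡y (∈-map⁺ node e′∈)) y∉) ,
        (λ p<y → ⊥-elim (<P-irrefl refl (<P-trans (proj₁ (Down.gate acyclic (connected inv) q∈ y∉ (inj₂ cov) (∈-map⁺ node e′∈) p<y)) y<q)))

  complete : ∀ {f es} → Partial f es → (∀ x → x ∈ˡ map node es) → InducedCopy P F
  complete {f} {es} inv all = φ , injective , (λ x → R⊆F (ρ x) (lev x) (proj₁ (level inv (entry∈ x)))) , λ x y → reflects , preserves
    where
    entry : ∀ x → ∃ λ Xj → (x , Xj) ∈ˡ es
    entry x = let ((_ , Xj) , e∈ , x≡) = ∈-map⁻ node (all x) in Xj , subst (λ y → (y , Xj) ∈ˡ es) (sym x≡) e∈
    φ : Fin size → Subset n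
    φ x = proj₁ (proj₁ (entry x))
    lev : Fin size → ℕ
    lev x = proj₂ (proj₁ (entry x))
    entry∈ : ∀ x → (x , φ x , lev x) ∈ˡ es
    entry∈ x = proj₂ (entry x)
    below : ∀ x y → φ x ⊆ φ y → x ≡ y ⊎ x <P y
    below x y = proj₁ (faithful inv (entry∈ x) (entry∈ y))
    antisym : ∀ {x y} → x ≡ y ⊎ x <P y → y ≡ x ⊎ y <P x → x ≡ y
    antisym (inj₁ x≡y) _          = x≡y
    antisym (inj₂ _)   (inj₁ y≡x) = sym y≡x
    antisym (inj₂ x<y) (inj₂ y<x) = ⊥-elim (<P-irrefl refl (<P-trans x<y y<x))
    injective : ∀ {x y} → φ x ≡ φ y → x ≡ y
    injective {x} {y} eq = antisym (below x y (subst (φ x ⊆_) eq ⊆-refl)) (below y x (subst (_⊆ φ x) eq ⊆-refl))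
    reflects : ∀ {x y} → φ x ⊂ φ y → x <P y
    reflects {x} {y} (x⊆y , e , e∈ , e∉) = [ (λ { refl → contradiction e∈ e∉ }) , id ]′ (below x y x⊆y)
    preserves : ∀ {x y} → x <P y → φ x ⊂ φ y
    preserves {x} {y} x<y = let (x⊆y , lt , _) = proj₂ (proj₂ (faithful inv (entry∈ x) (entry∈ y))) x<y in
      x⊆y , ⊈⇒∃ (λ y⊆x → <⇒≱ lt (p⊆q⇒∣p∣≤∣q∣ y⊆x))

  unfinished : ∀ {f es} → Partial f es → (∀ x → x ∈ˡ map node es) ⊎ (∃ λ x → ¬ x ∈ˡ map node es)
  unfinished {es = es} inv = decide (Finₚ.any? (λ x → ¬? (x ∈?ns map node es)))
    where
    decide : Dec (∃ λ x → ¬ x ∈ˡ map node es) → (∀ x → x ∈ˡ map node es) ⊎ (∃ λ x → ¬ x ∈ˡ map node es)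
    decide (yes ∃x) = inj₂ ∃x
    decide (no ∄x)  = inj₁ (λ x → decidable-stable (x ∈?ns map node es) (λ x∉ → ∄x (x , x∉)))

  grow : ∀ f {e es} → Partial f (e ∷ es) → InducedCopy P F
  grow-at : ∀ f {e es} → Partial f (e ∷ es) →
            (∃ λ q → ∃ λ y → q ∈ˡ map node (e ∷ es) × ¬ y ∈ˡ map node (e ∷ es) × HasseAdj P q y) → InducedCopy P F
  grow f {e} inv = [ complete inv , (λ (x , x∉) → grow-at f inv (crossing (proj₁ (proj₂ tree) (node e) x) (here refl) x∉)) ]′
                   (unfinished inv)
  grow-at zero {e} {es} inv (q , y , q∈ , y∉ , adj) =
    -- With no node missing, `size` distinct nodes are placed, and `y` would be one too many.
    contradiction (unique-length (All.tabulate (λ x∈ y≡x → y∉ (subst (_∈ˡ _) (sym y≡x) x∈)) ∷ unique inv))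
      (<⇒≱ (s≤s (≤-reflexive (trans (sym (total inv)) (trans (+-identityʳ _) (sym (length-map node (e ∷ es))))))))
  grow-at (suc f) {e} {es} inv (q , y , q∈ , y∉ , adj) = let ((_ , Xj) , e∈ , q≡) = ∈-map⁻ node q∈ in
    step′ (subst (λ q → (q , Xj) ∈ˡ e ∷ es) (sym q≡) e∈) adj
    where
    step′ : ∀ {X j} → (q , X , j) ∈ˡ e ∷ es → HasseAdj P q y → InducedCopy P F
    step′ e∈ (inj₁ cov) = grow f (proj₂ (extend-up inv e∈ cov y∉))
    step′ e∈ (inj₂ cov) = grow f (proj₂ (extend-down inv e∈ cov y∉))

  -- `k` levels to move from an arbitrary rank to the rank of the first node, and `k` more for each
  -- node of `P`.
  depth : ℕ
  depth = k + size * k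

  -- From such a set, `reach-up` or `reach-down` with nothing to avoid leads to a set at the rank of
  -- node zero. It still has `size * k` levels, enough to embed all of `P`.
  R-empty : InducedFree P F → ∀ {r v} → r < k → ¬ v ∈F R r (suc depth)
  R-empty free {r} {v} r<k v∈ = free (at-root (proj₁ tree))
    where
    start : ∀ x {j X} → 1 ≤ size → X ∈F R (ρ x) j → size * k ≤ j → InducedCopy P F
    start x {j} {X} 1≤size X∈ le = grow (size ∸ 1) {x , X , j} {[]} (record
      { faithful  = λ { (here refl) (here refl) → (λ _ → inj₁ refl) , (λ _ → refl) , (λ x<x → contradiction x<x (<P-irrefl refl)) }
      ; level     = λ { (here refl) → X∈ , ≤-trans (*-monoˡ-≤ k (m∸n≤m size 1)) le }
      ; connected = singleton-connected x
      ; unique    = [] ∷ []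
      ; total     = m+[n∸m]≡n 1≤size
      })
    at-root : 1 ≤ size → InducedCopy P F
    at-root 1≤size = from (<-cmp r (ρ x))
      where
      x : Fin size
      x = Data.Fin.fromℕ< 1≤size
      from : Tri (r < ρ x) (r ≡ ρ x) (ρ x < r) → InducedCopy P F
      from (tri≈ _ r≡ _) = start x 1≤size (subst (λ r → v ∈F R r (suc depth)) r≡ v∈) (≤-trans (m≤n+m _ k) (n≤1+n _))
      from (tri< r< _ _) =
        let gap = trans (+-suc r _) (m+[n∸m]≡n r<)
            (j≡ , le) = drop-level {size} {suc depth} (n≤1+n _) (≤-trans (m≤n+m _ r) (≤-trans (≤-reflexive gap) (<⇒≤ (ρ<k x))))
            (y , y∈ , _) = reach-up (ρ x ∸ suc r) r (suc depth ∸ suc (ρ x ∸ suc r)) {v} [] (subst (_< k) (sym gap) (ρ<k x))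
                             (subst (λ j → v ∈F R r j) (sym j≡) v∈) z≤n (λ ())
        in start x 1≤size (subst (λ s → y ∈F R s (suc depth ∸ suc (ρ x ∸ suc r))) gap y∈) le
      from (tri> _ _ r>) =
        let gap = trans (+-suc (ρ x) _) (m+[n∸m]≡n r>)
            (j≡ , le) = drop-level {size} {suc depth} (n≤1+n _) (≤-trans (m≤n+m _ (ρ x)) (≤-trans (≤-reflexive gap) (<⇒≤ r<k)))
            (y , y∈ , _) = reach-down (r ∸ suc (ρ x)) (ρ x) (suc depth ∸ suc (r ∸ suc (ρ x))) {v} []
                             (subst₂ (λ r j → v ∈F R r j) (sym gap) (sym j≡) v∈) z≤n (λ ())
        in start x 1≤size y∈ le

  module Classes (free : InducedFree P F) where

    -- For `r < k`, `R-empty` makes a member of `F` fail at rank `r` at some depth; `g r v` is the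
    -- last depth before its first failure.
    g : ℕ → Subset n → ℕ
    g r v = first-failure (λ j → R r j v) depth

    R-below-g : ∀ {r v i} → v ∈F F → i ≤ g r v → v ∈F R r i
    R-below-g {r} {v} v∈ = first-failure-true (λ j → R r j v) depth (R-zero r v∈)

    poor-at-g : ∀ {r v} → r < k → v ∈F F →
                (suc r < k × ¬ UpRich v (R (suc r) (g r v))) ⊎ (0 < r × ¬ DownRich v (R (pred r) (g r v)))
    poor-at-g {r} {v} r<k v∈ = R-poor {r} {g r v} v∈ (first-failure-false (λ j → R r j v) depth (R-empty free {r} {v} r<k))

    Class? : ∀ r v → Dec (v ∈F F × ¬ UpRich v (R (suc r) (g r v)) × ¬ DownRich v (R r (g (suc r) v)))
    Class? r v = v ∈F? F ×-dec ¬? (UpRich? v (R (suc r) (g r v))) ×-dec ¬? (DownRich? v (R r (g (suc r) v)))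

    class : ℕ → Family n
    class r v = does (Class? r v)

    class⁻ : ∀ {r v} → v ∈F class r → v ∈F F × ¬ UpRich v (R (suc r) (g r v)) × ¬ DownRich v (R r (g (suc r) v))
    class⁻ {r} {v} = does⇒ (Class? r v)

    -- The rank 0 can only fail upwards and the rank k − 1 only downwards, so
    -- two consecutive ranks fail towards each other.
    classes-cover : ∀ {v} → v ∈F F → ∃ λ r → suc r < k × v ∈F class r
    classes-cover {v} v∈ = from-0 k refl
      where
      from : ∀ f r → k ∸ r ≤ f → suc r < k → ¬ UpRich v (R (suc r) (g r v)) → ∃ λ r → suc r < k × v ∈F class r
      from zero r le r<k _ = contradiction (≤-trans (m<n⇒0<n∸m (<-trans (n<1+n r) r<k)) le) λ ()
      from (suc f) r le r<k poor with poor-at-g {suc r} {v} r<k v∈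
      ... | inj₂ (_ , poor′) = r , r<k , dec-true (Class? r v) (v∈ , poor , poor′)
      ... | inj₁ (r′<k , poor′) = from f (suc r) (s≤s⁻¹ (≤-trans (∸-monoʳ-< (n<1+n r) (<⇒≤ r<k)) le)) r′<k poor′
      from-0 : ∀ k′ → k′ ≡ k → ∃ λ r → suc r < k × v ∈F class r
      from-0 zero    eq = contradiction (<-≤-trans (ρ<k (Data.Fin.fromℕ< (proj₁ tree))) (≤-reflexive (sym eq))) λ ()
      from-0 (suc _) eq with poor-at-g {0} {v} (subst (0 <_) eq (s≤s z≤n)) v∈
      ... | inj₁ (1<k , poor) = from k 0 ≤-refl 1<k poor

    class-pairs : ∀ r → n * ∑ᶠ (class r) (#below D (class r)) ≤ 2 * (K * D) * mass (class r)
    class-pairs r = close-pairs D (K * D) (class r) (λ v → R (suc r) (g r v)) (λ y → R r (g (suc r) y))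
      (λ {c} {v} {y} v∈ y∈ _ _ _ → either v y (proj₁ (class⁻ v∈)) (proj₁ (class⁻ y∈)))
      (λ v∈ → ≮⇒≥ (proj₁ (proj₂ (class⁻ v∈))))
      (λ v∈ → ≮⇒≥ (proj₂ (proj₂ (class⁻ v∈))))
      where
      either : ∀ v y → v ∈F F → y ∈F F → y ∈F R (suc r) (g r v) ⊎ v ∈F R r (g (suc r) y)
      either v y v∈ y∈ with ≤-total (g r v) (g (suc r) y)
      ... | inj₁ le = inj₁ (R-below-g {suc r} {y} y∈ le)
      ... | inj₂ le = inj₂ (R-below-g {r} {v} v∈ le)

-- Containers for sparse families

_∖F_ : ∀ {n} → Family n → Family n → Family n
(C ∖F S) v = C v ∧ not (S v)

⁅_⁆F : ∀ {n} → Subset n → Family n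
⁅ v ⁆F u = does (u ≟ₛ v)

not-true⁻ : ∀ {b} → not b ≡ true → ¬ b ≡ true
not-true⁻ {false} _ ()

not-true⁺ : ∀ {b} → ¬ b ≡ true → not b ≡ true
not-true⁺ {true}  ¬b = contradiction refl ¬b
not-true⁺ {false} _  = refl

module _ {n : ℕ} where

  ∖-intro : ∀ {C S : Family n} {v} → v ∈F C → ¬ v ∈F S → v ∈F (C ∖F S)
  ∖-intro v∈ v∉ = ∧-true⁺ v∈ (not-true⁺ v∉)

  ∖-elim : ∀ {C S : Family n} {v} → v ∈F (C ∖F S) → v ∈F C × ¬ v ∈F S
  ∖-elim {C} {S} {v} v∈ = proj₁ (∧-true {C v} v∈) , not-true⁻ (proj₂ (∧-true {C v} v∈))

  ∈⁅⁆ : ∀ (v : Subset n) → v ∈F ⁅ v ⁆F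
  ∈⁅⁆ v = dec-true (v ≟ₛ v) refl

  ∈⁅⁆⇒≡ : ∀ {u v : Subset n} → u ∈F ⁅ v ⁆F → u ≡ v
  ∈⁅⁆⇒≡ {u} {v} = does⇒ (u ≟ₛ v)

  count-< : ∀ {X Y : Family n} v → X ⊆F Y → v ∈F Y → ¬ v ∈F X → count X < count Y
  count-< {X} {Y} v X⊆Y v∈Y v∉X = begin
    suc (count X) ≤⟨ +-monoˡ-≤ (count X) (≤-trans (≤-reflexive (sym (𝟙-yes (v ∈F? ⁅ v ⁆F) (∈⁅⁆ v))))
                                                            (∑-≥ (λ u → 𝟙 (u ∈F? ⁅ v ⁆F)) (∈-subsets v))) ⟩
    ∑ (subsets n) (λ u → 𝟙 (u ∈F? ⁅ v ⁆F)) + count X ≡⟨ ∑-+ (subsets n) _ _ ⟨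
    _ ≤⟨ ∑-mono (subsets n) disjoint ⟩
    count Y ∎
    where
    open ≤-Reasoning
    disjoint : ∀ u → 𝟙 (u ∈F? ⁅ v ⁆F) + 𝟙 (u ∈F? X) * 1 ≤ 𝟙 (u ∈F? Y) * 1
    disjoint u = go (u ∈F? ⁅ v ⁆F) (u ∈F? X)
      where
      go : (d : Dec (u ∈F ⁅ v ⁆F)) (e : Dec (u ∈F X)) → 𝟙 d + 𝟙 e * 1 ≤ 𝟙 (u ∈F? Y) * 1
      go (yes u≡v) (yes u∈X) = contradiction (subst (_∈F X) (∈⁅⁆⇒≡ u≡v) u∈X) v∉X
      go (yes u≡v) (no _)    = ≤-reflexive (sym (trans (*-identityʳ _) (𝟙-yes (u ∈F? Y) (subst (_∈F Y) (sym (∈⁅⁆⇒≡ u≡v)) v∈Y))))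
      go (no _)    (yes u∈X) = ≤-reflexive (sym (trans (*-identityʳ _) (𝟙-yes (u ∈F? Y) (X⊆Y u∈X))))
      go (no _)    (no _)    = z≤n

  Below-mono : ∀ {D} {R R′ : Family n} {c v} → R ⊆F R′ → Below D R c v → Below D R′ c v
  Below-mono R⊆R′ (u , u∈ , rest) = u , R⊆R′ u∈ , rest

  #below-mono : ∀ D {R R′ : Family n} → R ⊆F R′ → ∀ y → #below D R y ≤ #below D R′ y
  #below-mono D {R} {R′} R⊆R′ y = ∑-mono (Ω n) (λ c →
    𝟙-mono (On? c y ×-dec Below? D R c y) (On? c y ×-dec Below? D R′ c y) (λ (on , b) → on , Below-mono {D} {R} {R′} {c} {y} R⊆R′ b))

-- Σ_{i ≤ s} (m choose i), which bounds the number of leaves of a binary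
-- decision tree of depth m with at most s positive answers on each branch.
leaves : ℕ → ℕ → ℕ
leaves m       zero    = 1
leaves zero    (suc s) = 1
leaves (suc m) (suc s) = leaves m (suc s) + leaves m s

1≤leaves : ∀ m s → 1 ≤ leaves m s
1≤leaves m       zero    = ≤-refl
1≤leaves zero    (suc s) = ≤-refl
1≤leaves (suc m) (suc s) = ≤-trans (1≤leaves m (suc s)) (m≤m+n _ _)

_⊑_ : ∀ {n} → Family n → Family n → Set
A ⊑ C = ∀ v → v ∈F A → v ∈F C

-- `Sparse` lets a share of `θ / n` of the chains through a set meet `S` closely below it, and by
-- `few-pairs` a single set alone stays within this share. `sl` cuts the layers into `M` slabs such
-- that members of `C₀` of different sizes in one slab differ in size by at most `D`.
module Containers {n : ℕ} (D θ G N M : ℕ) (sl : ℕ → ℕ) (C₀ : Family n)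
  (0<n : 0 < n) (w-large : ∀ v → length (Ω n) ≤ N * w {n} v) (0<Ω : 0 < length (Ω n))
  (sl<M : ∀ {y} → y ∈F C₀ → sl ∣ y ∣ < M)
  (same : ∀ {v y} → v ∈F C₀ → y ∈F C₀ → ∣ v ∣ < ∣ y ∣ → sl ∣ v ∣ ≡ sl ∣ y ∣ → ∣ y ∣ ≤ ∣ v ∣ + D)
  (few-pairs : ∀ {v y : Subset n} → y ∈F C₀ →
     n * ∑ (Ω n) (λ c → 𝟙 (On? c y ×-dec On? c v ×-dec Close? D v y)) ≤ θ * w y) where

  Sparse : Family n → Subset n → Set
  Sparse S y = n * #below D S y ≤ θ * w y

  Sparse? : ∀ S y → Dec (Sparse S y)
  Sparse? S y = n * #below D S y ≤? θ * w y

  new? : ∀ (S : Family n) (v y : Subset n) (c : Chain n) → Dec ((On c y × On c v × Close D v y) × ¬ Below D S c y)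
  new? S v y c = (On? c y ×-dec On? c v ×-dec Close? D v y) ×-dec ¬? (Below? D S c y)

  new : Family n → Subset n → Subset n → ℕ
  new S v y = ∑ (Ω n) (λ c → 𝟙 (new? S v y c))

  pairs : Subset n → Subset n → ℕ
  pairs v y = ∑ (Ω n) (λ c → 𝟙 (On? c y ×-dec On? c v ×-dec Close? D v y))

  gain : Family n → Family n → Subset n → ℕ
  gain C S v = ∑ᶠ C (new S v)

  -- The slack lost when v enters S is n times its gain; this limits the size of S.
  slack : Family n → Subset n → ℕ
  slack S y = 2 * θ * w y ∸ n * #below D S y

  insert : Family n → Subset n → Family n
  insert S v = S ∪F ⁅ v ⁆F

  remove : Family n → Subset n → Family n
  remove C v = C ∖F ⁅ v ⁆F

  prune : Family n → Family n → Family n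
  prune C S y = C y ∧ does (Sparse? S y)

  #below+new : ∀ S v y → #below D S y + new S v y ≤ #below D (insert S v) y
  #below+new S v y = ≤-trans (≤-reflexive (sym (∑-+ (Ω n) _ _))) (∑-mono (Ω n) λ c → bound c (Below? D S c y))
    where
    bound : ∀ c (b? : Dec (Below D S c y)) →
      𝟙 (On? c y ×-dec b?) + 𝟙 ((On? c y ×-dec On? c v ×-dec Close? D v y) ×-dec ¬? b?) ≤ 𝟙 (On? c y ×-dec Below? D (insert S v) c y)
    bound c (yes b) = ≤-trans (≤-reflexive (trans (cong (𝟙 (On? c y ×-dec yes b) +_)
        (𝟙-no ((On? c y ×-dec On? c v ×-dec Close? D v y) ×-dec ¬? (yes b)) (λ (_ , ¬b) → ¬b b))) (+-identityʳ _)))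
      (𝟙-mono (On? c y ×-dec yes b) (On? c y ×-dec Below? D (insert S v) c y) (λ (on , b) → on , Below-mono {D = D} {S} {insert S v} {c} {y} ∨-trueˡ b))
    bound c (no ¬b) = ≤-trans (≤-reflexive (cong (_+ 𝟙 ((On? c y ×-dec On? c v ×-dec Close? D v y) ×-dec ¬? (no ¬b)))
        (𝟙-no (On? c y ×-dec no ¬b) (λ (_ , b) → ¬b b))))
      (𝟙-mono ((On? c y ×-dec On? c v ×-dec Close? D v y) ×-dec ¬? (no ¬b)) (On? c y ×-dec Below? D (insert S v) c y)
        (λ ((on , onv , cl) , _) → on , v , ∨-trueʳ {S v} (∈⁅⁆ v) , onv , cl))

  #below-insert : ∀ S v y → #below D (insert S v) y ≤ #below D S y + pairs v y
  #below-insert S v y = ≤-trans (∑-mono (Ω n) (λ c → 𝟙-⊎ (On? c y ×-dec Below? D (insert S v) c y)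
      (On? c y ×-dec Below? D S c y) (On? c y ×-dec On? c v ×-dec Close? D v y) (split c))) (≤-reflexive (∑-+ (Ω n) _ _))
    where
    split : ∀ c → On c y × Below D (insert S v) c y → (On c y × Below D S c y) ⊎ (On c y × On c v × Close D v y)
    split c (on , u , u∈ , onu , cl) = [ (λ u∈S → inj₁ (on , u , u∈S , onu , cl)) ,
      (λ u∈v → inj₂ (on , subst (λ u → On c u × Close D u y) (∈⁅⁆⇒≡ u∈v) (onu , cl))) ]′ (∨-true⁻ u∈)

  -- The `2 * θ` in `slack` leaves room for one insertion into a sparse state. Hence the truncated
  -- subtraction is exact even for a `y` that the insertion makes heavy and that is pruned only
  -- afterwards.
  slack-insert : ∀ S v {y} → y ∈F C₀ → Sparse S y → slack (insert S v) y + n * new S v y ≤ slack S y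
  slack-insert S v {y} y∈ sparse = m+n≤o⇒m≤o∸n _ (begin
    slack (insert S v) y + n * new S v y + n * #below D S y ≡⟨ +-assoc (slack (insert S v) y) _ _ ⟩
    slack (insert S v) y + (n * new S v y + n * #below D S y) ≡⟨ cong (slack (insert S v) y +_) (trans (sym (*-distribˡ-+ n _ _)) (cong (n *_) (+-comm (new S v y) _))) ⟩
    slack (insert S v) y + n * (#below D S y + new S v y) ≤⟨ +-monoʳ-≤ (slack (insert S v) y) (*-monoʳ-≤ n (#below+new S v y)) ⟩
    slack (insert S v) y + n * #below D (insert S v) y ≡⟨ m∸n+n≡m bounded ⟩
    2 * θ * w y ∎)
    where
    open ≤-Reasoning
    bounded : n * #below D (insert S v) y ≤ 2 * θ * w y
    bounded = begin
      n * #below D (insert S v) y ≤⟨ *-monoʳ-≤ n (#below-insert S v y) ⟩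
      n * (#below D S y + pairs v y) ≡⟨ *-distribˡ-+ n _ _ ⟩
      n * #below D S y + n * pairs v y ≤⟨ +-mono-≤ sparse (few-pairs y∈) ⟩
      θ * w y + θ * w y ≡⟨ cong (θ * w y +_) (+-identityʳ _) ⟨
      2 * (θ * w y) ≡⟨ *-assoc 2 θ (w y) ⟨
      2 * θ * w y ∎

  -- Divided by `n * G`: `mass C` is at most `M * n !` plus the fraction `θ / n + 1 / G` of itself.
  Tight : Family n → Set
  Tight C = n * (G * mass C) ≤ n * (G * (M * length (Ω n))) + (G * θ + n) * mass C

  -- A chain that meets `C` closely below `y` either meets `S` there, which is rare because `y` is
  -- sparse, or produces a new pair with a member of `C` outside `S`. The new pairs at each such
  -- member are few, because the construction stopped with all gains small.
  tight : ∀ C S → C ⊆F C₀ → (∀ {y} → y ∈F C → Sparse S y) →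
          (∀ {v} → v ∈F (C ∖F S) → G * gain C S v ≤ w v) → Tight C
  tight C S C⊆C₀ sparse small = begin
    n * (G * mass C)
      ≤⟨ *-monoʳ-≤ n (*-monoʳ-≤ G (mass-≤-classes D M sl C (λ y∈ → sl<M (C⊆C₀ y∈)) (λ v∈ y∈ → same (C⊆C₀ v∈) (C⊆C₀ y∈)))) ⟩
    n * (G * (m₀ + ∑ᶠ C (#below D C)))
      ≤⟨ *-monoʳ-≤ n (*-monoʳ-≤ G (+-monoʳ-≤ m₀ pairs≤)) ⟩
    n * (G * (m₀ + (old + fresh))) ≡⟨ expand n G m₀ old fresh ⟩
    n * (G * m₀) + (G * (n * old) + n * (G * fresh))
      ≤⟨ +-monoʳ-≤ (n * (G * m₀)) (+-mono-≤ (*-monoʳ-≤ G old≤) (*-monoʳ-≤ n fresh≤)) ⟩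
    n * (G * m₀) + (G * (θ * mass C) + n * mass C) ≡⟨ cong (n * (G * m₀) +_) (collect G θ n (mass C)) ⟩
    n * (G * m₀) + (G * θ + n) * mass C ∎
    where
    open ≤-Reasoning
    m₀ = M * length (Ω n)
    old = ∑ᶠ C (#below D S)
    fresh = ∑ᶠ (C ∖F S) (gain C S)
    expand : ∀ n g m a b → n * (g * (m + (a + b))) ≡ n * (g * m) + (g * (n * a) + n * (g * b))
    expand = solve-∀
    collect : ∀ g t n m → g * (t * m) + n * m ≡ (g * t + n) * m
    collect = solve-∀
    old≤ : n * old ≤ θ * mass C
    old≤ = begin
      n * old ≡⟨ ∑ᶠ-*ˡ C n (#below D S) ⟨
      ∑ᶠ C (λ y → n * #below D S y) ≤⟨ ∑ᶠ-mono C (λ y → sparse) ⟩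
      ∑ᶠ C (λ y → θ * w y) ≡⟨ ∑ᶠ-*ˡ C θ w ⟩
      θ * mass C ∎
    fresh≤ : G * fresh ≤ mass C
    fresh≤ = begin
      G * fresh ≡⟨ ∑ᶠ-*ˡ (C ∖F S) G (gain C S) ⟨
      ∑ᶠ (C ∖F S) (λ v → G * gain C S v) ≤⟨ ∑ᶠ-mono (C ∖F S) (λ v → small) ⟩
      mass (C ∖F S) ≤⟨ ∑ᶠ-⊆ w (λ {v} v∈ → proj₁ (∖-elim {C = C} {S} {v} v∈)) ⟩
      mass C ∎
    split : ∀ y c → 𝟙 (On? c y ×-dec Below? D C c y) ≤
            𝟙 (On? c y ×-dec Below? D S c y) + ∑ᶠ (C ∖F S) (λ v → 𝟙 (new? S v y c))
    split y c = 𝟙≤ (On? c y ×-dec Below? D C c y) (λ (on , v , v∈ , onv , cl) → case Below? D S c y of λ where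
      (yes b) → ≤-trans (≤-reflexive (sym (𝟙-yes (On? c y ×-dec Below? D S c y) (on , b)))) (m≤m+n _ _)
      (no ¬b) → let v∈′ = ∖-intro {C = C} {S} v∈ (λ v∈S → ¬b (v , v∈S , onv , cl)) in
        ≤-trans (≤-reflexive (sym (cong₂ _*_ (𝟙-yes (v ∈F? (C ∖F S)) v∈′) (𝟙-yes (new? S v y c) ((on , onv , cl) , ¬b)))))
          (≤-trans (∑-≥ (λ v → 𝟙 (v ∈F? (C ∖F S)) * 𝟙 (new? S v y c)) (∈-subsets v)) (m≤n+m _ (𝟙 (On? c y ×-dec Below? D S c y)))))
    pairs≤ : ∑ᶠ C (#below D C) ≤ old + fresh
    pairs≤ = begin
      ∑ᶠ C (#below D C) ≤⟨ ∑ᶠ-mono C (λ y _ → ≤-trans (∑-mono (Ω n) (split y)) (≤-reflexive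
          (trans (∑-+ (Ω n) _ _) (cong (#below D S y +_) (sym (∑ᶠ-swap (C ∖F S) (Ω n) (λ v c → 𝟙 (new? S v y c)))))))) ⟩
      ∑ᶠ C (λ y → #below D S y + ∑ᶠ (C ∖F S) (λ v → new S v y)) ≡⟨ ∑ᶠ-+ C _ _ ⟩
      old + ∑ᶠ C (λ y → ∑ᶠ (C ∖F S) (λ v → new S v y)) ≡⟨ cong (old +_) (exchange (C ∖F S)) ⟩
      old + fresh ∎
      where
      exchange : ∀ B → ∑ᶠ C (λ y → ∑ᶠ B (λ v → new S v y)) ≡ ∑ᶠ B (gain C S)
      exchange B = trans (∑ᶠ-swap C (subsets n) (λ y v → 𝟙 (v ∈F? B) * new S v y))
        (∑-cong (subsets n) (λ v → ∑ᶠ-*ˡ C (𝟙 (v ∈F? B)) (new S v)))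

  Good : Family n → Set
  Good A = ∀ {y} → y ∈F A → Sparse A y

  -- The state of a branch: all members of A lie in C, and S is the set of those
  -- found so far.
  Output : Family n → Family n → ℕ → Set
  Output C S ℓ = ∃ λ Cs → length Cs ≤ ℓ × All (λ C′ → C′ ⊑ C₀ × Tight C′) Cs ×
                 (∀ A → A ⊑ C → S ⊑ A → Good A → Any (A ⊑_) Cs)

  -- Pruning loses no member of `A` in the branch where `v` is in `A`: members of `A` are sparse
  -- towards `A`, hence towards its subfamily `insert S v`.
  combine-outputs : ∀ {C S} v {ℓ ℓ′} → Output (remove C v) S ℓ → Output (prune C (insert S v)) (insert S v) ℓ′ → Output C S (ℓ + ℓ′)
  combine-outputs {C} {S} v (Cs , len , ok , cov) (Cs′ , len′ , ok′ , cov′) =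
    Cs ++ Cs′ , ≤-trans (≤-reflexive (length-++ Cs)) (+-mono-≤ len len′) , all-++ ok ok′ , covers
    where
    covers : ∀ A → A ⊑ C → S ⊑ A → Good A → Any (A ⊑_) (Cs ++ Cs′)
    covers A A⊑C S⊑A good = case v ∈F? A of λ where
      (no v∉) → any-++ˡ (cov A (λ u u∈ → ∖-intro {C = C} {⁅ v ⁆F} (A⊑C u u∈) (λ u≡v → v∉ (subst (_∈F A) (∈⁅⁆⇒≡ u≡v) u∈))) S⊑A good)
      (yes v∈) → let S′⊑A = λ u u∈ → [ S⊑A u , (λ u≡v → subst (_∈F A) (sym (∈⁅⁆⇒≡ u≡v)) v∈) ]′ (∨-true⁻ u∈) in
        any-++ʳ Cs (cov′ A (λ u u∈ → ∧-true⁺ (A⊑C u u∈) (dec-true (Sparse? (insert S v) u)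
          (≤-trans (*-monoʳ-≤ n (#below-mono D {insert S v} {A} (λ {x} → S′⊑A x) u)) (good u∈)))) S′⊑A good)

  find? : ∀ C S → Dec (∃ λ v → v ∈F (C ∖F S) × w v < G * gain C S v)
  find? C S = anySubset? (λ v → v ∈F? (C ∖F S) ×-dec w v <? G * gain C S v)

  budget-insert : ∀ C S v → C ⊆F C₀ → (∀ {y} → y ∈F C → Sparse S y) →
    ∑ᶠ (prune C (insert S v)) (slack (insert S v)) + n * gain C S v ≤ ∑ᶠ C (slack S)
  budget-insert C S v C⊆C₀ sparse = begin
    ∑ᶠ (prune C (insert S v)) (slack (insert S v)) + n * gain C S v
      ≤⟨ +-monoˡ-≤ _ (∑ᶠ-⊆ (slack (insert S v)) (λ {y} y∈ → proj₁ (∧-true {C y} y∈))) ⟩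
    ∑ᶠ C (slack (insert S v)) + n * gain C S v ≡⟨ cong (∑ᶠ C (slack (insert S v)) +_) (∑ᶠ-*ˡ C n (new S v)) ⟨
    _ ≡⟨ ∑ᶠ-+ C (slack (insert S v)) (λ y → n * new S v y) ⟨
    ∑ᶠ C (λ y → slack (insert S v) y + n * new S v y) ≤⟨ ∑ᶠ-mono C (λ y y∈ → slack-insert S v (C⊆C₀ y∈) (sparse y∈)) ⟩
    ∑ᶠ C (slack S) ∎
    where open ≤-Reasoning

  -- `m` bounds the undecided sets and `s` the insertions that can still be paid for. An inserted
  -- `v` weighs at least `n ! / N` and less than `G` times its gain, so it takes at least `n * n !`
  -- off the budget `G * N * ∑ᶠ C (slack S)`.
  run : ∀ m s C S → C ⊆F C₀ → (∀ {y} → y ∈F C → Sparse S y) → count (C ∖F S) ≤ m →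
        G * N * ∑ᶠ C (slack S) ≤ s * (n * length (Ω n)) → Output C S (leaves m s)
  run-at : ∀ m s C S → C ⊆F C₀ → (∀ {y} → y ∈F C → Sparse S y) → count (C ∖F S) ≤ m →
        G * N * ∑ᶠ C (slack S) ≤ s * (n * length (Ω n)) →
        ∀ v → v ∈F (C ∖F S) → w v < G * gain C S v → Output C S (leaves m s)
  run m s C S C⊆C₀ sparse cnt bud = case find? C S of λ where
    (yes (v , v∈ , big)) → run-at m s C S C⊆C₀ sparse cnt bud v v∈ big
    (no none) → C ∷ [] , 1≤leaves m s ,
      ((λ v → C⊆C₀) , tight C S C⊆C₀ sparse (λ {v} v∈ → ≮⇒≥ (λ big → none (v , v∈ , big)))) ∷ [] ,
      (λ A A⊑C _ _ → here A⊑C)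
  run-at m s C S C⊆C₀ sparse cnt bud v v∈ big = go m s cnt bud
    where
    open ≤-Reasoning
    spent : n * length (Ω n) + G * N * ∑ᶠ (prune C (insert S v)) (slack (insert S v)) ≤ G * N * ∑ᶠ C (slack S)
    spent = begin
      n * length (Ω n) + G * N * rest ≤⟨ +-monoˡ-≤ (G * N * rest) (*-monoʳ-≤ n (w-large v)) ⟩
      n * (N * w v) + G * N * rest ≤⟨ +-monoˡ-≤ (G * N * rest) (*-monoʳ-≤ n (*-monoʳ-≤ N (<⇒≤ big))) ⟩
      n * (N * (G * gain C S v)) + G * N * rest ≡⟨ rearrange n N G (gain C S v) rest ⟩
      G * N * (rest + n * gain C S v) ≤⟨ *-monoʳ-≤ (G * N) (budget-insert C S v C⊆C₀ sparse) ⟩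
      G * N * ∑ᶠ C (slack S) ∎
      where
      rest = ∑ᶠ (prune C (insert S v)) (slack (insert S v))
      rearrange : ∀ n N g x r → n * (N * (g * x)) + g * N * r ≡ g * N * (r + n * x)
      rearrange = solve-∀
    count-remove : count (remove C v ∖F S) < count (C ∖F S)
    count-remove = count-< v
      (λ {u} u∈ → let (a , b) = ∖-elim {C = remove C v} {S} {u} u∈ in ∖-intro {C = C} {S} (proj₁ (∖-elim {C = C} {⁅ v ⁆F} {u} a)) b)
      v∈ (λ v∈′ → proj₂ (∖-elim {C = C} {⁅ v ⁆F} {v} (proj₁ (∖-elim {C = remove C v} {S} {v} v∈′))) (∈⁅⁆ v))
    count-insert : count (prune C (insert S v) ∖F insert S v) < count (C ∖F S)
    count-insert = count-< v
      (λ {u} u∈ → let (a , b) = ∖-elim {C = prune C (insert S v)} {insert S v} {u} u∈ in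
        ∖-intro {C = C} {S} (proj₁ (∧-true {C u} a)) (λ u∈S → b (∨-trueˡ u∈S)))
      v∈ (λ v∈′ → proj₂ (∖-elim {C = prune C (insert S v)} {insert S v} {v} v∈′) (∨-trueʳ {S v} (∈⁅⁆ v)))
    go : ∀ m s → count (C ∖F S) ≤ m → G * N * ∑ᶠ C (slack S) ≤ s * (n * length (Ω n)) → Output C S (leaves m s)
    go m zero cnt bud = contradiction
      (≤-trans (m≤m+n (n * length (Ω n)) _) (≤-trans spent bud)) (<⇒≱ (*-mono-≤ 0<n 0<Ω))
    go zero (suc s) cnt bud = contradiction (≤-trans count-remove cnt) λ ()
    go (suc m) (suc s) cnt bud = combine-outputs v
      (run m (suc s) (remove C v) S (λ {u} u∈ → C⊆C₀ (proj₁ (∖-elim {C = C} {⁅ v ⁆F} {u} u∈)))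
        (λ {u} u∈ → sparse (proj₁ (∖-elim {C = C} {⁅ v ⁆F} {u} u∈)))
        (s≤s⁻¹ (≤-trans count-remove cnt))
        (≤-trans (*-monoʳ-≤ (G * N) (∑ᶠ-⊆ (slack S) (λ {u} u∈ → proj₁ (∖-elim {C = C} {⁅ v ⁆F} {u} u∈)))) bud))
      (run m s (prune C (insert S v)) (insert S v) (λ {u} u∈ → C⊆C₀ (proj₁ (∧-true {C u} u∈)))
        (λ {u} u∈ → does⇒ (Sparse? (insert S v) u) (proj₂ (∧-true {C u} u∈)))
        (s≤s⁻¹ (≤-trans count-insert cnt))
        (+-cancelˡ-≤ (n * length (Ω n)) _ _ (≤-trans spent bud)))

-- Counting families

-- The usual tail estimate Σ_{i ≤ s} (m choose i) ≤ z^(-s) (1 + z)^m for z = 1 / a ≤ 1, with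
-- denominators cleared.
leaves-bound : ∀ a m s → 1 ≤ a → leaves m s * a ^ m ≤ a ^ s * suc a ^ m
leaves-bound a m zero 1≤a = begin
  1 * a ^ m ≡⟨ *-identityˡ _ ⟩
  a ^ m ≤⟨ ^-monoˡ-≤ m (n≤1+n a) ⟩
  suc a ^ m ≡⟨ *-identityˡ _ ⟨
  1 * suc a ^ m ∎
  where open ≤-Reasoning
leaves-bound a zero (suc s) 1≤a = *-monoˡ-≤ 1 (m^n>0 a {{>-nonZero 1≤a}} (suc s))
leaves-bound a (suc m) (suc s) 1≤a = begin
  (leaves m (suc s) + leaves m s) * (a * a ^ m) ≡⟨ split (leaves m (suc s)) (leaves m s) a (a ^ m) ⟩
  a * (leaves m (suc s) * a ^ m) + a * (leaves m s * a ^ m) ≤⟨ +-mono-≤ (*-monoʳ-≤ a (leaves-bound a m (suc s) 1≤a))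
                                                                               (*-monoʳ-≤ a (leaves-bound a m s 1≤a)) ⟩
  a * (a * a ^ s * suc a ^ m) + a * (a ^ s * suc a ^ m) ≡⟨ join a (a ^ s) (suc a ^ m) ⟩
  a * a ^ s * (suc a * suc a ^ m) ∎
  where
  open ≤-Reasoning
  split : ∀ x y a p → (x + y) * (a * p) ≡ a * (x * p) + a * (y * p)
  split = solve-∀
  join : ∀ a p q → a * (a * p * q) + a * (p * q) ≡ a * p * ((1 + a) * q)
  join = solve-∀

smalls : ∀ {n} → List (Subset n) → ℕ → List (Family n)
smalls xs       zero    = (λ _ → false) ∷ []
smalls []       (suc s) = (λ _ → false) ∷ []
smalls (x ∷ xs) (suc s) = smalls xs (suc s) ++ map (_∪F ⁅ x ⁆F) (smalls xs s)

length-smalls : ∀ {n} (xs : List (Subset n)) s → length (smalls xs s) ≡ leaves (length xs) s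
length-smalls xs       zero    = refl
length-smalls []       (suc s) = refl
length-smalls (x ∷ xs) (suc s) = trans (length-++ (smalls xs (suc s)))
  (cong₂ _+_ (length-smalls xs (suc s)) (trans (length-map _ (smalls xs s)) (length-smalls xs s)))

-- The converse inclusion `B′ ⊑ B` is recorded so that a bound on the mass of `B` passes to the
-- listed family.
smalls-cover : ∀ {n} (xs : List (Subset n)) s (B : Family n) → ∑ xs (λ v → 𝟙 (v ∈F? B)) ≤ s →
               Any (λ B′ → (∀ v → v ∈ˡ xs → v ∈F B → v ∈F B′) × B′ ⊑ B) (smalls xs s)
smalls-cover xs zero B le = here ((λ v v∈ v∈B → contradiction
  (≤-trans (≤-trans (≤-reflexive (sym (𝟙-yes (v ∈F? B) v∈B))) (∑-≥ (λ v → 𝟙 (v ∈F? B)) v∈)) le) λ ()) , λ v ())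
smalls-cover [] (suc s) B le = here ((λ v ()) , λ v ())
smalls-cover (x ∷ xs) (suc s) B le = at-x (x ∈F? B) le
  where
  at-x : (d : Dec (x ∈F B)) → 𝟙 d + ∑ xs (λ v → 𝟙 (v ∈F? B)) ≤ suc s →
         Any (λ B′ → (∀ v → v ∈ˡ x ∷ xs → v ∈F B → v ∈F B′) × B′ ⊑ B) (smalls (x ∷ xs) (suc s))
  at-x (no x∉) le = any-++ˡ (Any.map (λ (cov , sub) →
    (λ { v (here refl) v∈B → contradiction v∈B x∉ ; v (there v∈) v∈B → cov v v∈ v∈B }) , sub) (smalls-cover xs (suc s) B le))
  at-x (yes x∈) le = any-++ʳ (smalls xs (suc s)) (any-map (Any.map (λ {B′} (cov , sub) →
    (λ { v (here refl) v∈B → ∨-trueʳ {B′ v} (∈⁅⁆ v) ; v (there v∈) v∈B → ∨-trueˡ (cov v v∈ v∈B) }) ,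
    (λ v v∈ → [ sub v , (λ v≡x → subst (_∈F B) (sym (∈⁅⁆⇒≡ v≡x)) x∈) ]′ (∨-true⁻ v∈))) (smalls-cover xs s B (s≤s⁻¹ le))))

_⊑?_ : ∀ {n} (A C : Family n) → Dec (A ⊑ C)
A ⊑? C = decide (anySubset? (λ v → v ∈F? A ×-dec ¬? (v ∈F? C)))
  where
  decide : Dec (∃ λ v → v ∈F A × ¬ v ∈F C) → Dec (A ⊑ C)
  decide (yes (v , v∈ , v∉)) = no (λ A⊑C → v∉ (A⊑C v v∈))
  decide (no none)           = yes (λ v v∈ → decidable-stable (v ∈F? C) (λ v∉ → none (v , v∈ , v∉)))

length-split : ∀ {P : A → Set} (P? : ∀ x → Dec (P x)) (xs : List A) →
               length xs ≡ length (filter P? xs) + length (filter (¬? ∘ P?) xs)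
length-split P? []       = refl
length-split P? (x ∷ xs) with P? x
... | yes _ = cong suc (length-split P? xs)
... | no  _ = trans (cong suc (length-split P? xs)) (sym (+-suc _ _))

any-filter : ∀ {P Q : A → Set} (P? : ∀ x → Dec (P x)) {xs} → Any Q xs → (∀ {x} → Q x → P x) → Any Q (filter P? xs)
any-filter P? any Q⇒P = let (x , x∈ , qx) = find any in lose (∈-filter⁺ P? x∈ (Q⇒P qx)) qx

module _ {n : ℕ} where

  private
    Differ : List (Subset n) → Family n → Family n → Set
    Differ xs F G = ¬ (∀ v → v ∈ˡ xs → F v ≡ G v)

    forget : ∀ {x xs b Fs} → All (λ F → F x ≡ b) Fs → AllPairs (Differ (x ∷ xs)) Fs → AllPairs (Differ xs) Fs
    forget []       []       = []
    forget (p ∷ ps) (d ∷ ds) =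
      All.zipWith (λ (q , differ) same → differ (λ { v (here refl) → trans p (sym q) ; v (there v∈) → same v v∈ })) (ps , d) ∷ forget ps ds

    not-true : ∀ {b} → ¬ b ≡ true → b ≡ false
    not-true {true}  ¬b = contradiction refl ¬b
    not-true {false} _  = refl

    count-on : ∀ xs (C : Family n) Fs → AllPairs (Differ xs) Fs → All (_⊑ C) Fs → length Fs ≤ 2 ^ ∑ xs (λ v → 𝟙 (v ∈F? C))
    count-on [] C []           _               _ = z≤n
    count-on [] C (F ∷ [])     _               _ = ≤-refl
    count-on [] C (F ∷ G ∷ Fs) ((differ ∷ _) ∷ _) _ = contradiction (λ v ()) differ
    count-on (x ∷ xs) C Fs dist sub = at-x (x ∈F? C)
      where
      at-x : (d : Dec (x ∈F C)) → length Fs ≤ 2 ^ (𝟙 d + ∑ xs (λ v → 𝟙 (v ∈F? C)))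
      at-x (no x∉)  = count-on xs C Fs (forget (All.map (λ F⊑C → not-true (λ x∈ → x∉ (F⊑C x x∈))) sub) dist) sub
      at-x (yes x∈) = begin
        length Fs ≡⟨ length-split (λ F → x ∈F? F) Fs ⟩
        length (filter (λ F → x ∈F? F) Fs) + length (filter (λ F → ¬? (x ∈F? F)) Fs)
          ≤⟨ +-mono-≤
               (count-on xs C _ (forget (all-filter (λ F → x ∈F? F) Fs) (pairs-filter⁺ (λ F → x ∈F? F) dist)) (all-filter⁺ (λ F → x ∈F? F) sub))
               (count-on xs C _ (forget (All.map not-true (all-filter (λ F → ¬? (x ∈F? F)) Fs)) (pairs-filter⁺ (λ F → ¬? (x ∈F? F)) dist)) (all-filter⁺ (λ F → ¬? (x ∈F? F)) sub)) ⟩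
        2 ^ e + 2 ^ e ≡⟨ cong (2 ^ e +_) (+-identityʳ _) ⟨
        2 ^ suc e ∎
        where
        open ≤-Reasoning
        e = ∑ xs (λ v → 𝟙 (v ∈F? C))

  count-covered : ∀ x Cs (Fs : List (Family n)) → AllPairs DistinctFamilies Fs → All (λ C → count C ≤ x) Cs →
                  All (λ F → Any (F ⊑_) Cs) Fs → length Fs ≤ length Cs * 2 ^ x
  count-covered x []       []      _    _          _          = z≤n
  count-covered x []       (F ∷ _) _    _          (() ∷ _)
  count-covered x (C ∷ Cs) Fs      dist (le ∷ les) covered = begin
    length Fs ≡⟨ length-split (_⊑? C) Fs ⟩
    length (filter (_⊑? C) Fs) + length (filter (¬? ∘ (_⊑? C)) Fs)
      ≤⟨ +-mono-≤ inside-C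
           (count-covered x Cs _ (pairs-filter⁺ (¬? ∘ (_⊑? C)) dist) les
             (All.zipWith (λ { (¬F⊑C , here F⊑C) → contradiction F⊑C ¬F⊑C ; (_ , there F⊑) → F⊑ })
               (all-filter (¬? ∘ (_⊑? C)) Fs , all-filter⁺ (¬? ∘ (_⊑? C)) covered))) ⟩
    2 ^ x + length Cs * 2 ^ x ∎
    where
    open ≤-Reasoning
    inside-C : length (filter (_⊑? C) Fs) ≤ 2 ^ x
    inside-C = ≤-trans
      (count-on (subsets n) C _
        (AllPairs.map (λ differ same → differ (λ v → same v (∈-subsets v))) (pairs-filter⁺ (_⊑? C) dist))
        (all-filter (_⊑? C) Fs))
      (^-monoʳ-≤ 2 (≤-trans (∑-mono (subsets n) (λ v → ≤-reflexive (sym (*-identityʳ _)))) le))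

module _ {n : ℕ} where

  products : List (Family n) → List (Family n) → List (Family n)
  products = cartesianProductWith _∪F_

  length-products : ∀ Xs Ys → length (products Xs Ys) ≡ length Xs * length Ys
  length-products []       Ys = refl
  length-products (X ∷ Xs) Ys = trans (length-++ (map (X ∪F_) Ys)) (cong₂ _+_ (length-map _ Ys) (length-products Xs Ys))

  products-cover : ∀ {A B} {Xs Ys : List (Family n)} → Any (A ⊑_) Xs → Any (B ⊑_) Ys → Any ((A ∪F B) ⊑_) (products Xs Ys)
  products-cover = any-product _∪F_ (λ A⊑X B⊑Y v v∈ → [ (λ v∈A → ∨-trueˡ (A⊑X v v∈A)) , (λ v∈B → ∨-trueʳ (B⊑Y v v∈B)) ]′ (∨-true⁻ v∈))

  products-mass : ∀ {a b Xs Ys} → All (λ X → mass X ≤ a) Xs → All (λ Y → mass Y ≤ b) Ys → All (λ Z → mass Z ≤ a + b) (products Xs Ys)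
  products-mass {Ys = Ys} [] ys = []
  products-mass {Xs = X ∷ Xs} {Ys} (x ∷ xs) ys =
    all-++ (all-map (All.map (λ {Y} y → ≤-trans (∑ᶠ-∪ X Y w) (+-mono-≤ x y)) ys)) (products-mass xs ys)

  unions : List (Family n) → ℕ → List (Family n)
  unions Xs zero    = (λ _ → false) ∷ []
  unions Xs (suc p) = products Xs (unions Xs p)

  length-unions : ∀ Xs p → length (unions Xs p) ≡ length Xs ^ p
  length-unions Xs zero    = refl
  length-unions Xs (suc p) = trans (length-products Xs (unions Xs p)) (cong (length Xs *_) (length-unions Xs p))

  unions-mass : ∀ {a Xs} p → All (λ X → mass X ≤ a) Xs → All (λ Z → mass Z ≤ p * a) (unions Xs p)
  unions-mass zero    xs = ≤-reflexive (∑-zero (subsets n)) ∷ []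
  unions-mass (suc p) xs = products-mass xs (unions-mass p xs)

  ⋃F : (ℕ → Family n) → ℕ → Family n
  ⋃F A zero    = λ _ → false
  ⋃F A (suc p) = A p ∪F ⋃F A p

  ∈-⋃F : ∀ {A p r v} → r < p → v ∈F A r → v ∈F ⋃F A p
  ∈-⋃F {A} {suc p} {r} {v} r≤p v∈ = [ (λ r<p → ∨-trueʳ {A p v} (∈-⋃F r<p v∈)) , (λ { refl → ∨-trueˡ v∈ }) ]′ (m≤n⇒m<n∨m≡n (s≤s⁻¹ r≤p))

  ⋃F-mass : ∀ {A a} p → (∀ r → mass (A r) ≤ a) → mass (⋃F A p) ≤ p * a
  ⋃F-mass zero    le = ≤-reflexive (∑-zero (subsets n))
  ⋃F-mass {A} (suc p) le = ≤-trans (∑ᶠ-∪ (A p) (⋃F A p) w) (+-mono-≤ (le p) (⋃F-mass p le))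

  unions-cover : ∀ {Xs} A p → (∀ r → Any (A r ⊑_) Xs) → Any (⋃F A p ⊑_) (unions Xs p)
  unions-cover A zero    cov = here (λ v ())
  unions-cover A (suc p) cov = products-cover (cov p) (unions-cover A p cov)

-- Central binomial coefficient

-- The common weight of the `i`-subsets of an `n`-set, that is `n !` divided by (n choose i).
W : ℕ → ℕ → ℕ
W n i = i ! * (n ∸ i) !

W-suc : ∀ {n i} → i < n → W n (suc i) * (n ∸ i) ≡ W n i * suc i
W-suc {n} {i} i<n = trans (cong (λ d → suc i ! * (n ∸ suc i) ! * d) n∸i≡)
  (trans (rearrange (suc i) (i !) ((n ∸ suc i) !) (suc (n ∸ suc i))) (cong (λ d → i ! * d ! * suc i) (sym n∸i≡)))
  where
  n∸i≡ : n ∸ i ≡ suc (n ∸ suc i)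
  n∸i≡ = +-cancelˡ-≡ i _ _ (trans (m+[n∸m]≡n (<⇒≤ i<n)) (sym (trans (+-suc i _) (m+[n∸m]≡n i<n))))
  rearrange : ∀ s a b d → s * a * b * d ≡ a * (d * b) * s
  rearrange = solve-∀

W-sym : ∀ {n i} → i ≤ n → W n (n ∸ i) ≡ W n i
W-sym {n} {i} i≤n = trans (cong (λ j → (n ∸ i) ! * j !) (m∸[m∸n]≡n i≤n)) (*-comm ((n ∸ i) !) (i !))

module _ (n : ℕ) where

  private
    h = n / 2

  2h≤n : h + h ≤ n
  2h≤n = ≤-trans (≤-reflexive (trans (cong (h +_) (sym (+-identityʳ h))) (*-comm 2 h))) (m/n*n≤m n 2)

  n≤2h+1 : n ≤ suc (h + h)
  n≤2h+1 = begin
    n ≡⟨ m≡m%n+[m/n]*n n 2 ⟩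
    n % 2 + h * 2 ≤⟨ +-monoˡ-≤ (h * 2) (s≤s⁻¹ (m%n<n n 2)) ⟩
    suc (h * 2) ≡⟨ cong suc (trans (*-comm h 2) (cong (h +_) (+-identityʳ h))) ⟩
    suc (h + h) ∎
    where open ≤-Reasoning

  W-step : ∀ {j} → suc j ≤ h → W n (suc j) ≤ W n j
  W-step {j} j<h = *-cancelʳ-≤ _ _ (n ∸ j) {{>-nonZero (m<n⇒0<n∸m j<n)}} (≤-trans (≤-reflexive (W-suc j<n))
    (*-monoʳ-≤ (W n j) (m+n≤o⇒m≤o∸n (suc j) (≤-trans (+-mono-≤ j<h (<⇒≤ j<h)) 2h≤n))))
    where
    j<n : j < n
    j<n = ≤-trans j<h (≤-trans (m≤m+n h h) 2h≤n)

  W-anti : ∀ a {i} → i + a ≤ h → W n (i + a) ≤ W n i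
  W-anti zero    {i} le = ≤-reflexive (cong (W n) (+-identityʳ i))
  W-anti (suc a) {i} le = ≤-trans (≤-reflexive (cong (W n) (+-suc i a)))
    (≤-trans (W-step (≤-trans (≤-reflexive (sym (+-suc i a))) le)) (W-anti a (≤-trans (+-monoʳ-≤ i (n≤1+n a)) le)))

  W-left : ∀ {i} → i ≤ h → W n h ≤ W n i
  W-left {i} i≤h = subst (λ j → W n j ≤ W n i) (m+[n∸m]≡n i≤h) (W-anti (h ∸ i) (≤-reflexive (m+[n∸m]≡n i≤h)))

  W-central : ∀ {i} → i ≤ n → W n h ≤ W n i
  W-central {i} i≤n with i ≤? h
  ... | yes i≤h = W-left i≤h
  ... | no  i≰h = ≤-trans (W-left (m≤n+o⇒m∸n≤o n i (≤-trans n≤2h+1 (+-monoˡ-≤ h (≰⇒> i≰h))))) (≤-reflexive (W-sym i≤n))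

  module _ (x y : ℕ) (h≤ : h ≤ x * (x * y)) where

    private
      d = x * y

    -- The quotient of neighbouring weights is (j + 1) / (n - j). At distance `d` below the middle,
    -- where `d` is at least `h / x`, it has dropped to x / (x + 1).
    W-ratio : ∀ {j} → suc j + d ≤ h → W n (suc j) * suc x ≤ W n j * x
    W-ratio {j} le = *-cancelʳ-≤ _ _ (n ∸ j) {{>-nonZero (m<n⇒0<n∸m j<n)}} (begin
      W n (suc j) * suc x * (n ∸ j) ≡⟨ swap (W n (suc j)) (suc x) (n ∸ j) ⟩
      W n (suc j) * (n ∸ j) * suc x ≡⟨ cong (_* suc x) (W-suc j<n) ⟩
      W n j * suc j * suc x ≡⟨ *-assoc (W n j) (suc j) (suc x) ⟩
      W n j * (suc j * suc x) ≤⟨ *-monoʳ-≤ (W n j) core ⟩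
      W n j * (x * (n ∸ j)) ≡⟨ *-assoc (W n j) x (n ∸ j) ⟨
      W n j * x * (n ∸ j) ∎)
      where
      open ≤-Reasoning
      swap : ∀ a b c → a * b * c ≡ a * c * b
      swap = solve-∀
      j<h : suc j ≤ h
      j<h = ≤-trans (m≤m+n (suc j) d) le
      j<n : j < n
      j<n = ≤-trans j<h (≤-trans (m≤m+n h h) 2h≤n)
      core : suc j * suc x ≤ x * (n ∸ j)
      core = begin
        suc j * suc x ≡⟨ *-suc (suc j) x ⟩
        suc j + suc j * x ≤⟨ +-monoˡ-≤ (suc j * x) (≤-trans j<h h≤) ⟩
        x * d + suc j * x ≡⟨ cong (x * d +_) (*-comm (suc j) x) ⟩
        x * d + x * suc j ≡⟨ *-distribˡ-+ x d (suc j) ⟨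
        x * (d + suc j) ≤⟨ *-monoʳ-≤ x (≤-trans (≤-reflexive (+-comm d (suc j))) le) ⟩
        x * h ≤⟨ *-monoʳ-≤ x (m+n≤o⇒m≤o∸n h (≤-trans (+-monoʳ-≤ h (<⇒≤ j<h)) 2h≤n)) ⟩
        x * (n ∸ j) ∎

    W-ratio^ : ∀ a {i} → i + a + d ≤ h → W n (i + a) * suc x ^ a ≤ W n i * x ^ a
    W-ratio^ zero    {i} le = ≤-reflexive (cong (λ j → W n j * 1) (+-identityʳ i))
    W-ratio^ (suc a) {i} le = begin
      W n (i + suc a) * (suc x * suc x ^ a) ≡⟨ cong (λ j → W n j * (suc x * suc x ^ a)) (+-suc i a) ⟩
      W n (suc (i + a)) * (suc x * suc x ^ a) ≡⟨ *-assoc (W n (suc (i + a))) (suc x) _ ⟨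
      W n (suc (i + a)) * suc x * suc x ^ a ≤⟨ *-monoˡ-≤ (suc x ^ a) (W-ratio (subst (λ j → j + d ≤ h) (+-suc i a) le)) ⟩
      W n (i + a) * x * suc x ^ a ≡⟨ swap (W n (i + a)) x (suc x ^ a) ⟩
      x * (W n (i + a) * suc x ^ a) ≤⟨ *-monoʳ-≤ x (W-ratio^ a (≤-trans (+-monoˡ-≤ d (+-monoʳ-≤ i (n≤1+n a))) le)) ⟩
      x * (W n i * x ^ a) ≡⟨ comm3 x (W n i) (x ^ a) ⟩
      W n i * (x * x ^ a) ∎
      where
      open ≤-Reasoning
      swap : ∀ a b c → a * b * c ≡ b * (a * c)
      swap = solve-∀

bernoulli : ∀ x m → x ^ m * (x + m) ≤ x * suc x ^ m
bernoulli x zero    = ≤-reflexive (trans (*-identityˡ _) (trans (+-identityʳ x) (sym (*-identityʳ x))))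
bernoulli x (suc m) = begin
  x * x ^ m * (x + suc m) ≡⟨ expand x (x ^ m) m ⟩
  x ^ m * (x * (x + suc m)) ≤⟨ *-monoʳ-≤ (x ^ m) (≤-trans (m≤m+n _ m) (≤-reflexive (fact x m))) ⟩
  x ^ m * (suc x * (x + m)) ≡⟨ comm3 (x ^ m) (suc x) (x + m) ⟩
  suc x * (x ^ m * (x + m)) ≤⟨ *-monoʳ-≤ (suc x) (bernoulli x m) ⟩
  suc x * (x * suc x ^ m) ≡⟨ comm3 (suc x) x (suc x ^ m) ⟩
  x * (suc x * suc x ^ m) ∎
  where
  open ≤-Reasoning
  expand : ∀ x p m → x * p * (x + (1 + m)) ≡ p * (x * (x + (1 + m)))
  expand = solve-∀
  fact : ∀ x m → x * (x + (1 + m)) + m ≡ (1 + x) * (x + m)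
  fact = solve-∀

2x^x≤ : ∀ {x} → 1 ≤ x → 2 * x ^ x ≤ suc x ^ x
2x^x≤ {x} 1≤x = *-cancelˡ-≤ x {{>-nonZero 1≤x}} (≤-trans (≤-reflexive (rearrange x (x ^ x))) (bernoulli x x))
  where
  rearrange : ∀ x p → x * (2 * p) ≡ p * (x + x)
  rearrange = solve-∀

^-*-distrib : ∀ a b y → (a * b) ^ y ≡ a ^ y * b ^ y
^-*-distrib a b zero    = refl
^-*-distrib a b (suc y) = trans (cong (a * b *_) (^-*-distrib a b y)) (rearrange a b (a ^ y) (b ^ y))
  where
  rearrange : ∀ a b c d → a * b * (c * d) ≡ a * c * (b * d)
  rearrange = solve-∀

2^y*x^≤ : ∀ {x} y → 1 ≤ x → 2 ^ y * x ^ (x * y) ≤ suc x ^ (x * y)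
2^y*x^≤ {x} y 1≤x = begin
  2 ^ y * x ^ (x * y) ≡⟨ cong (2 ^ y *_) (^-*-assoc x x y) ⟨
  2 ^ y * (x ^ x) ^ y ≡⟨ ^-*-distrib 2 (x ^ x) y ⟨
  (2 * x ^ x) ^ y ≤⟨ ^-monoˡ-≤ y (2x^x≤ 1≤x) ⟩
  (suc x ^ x) ^ y ≡⟨ ^-*-assoc (suc x) x y ⟩
  suc x ^ (x * y) ∎
  where open ≤-Reasoning

-- The half of the distance next to the middle only secures the ratio of `W-ratio`; there the weight
-- is at least the central one. Over the outer half, `x * y` steps, every `x` steps double the
-- weight by Bernoulli's inequality.
W-tail : ∀ n x y → 1 ≤ x → n / 2 ≤ x * (x * y) → ∀ {i} → i + (x * y + x * y) ≤ n / 2 → 2 ^ y * W n (n / 2) ≤ W n i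
W-tail n x y 1≤x h≤ {i} le = *-cancelʳ-≤ _ _ (x ^ d) {{m^n≢0 x d {{>-nonZero 1≤x}}}} (begin
  2 ^ y * W n (n / 2) * x ^ d ≡⟨ swap (2 ^ y) (W n (n / 2)) (x ^ d) ⟩
  W n (n / 2) * (2 ^ y * x ^ d) ≤⟨ *-mono-≤ (W-left n {i + d} (≤-trans (m≤m+n _ d) le′)) (2^y*x^≤ y 1≤x) ⟩
  W n (i + d) * suc x ^ d ≤⟨ W-ratio^ n x y h≤ d le′ ⟩
  W n i * x ^ d ∎)
  where
  open ≤-Reasoning
  d = x * y
  le′ : i + d + d ≤ n / 2
  le′ = ≤-trans (≤-reflexive (+-assoc i d d)) le
  swap : ∀ a b c → a * b * c ≡ b * (a * c)
  swap = solve-∀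

module _ (n : ℕ) where

  N : ℕ
  N = Data.Nat.Combinatorics._C_ n (n / 2)

  N*W≡n! : N * W n (n / 2) ≡ n !
  N*W≡n! = trans (cong (_* W n (n / 2)) (nCk≡n!/k![n-k]! h≤n)) (m/n*n≡m (k![n∸k]!∣n! h≤n))
    where
    h≤n : n / 2 ≤ n
    h≤n = m/n≤m n 2
    instance _ = (n / 2) !* (n ∸ n / 2) !≢0

  w-large : ∀ (v : Subset n) → length (Ω n) ≤ N * w v
  w-large v = begin
    length (Ω n) ≡⟨ length-Ω n ⟩
    n ! ≡⟨ N*W≡n! ⟨
    N * W n (n / 2) ≤⟨ *-monoʳ-≤ N (W-central n (∣p∣≤n v)) ⟩
    N * W n ∣ v ∣ ≡⟨ cong (N *_) (w≡ v) ⟨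
    N * w v ∎
    where open ≤-Reasoning

  w-tail : ∀ x y → 1 ≤ x → n / 2 ≤ x * (x * y) → ∀ (v : Subset n) →
           ∣ v ∣ + (x * y + x * y) ≤ n / 2 ⊎ (n ∸ ∣ v ∣) + (x * y + x * y) ≤ n / 2 → 2 ^ y * length (Ω n) ≤ N * w v
  w-tail x y 1≤x h≤ v far = begin
    2 ^ y * length (Ω n) ≡⟨ cong (2 ^ y *_) (trans (length-Ω n) (sym N*W≡n!)) ⟩
    2 ^ y * (N * W n (n / 2)) ≡⟨ comm3 (2 ^ y) N (W n (n / 2)) ⟩
    N * (2 ^ y * W n (n / 2)) ≤⟨ *-monoʳ-≤ N ([ W-tail n x y 1≤x h≤ {∣ v ∣} ,
                                      (λ le → ≤-trans (W-tail n x y 1≤x h≤ {n ∸ ∣ v ∣} le) (≤-reflexive (W-sym (∣p∣≤n v)))) ]′ far) ⟩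
    N * W n ∣ v ∣ ≡⟨ cong (N *_) (w≡ v) ⟨
    N * w v ∎
    where open ≤-Reasoning

  Ω>0 : 0 < length (Ω n)
  Ω>0 = ≤-trans (1≤n! n) (≤-reflexive (sym (length-Ω n)))

  -- No set weighs less than `n ! / N`. This turns a bound on the Lubell function into one on
  -- cardinality in units of the central binomial coefficient.
  count≤mass : ∀ (C : Family n) → length (Ω n) * count C ≤ N * mass C
  count≤mass C = begin
    length (Ω n) * count C ≡⟨ ∑ᶠ-*ˡ C (length (Ω n)) (λ _ → 1) ⟨
    ∑ᶠ C (λ _ → length (Ω n) * 1) ≤⟨ ∑ᶠ-mono C (λ v _ → ≤-trans (≤-reflexive (*-identityʳ _)) (w-large v)) ⟩
    ∑ᶠ C (λ v → N * w v) ≡⟨ ∑ᶠ-*ˡ C N w ⟩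
    N * mass C ∎
    where open ≤-Reasoning

  -- For `D = 0` no two sets are close, so `mass-≤-classes` with one class for each layer leaves
  -- only its first term.
  mass-interval : ∀ lo hi (C : Family n) → (∀ {v} → v ∈F C → lo ≤ ∣ v ∣ × ∣ v ∣ ≤ hi) → mass C ≤ suc (hi ∸ lo) * length (Ω n)
  mass-interval lo hi C range = ≤-trans
    (mass-≤-classes 0 (suc (hi ∸ lo)) (_∸ lo) C (λ v∈ → s≤s (∸-monoˡ-≤ lo (proj₂ (range v∈))))
      (λ v∈ y∈ lt eq → contradiction (∸-cancelʳ-≡ (proj₁ (range v∈)) (proj₁ (range y∈)) eq) (<⇒≢ lt)))
    (≤-trans (+-monoʳ-≤ _ (≤-trans (∑ᶠ-mono C {g = λ _ → 0} (λ y _ → ≤-reflexive (∑𝟙≡0 (Ω n) (λ c → On? c y ×-dec Below? 0 C c y)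
        (λ c (_ , v , _ , _ , lt , le) → <⇒≱ lt (≤-trans le (≤-reflexive (+-identityʳ _)))))))
      (≤-reflexive (trans (∑-cong (subsets n) (λ v → *-zeroʳ (𝟙 (v ∈F? C)))) (∑-zero (subsets n))))))
      (≤-reflexive (+-identityʳ _)))

  everything : Family n
  everything _ = true

  mass-everything : mass everything ≤ suc n * length (Ω n)
  mass-everything = mass-interval 0 n everything (λ {v} _ → z≤n , ∣p∣≤n v)

  count-everything : count everything ≡ 2 ^ n
  count-everything = trans (∑-const (subsets n) 1) (trans (*-identityʳ _) (length-subsets n))

  2^n≤ : 2 ^ n ≤ N * suc n
  2^n≤ = *-cancelˡ-≤ (length (Ω n)) {{>-nonZero Ω>0}} (begin
    length (Ω n) * 2 ^ n ≡⟨ cong (length (Ω n) *_) count-everything ⟨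
    length (Ω n) * count everything ≤⟨ count≤mass everything ⟩
    N * mass everything ≤⟨ *-monoʳ-≤ N mass-everything ⟩
    N * (suc n * length (Ω n)) ≡⟨ rearrange N (suc n) (length (Ω n)) ⟩
    length (Ω n) * (N * suc n) ∎)
    where
    open ≤-Reasoning
    rearrange : ∀ a b c → a * (b * c) ≡ c * (a * b)
    rearrange = solve-∀

  -- Each of these sets weighs at least `2 ^ y` times `n ! / N`, while all subsets together weigh at
  -- most `suc n * n !`.
  tail-count : ∀ x y → 1 ≤ x → n / 2 ≤ x * (x * y) → ∀ (C : Family n) →
    (∀ {v} → v ∈F C → ∣ v ∣ + (x * y + x * y) ≤ n / 2 ⊎ (n ∸ ∣ v ∣) + (x * y + x * y) ≤ n / 2) →
    2 ^ y * count C ≤ N * suc n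
  tail-count x y 1≤x h≤ C far = *-cancelˡ-≤ (length (Ω n)) {{>-nonZero Ω>0}} (begin
    length (Ω n) * (2 ^ y * count C) ≡⟨ rearrange (length (Ω n)) (2 ^ y) (count C) ⟩
    2 ^ y * length (Ω n) * count C ≡⟨ ∑ᶠ-*ˡ C (2 ^ y * length (Ω n)) (λ _ → 1) ⟨
    ∑ᶠ C (λ _ → 2 ^ y * length (Ω n) * 1) ≤⟨ ∑ᶠ-mono C (λ v v∈ → ≤-trans (≤-reflexive (*-identityʳ _)) (w-tail x y 1≤x h≤ v (far v∈))) ⟩
    ∑ᶠ C (λ v → N * w v) ≡⟨ ∑ᶠ-*ˡ C N w ⟩
    N * mass C ≤⟨ *-monoʳ-≤ N (≤-trans (∑ᶠ-⊆ {C = C} {everything} w (λ _ → refl)) mass-everything) ⟩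
    N * (suc n * length (Ω n)) ≡⟨ rearrange′ N (suc n) (length (Ω n)) ⟩
    length (Ω n) * (N * suc n) ∎)
    where
    open ≤-Reasoning
    rearrange : ∀ a b c → a * (b * c) ≡ b * a * c
    rearrange = solve-∀
    rearrange′ : ∀ a b c → a * (b * c) ≡ c * (a * b)
    rearrange′ = solve-∀

-- One round of containers

-- This is (1 + 1 / a)^c ≤ a / (a - c) with denominators cleared, where `r` stands for the
-- difference.
suc^*≤ : ∀ a c r → a ≡ c + r → suc a ^ c * r ≤ a ^ c * a
suc^*≤ a zero    r a≡ = ≤-reflexive (cong (1 *_) (sym a≡))
suc^*≤ a (suc c) r a≡ = begin
  suc a * suc a ^ c * r ≡⟨ swap (suc a) (suc a ^ c) r ⟩
  suc a ^ c * (r + a * r) ≤⟨ *-monoʳ-≤ (suc a ^ c) (+-monoˡ-≤ (a * r) (≤-trans (m≤n+m r (suc c)) (≤-reflexive (sym a≡)))) ⟩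
  suc a ^ c * (a + a * r) ≡⟨ cong (suc a ^ c *_) (*-suc a r) ⟨
  suc a ^ c * (a * suc r) ≡⟨ comm3 (suc a ^ c) a (suc r) ⟩
  a * (suc a ^ c * suc r) ≤⟨ *-monoʳ-≤ a (suc^*≤ a c (suc r) (trans a≡ (sym (+-suc c r)))) ⟩
  a * (a ^ c * a) ≡⟨ *-assoc a (a ^ c) a ⟨
  a * a ^ c * a ∎
  where
  open ≤-Reasoning
  swap : ∀ s p r → s * p * r ≡ p * (s * r)
  swap = solve-∀

-- `leaves-bound` at a = 2^(ℓ + 1). There `2 ^ ℓ` factors 1 + 1 / a multiply to at most 2, so the
-- `2 ^ (ℓ + e)` of them contribute at most 2 to the power `2 ^ e`.
leaves-2^ : ∀ ℓ e s → leaves (2 ^ (ℓ + e)) s ≤ 2 ^ (suc ℓ * s + 2 ^ e)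
leaves-2^ ℓ e s = *-cancelʳ-≤ _ _ (a ^ m) {{m^n≢0 a m {{a≢0}}}} (begin
  leaves m s * a ^ m ≤⟨ leaves-bound a m s (>-nonZero⁻¹ a {{a≢0}}) ⟩
  a ^ s * suc a ^ m ≡⟨ cong (λ i → a ^ s * suc a ^ i) (^-distribˡ-+-* 2 ℓ e) ⟩
  a ^ s * suc a ^ (b * 2 ^ e) ≡⟨ cong (a ^ s *_) (^-*-assoc (suc a) b (2 ^ e)) ⟨
  a ^ s * (suc a ^ b) ^ (2 ^ e) ≤⟨ *-monoʳ-≤ (a ^ s) (^-monoˡ-≤ (2 ^ e) doubling) ⟩
  a ^ s * (2 * a ^ b) ^ (2 ^ e) ≡⟨ cong (a ^ s *_) (^-*-distrib 2 (a ^ b) (2 ^ e)) ⟩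
  a ^ s * (2 ^ 2 ^ e * (a ^ b) ^ (2 ^ e)) ≡⟨ cong (λ p → a ^ s * (2 ^ 2 ^ e * p)) (trans (^-*-assoc a b (2 ^ e)) (cong (a ^_) (sym (^-distribˡ-+-* 2 ℓ e)))) ⟩
  a ^ s * (2 ^ 2 ^ e * a ^ m) ≡⟨ *-assoc (a ^ s) (2 ^ 2 ^ e) (a ^ m) ⟨
  a ^ s * 2 ^ 2 ^ e * a ^ m ≡⟨ cong (λ p → p * 2 ^ 2 ^ e * a ^ m) (^-*-assoc 2 (suc ℓ) s) ⟩
  2 ^ (suc ℓ * s) * 2 ^ 2 ^ e * a ^ m ≡⟨ cong (_* a ^ m) (^-distribˡ-+-* 2 (suc ℓ * s) (2 ^ e)) ⟨
  2 ^ (suc ℓ * s + 2 ^ e) * a ^ m ∎)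
  where
  open ≤-Reasoning
  a b m : ℕ
  a = 2 ^ suc ℓ
  b = 2 ^ ℓ
  m = 2 ^ (ℓ + e)
  instance
    b≢0 : NonZero b
    b≢0 = m^n≢0 2 ℓ
  a≢0 : NonZero a
  a≢0 = m^n≢0 2 (suc ℓ)
  rearrange : ∀ p b → p * (2 * b) ≡ 2 * p * b
  rearrange = solve-∀
  doubling : suc a ^ b ≤ 2 * a ^ b
  doubling = *-cancelʳ-≤ _ _ b (≤-trans (suc^*≤ a b b (cong (b +_) (+-identityʳ b))) (≤-reflexive (rearrange (a ^ b) b)))

*≤⇒≤/ : ∀ {a b} d {{_ : NonZero d}} → a * d ≤ b → a ≤ b / d
*≤⇒≤/ {a} d le = ≤-trans (≤-reflexive (sym (m*n/n≡m a d))) (/-monoˡ-≤ d le)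

module Phases (P : FinPoset) (_<P?_ : ∀ x y → Dec (FinPoset._<P_ P x y))
  (tree : IsTreePoset P) (k : ℕ) (short : ∀ xs → IsChain P xs → length xs ≤ k)
  {n : ℕ} (N : ℕ) (0<n : 0 < n) (0<Ω : 0 < length (Ω n)) (w-large : ∀ (v : Subset n) → length (Ω n) ≤ N * w v)
  (Mid : Family n) (mid : ∀ {v} → v ∈F Mid → n ≤ 3 * (n ∸ ∣ v ∣) × n ≤ 3 * ∣ v ∣) where

  open FinPoset P

  K : ℕ
  K = 3 * (size * suc k)

  3≤K : 3 ≤ K
  3≤K = *-monoʳ-≤ 3 (*-mono-≤ (proj₁ tree) (s≤s z≤n))

  module _ (D : ℕ) (F : Family n) (free : InducedFree P F) (F⊑Mid : F ⊑ Mid) where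

    private
      module E = Embedding P _<P?_ tree k short D F (λ {v} v∈ → mid (F⊑Mid v v∈))

    part : ℕ → Family n
    part = E.Classes.class free

    part⊑F : ∀ r → part r ⊑ F
    part⊑F r v v∈ = proj₁ (E.Classes.class⁻ free v∈)

    parts-cover : F ⊑ ⋃F part (k ∸ 1)
    parts-cover v v∈ = let (r , r<k , v∈r) = E.Classes.classes-cover free v∈ in
      ∈-⋃F {A = part} (m+n≤o⇒m≤o∸n (suc r) (≤-trans (≤-reflexive (+-comm (suc r) 1)) r<k)) v∈r

    part-pairs : ∀ r → n * ∑ᶠ (part r) (#below D (part r)) ≤ 2 * (K * D) * mass (part r)
    part-pairs = E.Classes.class-pairs free

  -- One slab for the whole middle: the close pairs account for at most half of the mass of a part,
  -- so each part has mass at most `2 * n !`. This a priori bound serves to keep the exceptional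
  -- sets of the container rounds few.
  free-mass : ∀ D → (∀ {v y} → v ∈F Mid → y ∈F Mid → ∣ y ∣ ≤ ∣ v ∣ + D) → 4 * (K * D) ≤ n →
              ∀ F → InducedFree P F → F ⊑ Mid → mass F ≤ (k ∸ 1) * (2 * length (Ω n))
  free-mass D wide small F free F⊑Mid = ≤-trans (∑ᶠ-⊆ w (λ {v} → parts-cover D F free F⊑Mid v)) (⋃F-mass {A = part D F free F⊑Mid} (k ∸ 1) part-mass)
    where
    open ≤-Reasoning
    module _ (r : ℕ) where
      Aᵣ : Family n
      Aᵣ = part D F free F⊑Mid r
      Aᵣ⊑Mid : Aᵣ ⊑ Mid
      Aᵣ⊑Mid v v∈ = F⊑Mid v (part⊑F D F free F⊑Mid r v v∈)
      part-mass : mass Aᵣ ≤ 2 * length (Ω n)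
      part-mass = *-cancelˡ-≤ n {{>-nonZero 0<n}} (+-cancelʳ-≤ (n * mass Aᵣ) _ _ (begin
        n * mass Aᵣ + n * mass Aᵣ ≡⟨ cong (n * mass Aᵣ +_) (+-identityʳ _) ⟨
        2 * (n * mass Aᵣ) ≤⟨ *-monoʳ-≤ 2 (*-monoʳ-≤ n (mass-≤-classes D 1 (λ _ → 0) Aᵣ (λ _ → s≤s z≤n)
                                                                       (λ {v} {y} v∈ y∈ _ _ → wide (Aᵣ⊑Mid v v∈) (Aᵣ⊑Mid y y∈)))) ⟩
        2 * (n * (1 * length (Ω n) + ∑ᶠ Aᵣ (#below D Aᵣ))) ≡⟨ expand n (length (Ω n)) (∑ᶠ Aᵣ (#below D Aᵣ)) ⟩
        n * (2 * length (Ω n)) + 2 * (n * ∑ᶠ Aᵣ (#below D Aᵣ)) ≤⟨ +-monoʳ-≤ (n * (2 * length (Ω n))) (*-monoʳ-≤ 2 (part-pairs D F free F⊑Mid r)) ⟩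
        n * (2 * length (Ω n)) + 2 * (2 * (K * D) * mass Aᵣ) ≡⟨ cong (n * (2 * length (Ω n)) +_) (regroup (K * D) (mass Aᵣ)) ⟩
        n * (2 * length (Ω n)) + 4 * (K * D) * mass Aᵣ ≤⟨ +-monoʳ-≤ (n * (2 * length (Ω n))) (*-monoˡ-≤ (mass Aᵣ) small) ⟩
        n * (2 * length (Ω n)) + n * mass Aᵣ ∎))
        where
        expand : ∀ n l s → 2 * (n * (1 * l + s)) ≡ n * (2 * l) + 2 * (n * s)
        expand = solve-∀
        regroup : ∀ a m → 2 * (2 * a * m) ≡ 4 * a * m
        regroup = solve-∀

  -- The threshold `θ` is `Q` times the density `K * D` of the parts, so that by Markov's inequality
  -- few sets exceed it. With `G = g + 2` the two error terms `θ / n` and `1 / G` are each at most 1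
  -- / (g + 2), and solving for the mass leaves the factor (g + 2) / g.
  module Phase (Q g D M s : ℕ) {{_ : NonZero Q}} {{_ : NonZero g}} {{_ : NonZero D}} (sl : ℕ → ℕ)
    (C₀ : Family n) (C₀⊑Mid : C₀ ⊑ Mid)
    (sl<M : ∀ {y} → y ∈F C₀ → sl ∣ y ∣ < M)
    (same : ∀ {v y} → v ∈F C₀ → y ∈F C₀ → ∣ v ∣ < ∣ y ∣ → sl ∣ v ∣ ≡ sl ∣ y ∣ → ∣ y ∣ ≤ ∣ v ∣ + D)
    (θ-small : (g + 2) * (Q * (K * D)) ≤ n)
    (budget : (g + 2) * N * (2 * (Q * (K * D)) * mass C₀) ≤ s * (n * length (Ω n)))
    (few-bad : 4 * k * N ≤ s * Q) where

    θ μ-tight μ-bad : ℕ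
    θ = Q * (K * D)
    μ-tight = (g + 2) * (M * length (Ω n)) / g
    μ-bad = 4 * k * length (Ω n) / Q

    -- A chain through `v` and `y` still contains `v` one step below `y`. By `first-down` this has
    -- probability at most `D / ∣ y ∣`, and `∣ y ∣` is at least `n / 3` in the middle layers.
    few-pairs : ∀ {v y : Subset n} → y ∈F C₀ →
                n * ∑ (Ω n) (λ c → 𝟙 (On? c y ×-dec On? c v ×-dec Close? D v y)) ≤ θ * w y
    few-pairs {v} {y} y∈ = case Close? D v y ×-dec v ⊆? y of λ where
      (no ¬cl) → *∑𝟙≤ (Ω n) (λ c → On? c y ×-dec On? c v ×-dec Close? D v y) n
        (λ c (ony , onv , cl) → ¬cl (cl , On-⊆ c onv ony (<⇒≤ (proj₁ cl))))
      (yes (cl , v⊆y)) → begin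
        n * ∑ (Ω n) (λ c → 𝟙 (On? c y ×-dec On? c v ×-dec Close? D v y))
          ≤⟨ *-monoʳ-≤ n (∑-mono (Ω n) (λ c → 𝟙-mono (On? c y ×-dec On? c v ×-dec Close? D v y) (On? c y ×-dec v ⊆? at c (∣ y ∣ ∸ 1))
               (λ (ony , onv , (lt , _)) → ony , subst (_⊆ at c (∣ y ∣ ∸ 1)) onv (at-mono c (m+n≤o⇒m≤o∸n ∣ v ∣ (≤-trans (≤-reflexive (+-comm ∣ v ∣ 1)) lt)))))) ⟩
        n * first ≤⟨ *-monoˡ-≤ first (proj₂ (mid (C₀⊑Mid y y∈))) ⟩
        3 * ∣ y ∣ * first ≡⟨ *-assoc 3 ∣ y ∣ first ⟩
        3 * (∣ y ∣ * first) ≤⟨ *-monoʳ-≤ 3 (first-down y v v⊆y) ⟩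
        3 * ((∣ y ∣ ∸ ∣ v ∣) * w y) ≤⟨ *-monoʳ-≤ 3 (*-monoˡ-≤ (w y) (m≤n+o⇒m∸n≤o ∣ y ∣ ∣ v ∣ (proj₂ cl))) ⟩
        3 * (D * w y) ≡⟨ *-assoc 3 D (w y) ⟨
        3 * D * w y ≤⟨ *-monoˡ-≤ (w y) (*-monoˡ-≤ D 3≤K) ⟩
        K * D * w y ≤⟨ *-monoˡ-≤ (w y) (m≤n*m (K * D) Q) ⟩
        θ * w y ∎
     where
      open ≤-Reasoning
      first = ∑ (Ω n) (λ c → 𝟙 (On? c y ×-dec v ⊆? at c (∣ y ∣ ∸ 1)))

    open Containers D θ (g + 2) N M sl C₀ 0<n w-large 0<Ω sl<M same few-pairs

    ∅ : Family n
    ∅ _ = false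

    initial : Output C₀ ∅ (leaves (2 ^ n) s)
    initial = run (2 ^ n) s C₀ ∅ id
      (λ {y} _ → *∑𝟙≤ (Ω n) (λ c → On? c y ×-dec Below? D ∅ c y) n (λ { c (_ , _ , () , _) }))
      (≤-trans (∑ᶠ-⊆ {C = C₀ ∖F ∅} {λ _ → true} (λ _ → 1) (λ _ → refl))
        (≤-reflexive (trans (∑-const (subsets n) 1) (trans (*-identityʳ _) (length-subsets n)))))
      (≤-trans (*-monoʳ-≤ ((g + 2) * N) (≤-trans (∑ᶠ-mono C₀ (λ y _ → m∸n≤m (2 * θ * w y) (n * #below D ∅ y))) (≤-reflexive (∑ᶠ-*ˡ C₀ (2 * θ) w)))) budget)

    tight-mass : ∀ C → Tight C → mass C ≤ μ-tight
    tight-mass C t = *≤⇒≤/ g (begin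
      mass C * g ≡⟨ *-comm (mass C) g ⟩
      g * mass C ≤⟨ *-cancelˡ-≤ n {{>-nonZero 0<n}} (+-cancelʳ-≤ (2 * n * mass C) _ _ (begin
        n * (g * mass C) + 2 * n * mass C ≡⟨ regroup n g (mass C) ⟩
        n * ((g + 2) * mass C) ≤⟨ t ⟩
        n * ((g + 2) * (M * length (Ω n))) + ((g + 2) * θ + n) * mass C
          ≤⟨ +-monoʳ-≤ (n * ((g + 2) * (M * length (Ω n)))) (*-monoˡ-≤ (mass C) (≤-trans (+-monoˡ-≤ n θ-small) (≤-reflexive (cong (n +_) (sym (+-identityʳ n)))))) ⟩
        n * ((g + 2) * (M * length (Ω n))) + 2 * n * mass C ∎)) ⟩
      (g + 2) * (M * length (Ω n)) ∎)
      where
      open ≤-Reasoning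
      regroup : ∀ n g m → n * (g * m) + 2 * n * m ≡ n * ((g + 2) * m)
      regroup = solve-∀

    light? : ∀ (B : Family n) → Dec (mass B ≤ μ-bad)
    light? B = mass B ≤? μ-bad

    bads : List (Family n)
    bads = filter light? (smalls (subsets n) s)

    length-bads : length bads ≤ leaves (2 ^ n) s
    length-bads = ≤-trans (length-filter light? (smalls (subsets n) s))
      (≤-reflexive (trans (length-smalls (subsets n) s) (cong (λ m → leaves m s) (length-subsets n))))

    -- Exceptional families are simply enumerated: as every set weighs at least `n ! / N`, a light
    -- family has at most `s` members.
    bads-cover : ∀ B → mass B * Q ≤ 4 * k * length (Ω n) → Any (B ⊑_) bads
    bads-cover B le = Any.map (λ (cov , _) v → cov v (∈-subsets v)) (any-filter light?
      (smalls-cover (subsets n) s B small) (λ (_ , sub) → ≤-trans (∑ᶠ-⊆ w (λ {v} → sub v)) B-light))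
      where
      open ≤-Reasoning
      B-light : mass B ≤ μ-bad
      B-light = *≤⇒≤/ Q le
      rearrange : ∀ l c q → l * (c * q) ≡ l * c * q
      rearrange = solve-∀
      rearrange′ : ∀ a b c → a * (b * c) ≡ c * (b * a)
      rearrange′ = solve-∀
      count-mass : length (Ω n) * ∑ (subsets n) (λ v → 𝟙 (v ∈F? B)) ≤ N * mass B
      count-mass = begin
        length (Ω n) * ∑ (subsets n) (λ v → 𝟙 (v ∈F? B)) ≡⟨ ∑-*ˡ (subsets n) (length (Ω n)) (λ v → 𝟙 (v ∈F? B)) ⟨
        ∑ (subsets n) (λ v → length (Ω n) * 𝟙 (v ∈F? B)) ≡⟨ ∑-cong (subsets n) (λ v → *-comm (length (Ω n)) _) ⟩
        ∑ᶠ B (λ _ → length (Ω n)) ≤⟨ ∑ᶠ-mono B (λ v _ → w-large v) ⟩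
        ∑ᶠ B (λ v → N * w v) ≡⟨ ∑ᶠ-*ˡ B N w ⟩
        N * mass B ∎
      small : ∑ (subsets n) (λ v → 𝟙 (v ∈F? B)) ≤ s
      small = *-cancelʳ-≤ _ _ Q (*-cancelˡ-≤ (length (Ω n)) {{>-nonZero 0<Ω}} (begin
        length (Ω n) * (∑ (subsets n) (λ v → 𝟙 (v ∈F? B)) * Q) ≡⟨ rearrange (length (Ω n)) _ Q ⟩
        length (Ω n) * ∑ (subsets n) (λ v → 𝟙 (v ∈F? B)) * Q ≤⟨ *-monoˡ-≤ Q count-mass ⟩
        N * mass B * Q ≡⟨ *-assoc N (mass B) Q ⟩
        N * (mass B * Q) ≤⟨ *-monoʳ-≤ N le ⟩
        N * (4 * k * length (Ω n)) ≡⟨ rearrange′ N (4 * k) (length (Ω n)) ⟩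
        length (Ω n) * (4 * k * N) ≤⟨ *-monoʳ-≤ (length (Ω n)) few-bad ⟩
        length (Ω n) * (s * Q) ∎))

    pieces : List (Family n)
    pieces = products (proj₁ initial) bads

    containers : List (Family n)
    containers = unions pieces (k ∸ 1)

    length-containers : length containers ≤ (leaves (2 ^ n) s * leaves (2 ^ n) s) ^ (k ∸ 1)
    length-containers = ≤-trans (≤-reflexive (length-unions pieces (k ∸ 1))) (^-monoˡ-≤ (k ∸ 1)
      (≤-trans (≤-reflexive (length-products (proj₁ initial) bads)) (*-mono-≤ (proj₁ (proj₂ initial)) length-bads)))

    containers-mass : All (λ X → mass X ≤ (k ∸ 1) * (μ-tight + μ-bad)) containers
    containers-mass = unions-mass (k ∸ 1) (products-mass
      (All.map (λ {C} (_ , t) → tight-mass C t) (proj₁ (proj₂ (proj₂ initial)))) (all-filter light? (smalls (subsets n) s)))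

    -- Each part splits into its sparse members, which the decision tree covers, and the rest. A set
    -- of the rest lies in more than `θ / n` of its chains above another member of the part, so the
    -- bound on all close pairs of the part limits the mass of the rest.
    containers-cover : ∀ F → InducedFree P F → F ⊑ C₀ → mass F ≤ 2 * k * length (Ω n) → Any (F ⊑_) containers
    containers-cover F free F⊑C₀ F-mass = Any.map (λ {X} A⊑X v v∈ → A⊑X v (parts-cover D F free F⊑Mid v v∈))
      (unions-cover (part D F free F⊑Mid) (k ∸ 1) piece)
      where
      open ≤-Reasoning
      F⊑Mid : F ⊑ Mid
      F⊑Mid v v∈ = C₀⊑Mid v (F⊑C₀ v v∈)
      piece : ∀ r → Any (part D F free F⊑Mid r ⊑_) pieces
      piece r = Any.map (λ {X} sub v v∈ → sub v (either v v∈))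
        (products-cover {A = thin} {bad} (proj₂ (proj₂ (proj₂ initial)) thin thin⊑C₀ (λ v ()) thin-good) (bads-cover bad bad-mass))
        where
        Aᵣ thin bad : Family n
        Aᵣ = part D F free F⊑Mid r
        thin v = Aᵣ v ∧ does (Sparse? Aᵣ v)
        bad v = Aᵣ v ∧ not (does (Sparse? Aᵣ v))
        thin⊑C₀ : thin ⊑ C₀
        thin⊑C₀ v v∈ = F⊑C₀ v (part⊑F D F free F⊑Mid r v (proj₁ (∧-true {Aᵣ v} v∈)))
        thin-good : Good thin
        thin-good {y} y∈ = ≤-trans (*-monoʳ-≤ n (#below-mono D {thin} {Aᵣ} (λ {u} u∈ → proj₁ (∧-true {Aᵣ u} u∈)) y))
          (does⇒ (Sparse? Aᵣ y) (proj₂ (∧-true {Aᵣ y} y∈)))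
        either : Aᵣ ⊑ (thin ∪F bad)
        either v v∈ = case Sparse? Aᵣ v of λ where
          (yes sp) → ∨-trueˡ (∧-true⁺ v∈ (dec-true (Sparse? Aᵣ v) sp))
          (no ¬sp) → ∨-trueʳ {thin v} (∧-true⁺ v∈ (cong not (dec-false (Sparse? Aᵣ v) ¬sp)))
        bad-heavy : ∀ v → v ∈F bad → θ * w v ≤ n * #below D Aᵣ v
        bad-heavy v v∈ = <⇒≤ (≰⇒> (λ sp → not-true⁻ (proj₂ (∧-true {Aᵣ v} v∈)) (dec-true (Sparse? Aᵣ v) sp)))
        regroup : ∀ q m d → m * q * d ≡ q * d * m
        regroup = solve-∀
        regroup′ : ∀ d k l → 2 * d * (2 * k * l) ≡ 4 * k * l * d
        regroup′ = solve-∀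
        bad-mass : mass bad * Q ≤ 4 * k * length (Ω n)
        bad-mass = *-cancelʳ-≤ _ _ (K * D) {{m*n≢0 K D {{>-nonZero (≤-trans (s≤s z≤n) 3≤K)}}}} (begin
          mass bad * Q * (K * D) ≡⟨ regroup Q (mass bad) (K * D) ⟩
          θ * mass bad ≡⟨ ∑ᶠ-*ˡ bad θ w ⟨
          ∑ᶠ bad (λ v → θ * w v) ≤⟨ ∑ᶠ-mono bad bad-heavy ⟩
          ∑ᶠ bad (λ v → n * #below D Aᵣ v) ≤⟨ ∑ᶠ-⊆ {C = bad} {Aᵣ} (λ v → n * #below D Aᵣ v) (λ {u} u∈ → proj₁ (∧-true {Aᵣ u} u∈)) ⟩
          ∑ᶠ Aᵣ (λ v → n * #below D Aᵣ v) ≡⟨ ∑ᶠ-*ˡ Aᵣ n (#below D Aᵣ) ⟩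
          n * ∑ᶠ Aᵣ (#below D Aᵣ) ≤⟨ part-pairs D F free F⊑Mid r ⟩
          2 * (K * D) * mass Aᵣ ≤⟨ *-monoʳ-≤ (2 * (K * D)) (≤-trans (∑ᶠ-⊆ {C = Aᵣ} {F} w (λ {v} → part⊑F D F free F⊑Mid r v)) F-mass) ⟩
          2 * (K * D) * (2 * k * length (Ω n)) ≡⟨ regroup′ (K * D) k (length (Ω n)) ⟩
          4 * k * length (Ω n) * (K * D) ∎)

-- The middle layers and two rounds

same-quotient : ∀ a b d {{_ : NonZero d}} → a / d ≡ b / d → b ≤ a + d
same-quotient a b d eq = begin
  b ≡⟨ m≡m%n+[m/n]*n b d ⟩
  b % d + b / d * d ≤⟨ +-mono-≤ (<⇒≤ (m%n<n b d)) (*-monoˡ-≤ d (≤-reflexive (sym eq))) ⟩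
  d + a / d * d ≤⟨ +-monoʳ-≤ d (m/n*n≤m a d) ⟩
  d + a ≡⟨ +-comm d a ⟩
  a + d ∎
  where open ≤-Reasoning

gather : ∀ {n} {L b} {Good : Family n → Set} {Nice : Family n → Set} (Xs : List (Family n)) → All (λ X → mass X ≤ b) Xs →
         (∀ X → mass X ≤ b → ∃ λ Cs → length Cs ≤ L × All Good Cs × (∀ F → Nice F → F ⊑ X → Any (F ⊑_) Cs)) →
         ∃ λ Cs → length Cs ≤ length Xs * L × All Good Cs × (∀ F → Nice F → Any (F ⊑_) Xs → Any (F ⊑_) Cs)
gather []       []       refine = [] , z≤n , [] , λ F nice ()
gather (X ∷ Xs) (x ∷ xs) refine with refine X x | gather Xs xs refine
... | Cs , len , good , cov | Cs′ , len′ , good′ , cov′ =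
  Cs ++ Cs′ , ≤-trans (≤-reflexive (length-++ Cs)) (+-mono-≤ len len′) , all-++ good good′ ,
  λ { F nice (here F⊑X) → any-++ˡ (cov F nice F⊑X) ; F nice (there any) → any-++ʳ Cs (cov′ F nice any) }

-- Q is about n^(1/11).  The middle layers are those at distance at most 2 Q^6
-- from n / 2; the two rounds use gaps Q^3 and 5 Q^6.
module Final (P : FinPoset) (_<P?_ : ∀ x y → Dec (FinPoset._<P_ P x y))
  (tree : IsTreePoset P) (k : ℕ) (short : ∀ xs → IsChain P xs → length xs ≤ k) (1≤k : 1 ≤ k) (m : ℕ)
  (n Q c ν x y E : ℕ) {{Q≢0 : NonZero Q}} where

  open FinPoset P

  K g p h Wd lo : ℕ
  K = 3 * (size * suc k)
  -- The containers exceed `p * N n` by a factor 1 + 3 / g, and `p * (3 / g)` is at most one half of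
  -- `1 / suc m`.
  g = 6 * suc m * k
  p = k ∸ 1
  h = n / 2
  Wd = Q ^ 6
  -- Twice `Wd`, because `W-tail` with `x * y = Wd` speaks of sets at distance `2 * x * y` from the
  -- middle.
  lo = h ∸ (Wd + Wd)

  ω : ℕ
  ω = length (Ω n)

  mid? : ∀ (v : Subset n) → Dec (lo ≤ ∣ v ∣ × ∣ v ∣ + lo ≤ n)
  mid? v = lo ≤? ∣ v ∣ ×-dec ∣ v ∣ + lo ≤? n

  Mid Outer : Family n
  Mid v = does (mid? v)
  Outer v = not (Mid v)

  module _
    (15≤Q : 15 ≤ Q) (c≤Q : c ≤ Q) (Q^11≤n : Q ^ 11 ≤ n)
    (c₁ : (g + 2) * (K * 5) ≤ c) (c₂ : 20 * K ≤ c) (c₃ : 4 * k * g ≤ c)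
    (c₄ : (g + 2) * (2 * K * 6) ≤ c) (c₅ : (g + 2) * (2 * (K * 5) * (22 * (k * k))) ≤ c) (c₆ : 4 * k ≤ c)
    (N≤νQ : N n ≤ ν * Q)
    (xy≡ : x * y ≡ Wd) (1≤x : 1 ≤ x) (h≤ : h ≤ x * (x * y)) (n-small : suc n * Q ≤ 2 ^ y)
    (leaves≤ : leaves (2 ^ n) (c * ν) ≤ 2 ^ E)
    (total : 2 * suc m * ((E + E) * p + (E + E) * p + ν) ≤ N n)
    where

    private
      instance
        g≢0 : NonZero g
        g≢0 = m*n≢0 (6 * suc m) k {{_}} {{>-nonZero 1≤k}}
        Wd≢0 : NonZero Wd
        Wd≢0 = m^n≢0 Q 6
        Q³≢0 : NonZero (Q ^ 3)
        Q³≢0 = m^n≢0 Q 3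
        5Wd≢0 : NonZero (5 * Wd)
        5Wd≢0 = m*n≢0 5 Wd

      open ≤-Reasoning

      1≤Wd : 1 ≤ Wd
      1≤Wd = >-nonZero⁻¹ Wd

      Q^≤n : ∀ i j → i + j ≡ 11 → ∀ {a} → a ≤ Q → 1 ≤ j → a * Q ^ i ≤ n
      Q^≤n i (suc j) eq {a} a≤Q _ = begin
        a * Q ^ i ≤⟨ *-monoˡ-≤ (Q ^ i) a≤Q ⟩
        Q ^ suc i ≤⟨ ^-monoʳ-≤ Q (≤-trans (m≤m+n (suc i) j) (≤-reflexive (trans (sym (+-suc i j)) eq))) ⟩
        Q ^ 11 ≤⟨ Q^11≤n ⟩
        n ∎

      0<n : 0 < n
      0<n = ≤-trans (>-nonZero⁻¹ (Q ^ 11) {{m^n≢0 Q 11}}) Q^11≤n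

      6Wd<h : 6 * Wd < h
      6Wd<h = ≰⇒> λ h≤6Wd → <-irrefl refl (begin-strict
        n ≤⟨ n≤2h+1 n ⟩
        suc (h + h) ≤⟨ s≤s (+-mono-≤ h≤6Wd h≤6Wd) ⟩
        suc (6 * Wd + 6 * Wd) <⟨ +-mono-≤ {2} {2 * Wd} (*-monoʳ-≤ 2 1≤Wd) (≤-refl {6 * Wd + 6 * Wd}) ⟩
        2 * Wd + (6 * Wd + 6 * Wd) ≡⟨ collect Wd ⟩
        14 * Wd ≤⟨ Q^≤n 6 5 refl (≤-trans (n≤1+n 14) 15≤Q) (s≤s z≤n) ⟩
        n ∎)
        where
        collect : ∀ w → 2 * w + (6 * w + 6 * w) ≡ 14 * w
        collect = solve-∀

      lo+2Wd : lo + (Wd + Wd) ≡ h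
      lo+2Wd = m∸n+n≡m (≤-trans (≤-trans (m≤m+n (Wd + Wd) (4 * Wd)) (≤-reflexive (collect Wd))) (<⇒≤ 6Wd<h))
        where
        collect : ∀ w → w + w + 4 * w ≡ 6 * w
        collect = solve-∀

      4Wd<lo : 4 * Wd < lo
      4Wd<lo = +-cancelʳ-< (Wd + Wd) _ _ (≤-trans (≤-reflexive (cong suc (collect Wd))) (≤-trans 6Wd<h (≤-reflexive (sym lo+2Wd))))
        where
        collect : ∀ w → 4 * w + (w + w) ≡ 6 * w
        collect = solve-∀

      n≤2lo : n ≤ lo + lo + suc (4 * Wd)
      n≤2lo = ≤-trans (n≤2h+1 n) (≤-reflexive (trans (cong (λ h → suc (h + h)) (sym lo+2Wd)) (collect lo Wd)))
        where
        collect : ∀ l w → suc (l + (w + w) + (l + (w + w))) ≡ l + l + suc (4 * w)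
        collect = solve-∀

      n≤3lo : n ≤ 3 * lo
      n≤3lo = ≤-trans n≤2lo (≤-trans (+-monoʳ-≤ (lo + lo) 4Wd<lo) (≤-reflexive (collect lo)))
        where
        collect : ∀ l → l + l + l ≡ 3 * l
        collect = solve-∀

      mid⁻ : ∀ {v} → v ∈F Mid → lo ≤ ∣ v ∣ × ∣ v ∣ + lo ≤ n
      mid⁻ {v} = does⇒ (mid? v)

      mid-sizes : ∀ {v} → v ∈F Mid → n ≤ 3 * (n ∸ ∣ v ∣) × n ≤ 3 * ∣ v ∣
      mid-sizes {v} v∈ =
        ≤-trans n≤3lo (*-monoʳ-≤ 3 (m+n≤o⇒m≤o∸n lo (≤-trans (≤-reflexive (+-comm lo ∣ v ∣)) (proj₂ (mid⁻ {v} v∈))))) ,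
        ≤-trans n≤3lo (*-monoʳ-≤ 3 (proj₁ (mid⁻ {v} v∈)))

      mid-top : ∀ {v} → v ∈F Mid → ∣ v ∣ ≤ lo + suc (4 * Wd)
      mid-top {v} v∈ = +-cancelʳ-≤ lo _ _ (≤-trans (proj₂ (mid⁻ {v} v∈)) (≤-trans n≤2lo (≤-reflexive (collect lo (suc (4 * Wd))))))
        where
        collect : ∀ l s → l + l + s ≡ l + s + l
        collect = solve-∀

      suc4Wd≤ : suc (4 * Wd) ≤ 5 * Wd
      suc4Wd≤ = +-monoˡ-≤ (4 * Wd) 1≤Wd

      mid-wide : ∀ {v y} → v ∈F Mid → y ∈F Mid → ∣ y ∣ ≤ ∣ v ∣ + 5 * Wd
      mid-wide {v} {y} v∈ y∈ = ≤-trans (mid-top {y} y∈) (+-mono-≤ (proj₁ (mid⁻ {v} v∈)) suc4Wd≤)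

      mass-Mid : mass Mid ≤ 6 * Wd * ω
      mass-Mid = ≤-trans (mass-interval n lo (lo + suc (4 * Wd)) Mid (λ {v} v∈ → proj₁ (mid⁻ {v} v∈) , mid-top {v} v∈))
        (*-monoˡ-≤ ω (≤-trans (≤-reflexive (cong suc (m+n∸m≡n lo (suc (4 * Wd))))) (≤-trans (+-mono-≤ 1≤Wd suc4Wd≤) (≤-reflexive refl))))

      module Ph = Phases P _<P?_ tree k short (N n) 0<n (Ω>0 n) (w-large n) Mid (λ {v} → mid-sizes {v})

      s : ℕ
      s = c * ν

      -- This fixes the exponent 11. In both rounds the factor `Q` of the threshold, the gap and the
      -- mass of the current container multiply to `Q ^ 10` up to constants, as 1 + 3 + 6 and as 1 +
      -- 6 + 3. A fingerprint of about `N n / Q` sets can pay for that once `n` is at least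
      -- `Q ^ 11`.
      within : ∀ {a X} → a ≤ c → X ≤ a * (N n * Q ^ 10 * ω) → X ≤ s * (n * ω)
      within {a} {X} a≤c X≤ = begin
        X ≤⟨ X≤ ⟩
        a * (N n * Q ^ 10 * ω) ≤⟨ *-mono-≤ a≤c (*-monoˡ-≤ ω (*-monoˡ-≤ (Q ^ 10) N≤νQ)) ⟩
        c * (ν * Q * Q ^ 10 * ω) ≡⟨ regroup c ν Q (Q ^ 10) ω ⟩
        c * ν * (Q * Q ^ 10 * ω) ≤⟨ *-monoʳ-≤ s (*-monoˡ-≤ ω Q^11≤n) ⟩
        s * (n * ω) ∎
        where
        regroup : ∀ c v q r l → c * (v * q * r * l) ≡ c * v * (q * r * l)
        regroup = solve-∀

      few-bad : 4 * k * N n ≤ s * Q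
      few-bad = begin
        4 * k * N n ≤⟨ *-mono-≤ c₆ N≤νQ ⟩
        c * (ν * Q) ≡⟨ *-assoc c ν Q ⟨
        s * Q ∎

      b₁ : ℕ
      -- 22 is 3 * 6 + 4: a tight part has at most three times its `6 * Q ^ 3` slabs, and the
      -- exceptional sets add at most `4 * k`.
      b₁ = 22 * (k * k) * Q ^ 3 * ω

      5Wd≡ : ∀ q → 5 * (q * (q * (q * (q * (q * (q * 1)))))) ≡ 5 * (q * (q * (q * 1))) * (q * (q * (q * 1)))
      5Wd≡ = solve-∀
      θ₁≡ : ∀ g k q r → (g + 2) * (q * (k * r)) ≡ (g + 2) * k * (q * r)
      θ₁≡ = solve-∀
      budget₁≡ : ∀ g n q k l → (g + 2) * n * (2 * (q * (k * (q * (q * (q * 1))))) * (6 * (q * (q * (q * (q * (q * (q * 1)))))) * l)) ≡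
                (g + 2) * (2 * k * 6) * (n * (q * (q * (q * (q * (q * (q * (q * (q * (q * (q * 1)))))))))) * l)
      budget₁≡ = solve-∀

      -- Sizes in the middle exceed `lo` by at most `5 * Q ^ 6`, so the quotients by `Q ^ 3` reach
      -- at most `5 * Q ^ 3` and `6 * Q ^ 3` slabs suffice.
      module Ph₁ = Ph.Phase Q g (Q ^ 3) (6 * Q ^ 3) s (λ i → (i ∸ lo) / Q ^ 3) Mid (λ v → id)
        (λ {y} y∈ → ≤-<-trans (≤-trans (/-monoˡ-≤ (Q ^ 3) (m≤n+o⇒m∸n≤o ∣ y ∣ lo (≤-trans (mid-top {y} y∈) (+-monoʳ-≤ lo suc4Wd≤))))
                                (≤-reflexive (trans (cong (_/ Q ^ 3) (5Wd≡ Q)) (m*n/n≡m (5 * Q ^ 3) (Q ^ 3)))))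
                     (*-monoˡ-< (Q ^ 3) (n<1+n 5)))
        (λ {v} {y} v∈ y∈ _ eq → ≤-trans (m≤n+m∸n ∣ y ∣ lo) (≤-trans (+-monoʳ-≤ lo (same-quotient (∣ v ∣ ∸ lo) (∣ y ∣ ∸ lo) (Q ^ 3) eq))
             (≤-reflexive (trans (sym (+-assoc lo (∣ v ∣ ∸ lo) (Q ^ 3))) (cong (_+ Q ^ 3) (m+[n∸m]≡n (proj₁ (mid⁻ {v} v∈))))))))
        (≤-trans (≤-reflexive (θ₁≡ g K Q (Q ^ 3)))
          (Q^≤n 4 7 refl (≤-trans (≤-trans (*-monoʳ-≤ (g + 2) (m≤m*n K 5)) c₁) c≤Q) (s≤s z≤n)))
        (within c₄ (≤-trans (*-monoʳ-≤ ((g + 2) * N n) (*-monoʳ-≤ (2 * (Q * (K * Q ^ 3))) mass-Mid)) (≤-reflexive (budget₁≡ g (N n) Q K ω))))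
        few-bad

      1≤g : 1 ≤ g
      1≤g = >-nonZero⁻¹ g

      containers₁-mass : p * (Ph₁.μ-tight + Ph₁.μ-bad) ≤ b₁
      containers₁-mass = begin
        p * (Ph₁.μ-tight + Ph₁.μ-bad) ≤⟨ *-mono-≤ (m∸n≤m k 1) (+-mono-≤ tight≤ (m/n≤m (4 * k * ω) Q)) ⟩
        k * (3 * (6 * Q ^ 3 * ω) + 4 * k * ω) ≤⟨ *-monoʳ-≤ k (+-mono-≤ (m≤n*m (3 * (6 * Q ^ 3 * ω)) k {{>-nonZero 1≤k}}) (m≤n*m (4 * k * ω) (Q ^ 3))) ⟩
        k * (k * (3 * (6 * Q ^ 3 * ω)) + Q ^ 3 * (4 * k * ω)) ≡⟨ collect k (Q ^ 3) ω ⟩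
        b₁ ∎
        where
        tight≤ : Ph₁.μ-tight ≤ 3 * (6 * Q ^ 3 * ω)
        tight≤ = ≤-trans (/-monoˡ-≤ g (≤-trans (*-monoˡ-≤ (6 * Q ^ 3 * ω) (+-monoʳ-≤ g (*-monoʳ-≤ 2 1≤g))) (≤-reflexive (triple g (6 * Q ^ 3 * ω)))))
          (≤-reflexive (m*n/n≡m (3 * (6 * Q ^ 3 * ω)) g))
          where
          triple : ∀ g z → (g + 2 * g) * z ≡ 3 * z * g
          triple = solve-∀
        collect : ∀ k q l → k * (k * (3 * (6 * q * l)) + q * (4 * k * l)) ≡ 22 * (k * k) * q * l
        collect = solve-∀

      Nice : Family n → Set
      Nice F = InducedFree P F × F ⊑ Mid × mass F ≤ 2 * k * ω

      L x₂ : ℕ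
      L = (leaves (2 ^ n) s * leaves (2 ^ n) s) ^ p
      -- The 3 is 2 from the factor (g + 2) / g of the tight containers and 1 from the exceptional
      -- sets, whose mass is at most `ω / g` by `c₃`.
      x₂ = p * N n + 3 * p * N n / g

      refine : ∀ X → mass X ≤ b₁ →
        ∃ λ Cs → length Cs ≤ L × All (λ C → count C ≤ x₂) Cs × (∀ F → Nice F → F ⊑ X → Any (F ⊑_) Cs)
      refine X X≤ = Ph₂.containers , Ph₂.length-containers , All.map (λ {C} → count≤ {C}) Ph₂.containers-mass ,
        λ F (free , F⊑Mid , F≤) F⊑X → Ph₂.containers-cover F free (λ v v∈ → ∧-true⁺ (F⊑X v v∈) (F⊑Mid v v∈)) F≤
        where
        C₀ : Family n
        C₀ = X ∩F Mid
        C₀⊑Mid : C₀ ⊑ Mid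
        C₀⊑Mid v v∈ = proj₂ (∧-true {X v} v∈)
        C₀≤ : mass C₀ ≤ b₁
        C₀≤ = ≤-trans (∑ᶠ-⊆ w (λ {v} v∈ → proj₁ (∧-true {X v} v∈))) X≤
        θ≡ : ∀ g k q r → (g + 2) * (q * (k * (5 * r))) ≡ (g + 2) * (k * 5) * (q * r)
        θ≡ = solve-∀
        budget≡ : ∀ g n q k l kk → (g + 2) * n * (2 * (q * (k * (5 * (q * (q * (q * (q * (q * (q * 1))))))))) * (22 * kk * (q * (q * (q * 1))) * l)) ≡
                  (g + 2) * (2 * (k * 5) * (22 * kk)) * (n * (q * (q * (q * (q * (q * (q * (q * (q * (q * (q * 1)))))))))) * l)
        budget≡ = solve-∀
        -- The gap now spans the whole middle, so a single slab remains, and with it the leading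
        -- term `n !` for each part.
        module Ph₂ = Ph.Phase Q g (5 * Wd) 1 s (λ _ → 0) C₀ C₀⊑Mid (λ _ → s≤s z≤n)
          (λ {v} {y} v∈ y∈ _ _ → mid-wide {v} {y} (C₀⊑Mid v v∈) (C₀⊑Mid y y∈))
          (≤-trans (≤-reflexive (θ≡ g K Q Wd)) (Q^≤n 7 4 refl (≤-trans c₁ c≤Q) (s≤s z≤n)))
          (within c₅ (≤-trans (*-monoʳ-≤ ((g + 2) * N n) (*-monoʳ-≤ (2 * (Q * (K * (5 * Wd)))) C₀≤)) (≤-reflexive (budget≡ g (N n) Q K ω (k * k)))))
          few-bad
        μ≤ : g * (Ph₂.μ-tight + Ph₂.μ-bad) ≤ (g + 3) * ω
        μ≤ = begin
          g * (Ph₂.μ-tight + Ph₂.μ-bad) ≡⟨ *-distribˡ-+ g _ _ ⟩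
          g * Ph₂.μ-tight + g * Ph₂.μ-bad ≤⟨ +-mono-≤ (≤-trans (≤-reflexive (*-comm g _)) (m/n*n≤m _ g)) bad≤ ⟩
          (g + 2) * (1 * ω) + ω ≡⟨ collect g ω ⟩
          (g + 3) * ω ∎
          where
          collect : ∀ g l → (g + 2) * (1 * l) + l ≡ (g + 3) * l
          collect = solve-∀
          bad≤ : g * Ph₂.μ-bad ≤ ω
          bad≤ = *-cancelˡ-≤ (4 * k) {{m*n≢0 4 k {{_}} {{>-nonZero 1≤k}}}} (begin
            4 * k * (g * Ph₂.μ-bad) ≡⟨ *-assoc (4 * k) g _ ⟨
            4 * k * g * Ph₂.μ-bad ≤⟨ *-monoˡ-≤ Ph₂.μ-bad (≤-trans c₃ c≤Q) ⟩
            Q * Ph₂.μ-bad ≡⟨ *-comm Q _ ⟩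
            Ph₂.μ-bad * Q ≤⟨ m/n*n≤m (4 * k * ω) Q ⟩
            4 * k * ω ∎)
        count≤ : ∀ {C} → mass C ≤ p * (Ph₂.μ-tight + Ph₂.μ-bad) → count C ≤ x₂
        count≤ {C} mass≤ = ≤-trans (m≤n+m∸n (count C) (p * N n)) (+-monoʳ-≤ (p * N n) (*≤⇒≤/ g (begin
          (count C ∸ p * N n) * g ≡⟨ *-distribʳ-∸ g (count C) (p * N n) ⟩
          count C * g ∸ p * N n * g ≤⟨ ∸-monoˡ-≤ (p * N n * g) counted ⟩
          (p * N n * g + 3 * p * N n) ∸ p * N n * g ≡⟨ m+n∸m≡n (p * N n * g) _ ⟩
          3 * p * N n ∎)))
          where
          rearrange₁ : ∀ l c g → l * (c * g) ≡ g * (l * c)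
          rearrange₁ = solve-∀
          rearrange₂ : ∀ g n p μ → g * (n * (p * μ)) ≡ n * p * (g * μ)
          rearrange₂ = solve-∀
          rearrange₃ : ∀ n p g l → n * p * ((g + 3) * l) ≡ l * (p * n * g + 3 * p * n)
          rearrange₃ = solve-∀
          counted : count C * g ≤ p * N n * g + 3 * p * N n
          counted = *-cancelˡ-≤ ω {{>-nonZero (Ω>0 n)}} (begin
            ω * (count C * g) ≡⟨ rearrange₁ ω (count C) g ⟩
            g * (ω * count C) ≤⟨ *-monoʳ-≤ g (count≤mass n C) ⟩
            g * (N n * mass C) ≤⟨ *-monoʳ-≤ g (*-monoʳ-≤ (N n) mass≤) ⟩
            g * (N n * (p * (Ph₂.μ-tight + Ph₂.μ-bad))) ≡⟨ rearrange₂ g (N n) p _ ⟩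
            N n * p * (g * (Ph₂.μ-tight + Ph₂.μ-bad)) ≤⟨ *-monoʳ-≤ (N n * p) μ≤ ⟩
            N n * p * ((g + 3) * ω) ≡⟨ rearrange₃ (N n) p g ω ⟩
            ω * (p * N n * g + 3 * p * N n) ∎)

      Outer-count : count Outer ≤ ν
      Outer-count = *-cancelʳ-≤ _ _ Q (≤-trans (*-cancelˡ-≤ (suc n) (begin
        suc n * (count Outer * Q) ≡⟨ rearrange (suc n) (count Outer) Q ⟩
        suc n * Q * count Outer ≤⟨ *-monoˡ-≤ (count Outer) n-small ⟩
        2 ^ y * count Outer ≤⟨ tail-count n x y 1≤x h≤ Outer (λ {v} → far {v}) ⟩
        N n * suc n ≡⟨ *-comm (N n) (suc n) ⟩
        suc n * N n ∎)) N≤νQ)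
        where
        rearrange : ∀ a b c → a * (b * c) ≡ a * c * b
        rearrange = solve-∀
        near-end : ∀ {i} → i < lo → i + (x * y + x * y) ≤ h
        near-end {i} i<lo = ≤-trans (≤-reflexive (cong (λ d → i + (d + d)) xy≡)) (≤-trans (+-monoˡ-≤ (Wd + Wd) (<⇒≤ i<lo)) (≤-reflexive lo+2Wd))
        far : ∀ {v} → v ∈F Outer → ∣ v ∣ + (x * y + x * y) ≤ h ⊎ (n ∸ ∣ v ∣) + (x * y + x * y) ≤ h
        far {v} v∈ = case lo ≤? ∣ v ∣ of λ where
          (no ≰)   → inj₁ (near-end (≰⇒> ≰))
          (yes lo≤) → case ∣ v ∣ + lo ≤? n of λ where
            (yes ≤n) → contradiction (dec-true (mid? v) (lo≤ , ≤n)) (not-true⁻ v∈)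
            (no ≰n)  → inj₂ (near-end (+-cancelʳ-< ∣ v ∣ _ _ (≤-trans (≤-reflexive (cong suc (m∸n+n≡m (∣p∣≤n v)))) (≤-trans (≰⇒> ≰n) (≤-reflexive (+-comm ∣ v ∣ lo))))))

      middle : Family n → Family n
      middle F = F ∩F Mid

      middle-nice : ∀ F → InducedFree P F → Nice (middle F)
      middle-nice F free = free′ , ⊑Mid , ≤-trans (Ph.free-mass (5 * Wd) (λ {v} {y} → mid-wide {v} {y})
          (≤-trans (≤-reflexive (regroup K Wd)) (Q^≤n 6 5 refl (≤-trans c₂ c≤Q) (s≤s z≤n))) (middle F) free′ ⊑Mid)
        (≤-trans (*-monoˡ-≤ (2 * ω) (m∸n≤m k 1)) (≤-reflexive (regroup′ k ω)))
        where
        regroup : ∀ k w → 4 * (k * (5 * w)) ≡ 20 * k * w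
        regroup = solve-∀
        regroup′ : ∀ k l → k * (2 * l) ≡ 2 * k * l
        regroup′ = solve-∀
        ⊑Mid : middle F ⊑ Mid
        ⊑Mid v v∈ = proj₂ (∧-true {F v} v∈)
        free′ : InducedFree P (middle F)
        free′ (φ , inj , φ∈ , ord) = free (φ , inj , (λ z → proj₁ (∧-true {F (φ z)} (φ∈ z))) , ord)

      gathered : ∃ λ Cs → length Cs ≤ length Ph₁.containers * L × All (λ C → count C ≤ x₂) Cs ×
                          (∀ F → Nice F → Any (F ⊑_) Ph₁.containers → Any (F ⊑_) Cs)
      gathered = gather Ph₁.containers (All.map (λ le → ≤-trans le containers₁-mass) Ph₁.containers-mass) refine

      Cs : List (Family n)
      -- The outer sets number at most `ν`, about `N n / Q`, so every container can afford all of
      -- them.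
      Cs = map (_∪F Outer) (proj₁ gathered)

      bits : ℕ
      bits = (E + E) * p + (E + E) * p

      L≤ : L ≤ 2 ^ ((E + E) * p)
      L≤ = begin
        L ≤⟨ ^-monoˡ-≤ p (*-mono-≤ leaves≤ leaves≤) ⟩
        (2 ^ E * 2 ^ E) ^ p ≡⟨ cong (_^ p) (^-distribˡ-+-* 2 E E) ⟨
        (2 ^ (E + E)) ^ p ≡⟨ ^-*-assoc 2 (E + E) p ⟩
        2 ^ ((E + E) * p) ∎

      length-Cs : length Cs ≤ 2 ^ bits
      length-Cs = begin
        length Cs ≡⟨ length-map (_∪F Outer) (proj₁ gathered) ⟩
        length (proj₁ gathered) ≤⟨ proj₁ (proj₂ gathered) ⟩
        length Ph₁.containers * L ≤⟨ *-mono-≤ (≤-trans Ph₁.length-containers L≤) L≤ ⟩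
        2 ^ ((E + E) * p) * 2 ^ ((E + E) * p) ≡⟨ ^-distribˡ-+-* 2 ((E + E) * p) ((E + E) * p) ⟨
        2 ^ bits ∎

      Cs-count : All (λ C → count C ≤ x₂ + ν) Cs
      Cs-count = all-map (All.map (λ {C} le → ≤-trans (∑ᶠ-∪ C Outer (λ _ → 1)) (+-mono-≤ le Outer-count)) (proj₁ (proj₂ (proj₂ gathered))))

      Cs-cover : ∀ F → InducedFree P F → Any (F ⊑_) Cs
      Cs-cover F free = any-map (Any.map (λ {C} sub v v∈ → either {C} sub v v∈ (v ∈F? Mid))
        (proj₂ (proj₂ (proj₂ gathered)) (middle F) nice
          (Ph₁.containers-cover (middle F) (proj₁ nice) (proj₁ (proj₂ nice)) (proj₂ (proj₂ nice)))))
        where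
        nice : Nice (middle F)
        nice = middle-nice F free
        either : ∀ {C} → middle F ⊑ C → ∀ v → v ∈F F → Dec (v ∈F Mid) → v ∈F (C ∪F Outer)
        either sub v v∈ (yes v∈Mid) = ∨-trueˡ (sub v (∧-true⁺ v∈ v∈Mid))
        either {C} sub v v∈ (no v∉Mid) = ∨-trueʳ {C v} (not-true⁺ v∉Mid)

      -- One half of the permitted excess `N n / suc m` goes to the rounding factor of the
      -- containers, the other half, in `total`, to the number of containers and the outer sets.
      z-small : 2 * suc m * (3 * p * N n / g) ≤ N n
      z-small = *-cancelˡ-≤ (3 * k) {{m*n≢0 3 k {{_}} {{>-nonZero 1≤k}}}} (begin
        3 * k * (2 * suc m * z) ≡⟨ regroup k (suc m) z ⟩
        z * g ≤⟨ m/n*n≤m (3 * p * N n) g ⟩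
        3 * p * N n ≤⟨ *-monoˡ-≤ (N n) (*-monoʳ-≤ 3 (m∸n≤m k 1)) ⟩
        3 * k * N n ∎)
        where
        z = 3 * p * N n / g
        regroup : ∀ k m z → 3 * k * (2 * m * z) ≡ z * (6 * m * k)
        regroup = solve-∀

      exponent : (bits + (x₂ + ν)) * suc m ≤ (p * suc m + 1) * N n
      exponent = *-cancelˡ-≤ 2 (begin
        2 * ((bits + (p * N n + z + ν)) * suc m) ≡⟨ split bits (p * N n) z ν (suc m) ⟩
        2 * suc m * (bits + ν) + 2 * suc m * z + 2 * (p * N n * suc m) ≤⟨ +-monoˡ-≤ (2 * (p * N n * suc m)) (+-mono-≤ total z-small) ⟩
        N n + N n + 2 * (p * N n * suc m) ≡⟨ join (N n) p (suc m) ⟩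
        2 * ((p * suc m + 1) * N n) ∎)
        where
        z = 3 * p * N n / g
        split : ∀ a b z v m → 2 * ((a + (b + z + v)) * m) ≡ 2 * m * (a + v) + 2 * m * z + 2 * (b * m)
        split = solve-∀
        join : ∀ n p m → n + n + 2 * (p * n * m) ≡ 2 * ((p * m + 1) * n)
        join = solve-∀

    count-free-families : (Fs : List (Family n)) → DistinctInducedFreeList P n Fs →
      length Fs ^ suc m ≤ 2 ^ ((p * suc m + 1) * N n)
    count-free-families Fs (distinct , free) = begin
      length Fs ^ suc m ≤⟨ ^-monoˡ-≤ (suc m) (count-covered (x₂ + ν) Cs Fs distinct Cs-count
                                                   (All.tabulate (λ {F} F∈ → Cs-cover F (free F F∈)))) ⟩
      (length Cs * 2 ^ (x₂ + ν)) ^ suc m ≤⟨ ^-monoˡ-≤ (suc m) (*-monoˡ-≤ (2 ^ (x₂ + ν)) length-Cs) ⟩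
      (2 ^ bits * 2 ^ (x₂ + ν)) ^ suc m ≡⟨ cong (_^ suc m) (^-distribˡ-+-* 2 bits (x₂ + ν)) ⟨
      (2 ^ (bits + (x₂ + ν))) ^ suc m ≡⟨ ^-*-assoc 2 (bits + (x₂ + ν)) (suc m) ⟩
      2 ^ ((bits + (x₂ + ν)) * suc m) ≤⟨ ^-monoʳ-≤ 2 exponent ⟩
      2 ^ ((p * suc m + 1) * N n) ∎

-- Choice of the parameters

n<2^n : ∀ n → n < 2 ^ n
n<2^n zero    = s≤s z≤n
n<2^n (suc n) = ≤-trans (+-mono-≤ (≤-trans (s≤s z≤n) (n<2^n n)) (n<2^n n)) (≤-reflexive (cong (2 ^ n +_) (sym (+-identityʳ _))))

linear≤2^ : ∀ Y → ∃ λ u₀ → ∀ u → u₀ ≤ u → Y * suc u ≤ 2 ^ u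
linear≤2^ Y = u₀ , λ u le → subst (λ u → Y * suc u ≤ 2 ^ u) (m+[n∸m]≡n le) (from (u ∸ u₀))
  where
  open ≤-Reasoning
  -- `suc u₀` is at most `4 * suc Y`, while `Y` and `suc Y` are each at most `2 ^ Y`.
  u₀ = 2 + (Y + Y)
  collect : ∀ a → suc (2 + (a + a)) + (1 + (a + a)) ≡ 4 * suc a
  collect = solve-∀
  split : ∀ a → a * (4 * a) ≡ 2 * (2 * (a * a))
  split = solve-∀
  base : Y * suc u₀ ≤ 2 ^ u₀
  base = begin
    Y * suc u₀ ≤⟨ *-mono-≤ (<⇒≤ (n<2^n Y)) (≤-trans (m≤m+n (suc u₀) (1 + (Y + Y))) (≤-reflexive (collect Y))) ⟩
    2 ^ Y * (4 * suc Y) ≤⟨ *-monoʳ-≤ (2 ^ Y) (*-monoʳ-≤ 4 (n<2^n Y)) ⟩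
    2 ^ Y * (4 * 2 ^ Y) ≡⟨ split (2 ^ Y) ⟩
    2 * (2 * (2 ^ Y * 2 ^ Y)) ≡⟨ cong (λ z → 2 * (2 * z)) (^-distribˡ-+-* 2 Y Y) ⟨
    2 ^ u₀ ∎
  from : ∀ d → Y * suc (u₀ + d) ≤ 2 ^ (u₀ + d)
  from zero    = subst (λ u → Y * suc u ≤ 2 ^ u) (sym (+-identityʳ u₀)) base
  from (suc d) = subst (λ u → Y * suc u ≤ 2 ^ u) (sym (+-suc u₀ d)) (begin
    Y * suc (suc (u₀ + d)) ≡⟨ *-suc Y (suc (u₀ + d)) ⟩
    Y + Y * suc (u₀ + d) ≤⟨ +-mono-≤ (≤-trans (m≤m*n Y (suc (u₀ + d))) (from d)) (from d) ⟩
    2 ^ (u₀ + d) + 2 ^ (u₀ + d) ≡⟨ cong (2 ^ (u₀ + d) +_) (+-identityʳ _) ⟨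
    2 ^ suc (u₀ + d) ∎)

bracket : ∀ b n → 1 ≤ n → n < 2 ^ (11 * suc b) → ∃ λ u → 2 ^ (11 * u) ≤ n × n < 2 ^ (11 * suc u)
bracket b n 1≤n n< with 2 ^ (11 * b) ≤? n
bracket b       n 1≤n n< | yes le = b , le , n<
bracket zero    n 1≤n n< | no ≰   = contradiction 1≤n ≰
bracket (suc b) n 1≤n n< | no ≰   = bracket b n 1≤n (≰⇒> ≰)

module Instance (P : FinPoset) (k : ℕ) (m : ℕ) where

  open FinPoset P

  K g c Y : ℕ
  K = 3 * (size * suc k)
  g = 6 * suc m * k
  -- The sum of the constants that `Final` requires to be at most `c`, in the order of its
  -- hypotheses.
  c = (g + 2) * (K * 5) + (20 * K + (4 * k * g + ((g + 2) * (2 * K * 6) + ((g + 2) * (2 * (K * 5) * (22 * (k * k))) + 4 * k))))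
  -- The summands serve, in this order, the length of the fingerprints in `total`, the lower bound
  -- on `y`, and the lower bound on `Q`.
  Y = 4 * suc m * (4 * k * (12 * c + 1) + 1) + 12 * 2 ^ 10 + (15 + c)

  module _ (_<P?_ : ∀ x y → Dec (x <P y)) (tree : IsTreePoset P) (short : ∀ xs → IsChain P xs → length xs ≤ k)
    (n u : ℕ) (large : Y * suc u ≤ 2 ^ u) (lower : 2 ^ (11 * u) ≤ n) (upper : n < 2 ^ (11 * suc u)) where

    private
      open ≤-Reasoning

      Q ℓ e ν E p x y : ℕ
      Q = 2 ^ u
      -- Since `suc n` is at most `2 ^ (11 * suc u)`, `2 ^ ℓ` is at least `Q * suc n`. Together with
      -- `2 ^ n ≤ N n * suc n` this keeps `2 ^ e` below `N n / Q`.
      ℓ = u + 11 * suc u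
      e = n ∸ ℓ
      p = k ∸ 1
      -- As `n` may be almost `2 ^ 11 * Q ^ 11`, half of it fits under `x * Q ^ 6` for
      -- `x = 2 ^ 10 * Q ^ 5`. What remains for `y` is `Q / 2 ^ 10`, still more than the logarithm
      -- of `suc n * Q`.
      x = 2 ^ (10 + 5 * u)
      y = 2 ^ (u ∸ 10)

      instance
        Q≢0 : NonZero Q
        Q≢0 = m^n≢0 2 u

      ν = suc (N n / Q)
      E = suc ℓ * (c * ν) + 2 ^ e

      1≤k : 1 ≤ k
      1≤k = short [ Data.Fin.fromℕ< (proj₁ tree) ] ([] ∷ [])

      Y≤Q : Y ≤ Q
      Y≤Q = ≤-trans (m≤m*n Y (suc u)) large

      15+c≤Q : 15 + c ≤ Q
      15+c≤Q = ≤-trans (m≤n+m (15 + c) _) Y≤Q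

      powers : 12 * 2 ^ 10 ≤ Y
      powers = ≤-trans (m≤n+m (12 * 2 ^ 10) (4 * suc m * (4 * k * (12 * c + 1) + 1))) (m≤m+n _ (15 + c))

      10≤u : 10 ≤ u
      10≤u = ≮⇒≥ (λ u<10 → <⇒≱ (^-monoʳ-< 2 (s≤s (s≤s z≤n)) u<10) (≤-trans (m≤n*m (2 ^ 10) 12) (≤-trans powers Y≤Q)))

      12u≤y : 12 * suc u ≤ y
      12u≤y = *-cancelˡ-≤ (2 ^ 10) (begin
        2 ^ 10 * (12 * suc u) ≡⟨ rearrange (2 ^ 10) 12 (suc u) ⟩
        12 * 2 ^ 10 * suc u ≤⟨ *-monoˡ-≤ (suc u) powers ⟩
        Y * suc u ≤⟨ large ⟩
        2 ^ u ≡⟨ cong (2 ^_) (m+[n∸m]≡n 10≤u) ⟨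
        2 ^ (10 + (u ∸ 10)) ≡⟨ ^-distribˡ-+-* 2 10 (u ∸ 10) ⟩
        2 ^ 10 * y ∎)
        where
        rearrange : ∀ a b c → a * (b * c) ≡ b * a * c
        rearrange = solve-∀

      ℓ≤n : ℓ ≤ n
      ℓ≤n = begin
        ℓ ≤⟨ n≤1+n ℓ ⟩
        12 * suc u ≤⟨ *-monoˡ-≤ (suc u) (≤-trans (m≤m*n 12 (2 ^ 10)) powers) ⟩
        Y * suc u ≤⟨ large ⟩
        2 ^ u ≤⟨ ^-monoʳ-≤ 2 (m≤n*m u 11) ⟩
        2 ^ (11 * u) ≤⟨ lower ⟩
        n ∎

      2^eQ≤N : 2 ^ e * Q ≤ N n
      2^eQ≤N = *-cancelʳ-≤ _ _ (2 ^ (11 * suc u)) {{m^n≢0 2 (11 * suc u)}} (begin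
        2 ^ e * 2 ^ u * 2 ^ (11 * suc u) ≡⟨ rearrange (2 ^ e) (2 ^ u) (2 ^ (11 * suc u)) ⟩
        2 ^ u * 2 ^ (11 * suc u) * 2 ^ e ≡⟨ cong (_* 2 ^ e) (^-distribˡ-+-* 2 u (11 * suc u)) ⟨
        2 ^ ℓ * 2 ^ e ≡⟨ ^-distribˡ-+-* 2 ℓ e ⟨
        2 ^ (ℓ + e) ≡⟨ cong (2 ^_) (m+[n∸m]≡n ℓ≤n) ⟩
        2 ^ n ≤⟨ 2^n≤ n ⟩
        N n * suc n ≤⟨ *-monoʳ-≤ (N n) upper ⟩
        N n * 2 ^ (11 * suc u) ∎)
        where
        rearrange : ∀ a b c → a * b * c ≡ b * c * a
        rearrange = solve-∀

      N≤νQ : N n ≤ ν * Q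
      N≤νQ = begin
        N n ≡⟨ m≡m%n+[m/n]*n (N n) Q ⟩
        N n % Q + N n / Q * Q ≤⟨ +-monoˡ-≤ (N n / Q * Q) (<⇒≤ (m%n<n (N n) Q)) ⟩
        Q + N n / Q * Q ∎

      νQ≤2N : ν * Q ≤ 2 * N n
      νQ≤2N = begin
        Q + N n / Q * Q ≤⟨ +-mono-≤ (≤-trans (m≤n*m Q (2 ^ e) {{m^n≢0 2 e}}) 2^eQ≤N) (m/n*n≤m (N n) Q) ⟩
        N n + N n ≡⟨ cong (N n +_) (+-identityʳ (N n)) ⟨
        2 * N n ∎

      2^e≤ν : 2 ^ e ≤ ν
      2^e≤ν = ≤-trans (*≤⇒≤/ Q 2^eQ≤N) (n≤1+n _)

      leaves≤ : leaves (2 ^ n) (c * ν) ≤ 2 ^ E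
      leaves≤ = subst (λ i → leaves (2 ^ i) (c * ν) ≤ 2 ^ E) (m+[n∸m]≡n ℓ≤n) (leaves-2^ ℓ e (c * ν))

      total : 2 * suc m * ((E + E) * p + (E + E) * p + ν) ≤ N n
      total = *-cancelˡ-≤ 2 (begin
        2 * (2 * suc m * ((E + E) * p + (E + E) * p + ν)) ≡⟨ regroup (suc m) E p ν ⟩
        4 * suc m * (4 * p * E + ν) ≤⟨ *-monoʳ-≤ (4 * suc m) (+-mono-≤ (*-mono-≤ (*-monoʳ-≤ 4 (m∸n≤m k 1)) E≤) (m≤m*n ν (suc u))) ⟩
        4 * suc m * (4 * k * ((12 * c + 1) * (ν * suc u)) + ν * suc u) ≡⟨ collect (4 * suc m) (4 * k) (12 * c + 1) (ν * suc u) ⟩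
        4 * suc m * (4 * k * (12 * c + 1) + 1) * (ν * suc u) ≤⟨ *-monoˡ-≤ (ν * suc u) (≤-trans (m≤m+n (4 * suc m * (4 * k * (12 * c + 1) + 1)) (12 * 2 ^ 10)) (m≤m+n (4 * suc m * (4 * k * (12 * c + 1) + 1) + 12 * 2 ^ 10) (15 + c))) ⟩
        Y * (ν * suc u) ≡⟨ comm3 Y ν (suc u) ⟩
        ν * (Y * suc u) ≤⟨ *-monoʳ-≤ ν large ⟩
        ν * Q ≤⟨ νQ≤2N ⟩
        2 * N n ∎)
        where
        regroup : ∀ m e p v → 2 * (2 * m * ((e + e) * p + (e + e) * p + v)) ≡ 4 * m * (4 * p * e + v)
        regroup = solve-∀
        collect : ∀ m k c v → m * (k * (c * v) + v) ≡ m * (k * c + 1) * v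
        collect = solve-∀
        spread : ∀ u c v → 12 * u * (c * v) + v * u ≡ (12 * c + 1) * (v * u)
        spread = solve-∀
        E≤ : E ≤ (12 * c + 1) * (ν * suc u)
        E≤ = begin
          suc ℓ * (c * ν) + 2 ^ e ≤⟨ +-monoʳ-≤ (suc ℓ * (c * ν)) (≤-trans 2^e≤ν (m≤m*n ν (suc u))) ⟩
          12 * suc u * (c * ν) + ν * suc u ≡⟨ spread (suc u) c ν ⟩
          (12 * c + 1) * (ν * suc u) ∎

      xy≡ : x * y ≡ Q ^ 6
      xy≡ = begin-equality
        x * y ≡⟨ ^-distribˡ-+-* 2 (10 + 5 * u) (u ∸ 10) ⟨
        2 ^ (10 + 5 * u + (u ∸ 10)) ≡⟨ cong (2 ^_) (trans (swap 10 (5 * u) (u ∸ 10)) (cong (5 * u +_) (m+[n∸m]≡n 10≤u))) ⟩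
        2 ^ (5 * u + u) ≡⟨ cong (2 ^_) (six u) ⟩
        2 ^ (u * 6) ≡⟨ ^-*-assoc 2 u 6 ⟨
        Q ^ 6 ∎
        where
        swap : ∀ a b c → a + b + c ≡ b + (a + c)
        swap = solve-∀
        six : ∀ u → 5 * u + u ≡ u * 6
        six = solve-∀

      h≤ : n / 2 ≤ x * (x * y)
      h≤ = <⇒≤ (m<n*o⇒m/o<n (≤-trans upper (≤-reflexive (begin-equality
        2 ^ (11 * suc u) ≡⟨ cong (2 ^_) (split u) ⟩
        2 ^ (suc (10 + 5 * u) + u * 6) ≡⟨ ^-distribˡ-+-* 2 (suc (10 + 5 * u)) (u * 6) ⟩
        2 * x * 2 ^ (u * 6) ≡⟨ rearrange x (2 ^ (u * 6)) ⟩
        x * 2 ^ (u * 6) * 2 ≡⟨ cong (λ z → x * z * 2) (trans (sym (^-*-assoc 2 u 6)) (sym xy≡)) ⟩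
        x * (x * y) * 2 ∎))))
        where
        split : ∀ u → 11 * (1 + u) ≡ 1 + (10 + 5 * u) + u * 6
        split = solve-∀
        rearrange : ∀ a b → 2 * a * b ≡ a * b * 2
        rearrange = solve-∀

      n-small : suc n * Q ≤ 2 ^ y
      n-small = begin
        suc n * 2 ^ u ≤⟨ *-monoˡ-≤ (2 ^ u) upper ⟩
        2 ^ (11 * suc u) * 2 ^ u ≡⟨ ^-distribˡ-+-* 2 (11 * suc u) u ⟨
        2 ^ (11 * suc u + u) ≤⟨ ^-monoʳ-≤ 2 (≤-trans (≤-reflexive (+-comm (11 * suc u) u)) (≤-trans (n≤1+n ℓ) 12u≤y)) ⟩
        2 ^ y ∎

      Q^11≤n : Q ^ 11 ≤ n
      Q^11≤n = ≤-trans (≤-reflexive (trans (^-*-assoc 2 u 11) (cong (2 ^_) (*-comm u 11)))) lower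

    count-free-families′ : (Fs : List (Family n)) → DistinctInducedFreeList P n Fs →
                           length Fs ^ suc m ≤ 2 ^ ((p * suc m + 1) * N n)
    count-free-families′ = Final.count-free-families P _<P?_ tree k short 1≤k m n Q c ν x y E
      (≤-trans (m≤m+n 15 c) 15+c≤Q) (≤-trans (m≤n+m c 15) 15+c≤Q) Q^11≤n
      (m≤m+n a₁ _) (below a₁ (m≤m+n a₂ _)) (below a₁ (below a₂ (m≤m+n a₃ _)))
      (below a₁ (below a₂ (below a₃ (m≤m+n a₄ _)))) (below a₁ (below a₂ (below a₃ (below a₄ (m≤m+n a₅ _)))))
      (below a₁ (below a₂ (below a₃ (below a₄ (m≤n+m (4 * k) a₅)))))
      N≤νQ xy≡ (m^n>0 2 (10 + 5 * u)) h≤ n-small leaves≤ total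
      where
      a₁ a₂ a₃ a₄ a₅ : ℕ
      a₁ = (g + 2) * (K * 5)
      a₂ = 20 * K
      a₃ = 4 * k * g
      a₄ = (g + 2) * (2 * K * 6)
      a₅ = (g + 2) * (2 * (K * 5) * (22 * (k * k)))
      below : ∀ a {b c} → b ≤ c → b ≤ a + c
      below a b≤c = ≤-trans b≤c (m≤n+m _ a)

-- Double negation passes through a quantifier over a finite type, one element at a time.
¬¬-∀ : ∀ {n} {P : Fin n → Set} → (∀ i → ¬ ¬ P i) → ¬ ¬ (∀ i → P i)
¬¬-∀ {zero}  ¬¬p ¬∀ = ¬∀ λ ()
¬¬-∀ {suc n} ¬¬p ¬∀ = ¬¬p zero λ p → ¬¬-∀ (λ i → ¬¬p (suc i)) λ ps → ¬∀ λ { zero → p ; (suc i) → ps i }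

open import Data.Nat.Combinatorics using (_C_)

-- The order of P need not be decidable, but the conclusion is, so it may be
-- assumed decidable for each n; the threshold depends only on the size of P.
theorem1p5 : (P : FinPoset) (k : ℕ) → IsTreePoset P → HasHeight P k →
    (m : ℕ) → ∃[ N ] ∀ n → N ≤ n → (Fs : List (Family n)) →
    DistinctInducedFreeList P n Fs →
    length Fs ^ suc m ≤ 2 ^ (((k ∸ 1) * suc m + 1) * (n C (n / 2)))
theorem1p5 P k tree (_ , short) m = 2 ^ (11 * u₀) , bound
  where
  open FinPoset P
  open Instance P k m
  u₀ : ℕ
  u₀ = proj₁ (linear≤2^ Y)
  bound : ∀ n → 2 ^ (11 * u₀) ≤ n → (Fs : List (Family n)) → DistinctInducedFreeList P n Fs →
          length Fs ^ suc m ≤ 2 ^ (((k ∸ 1) * suc m + 1) * (n C (n / 2)))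
  bound n large Fs free = decidable-stable (length Fs ^ suc m ≤? 2 ^ (((k ∸ 1) * suc m + 1) * (n C (n / 2))))
    λ ¬bound → ¬¬-∀ {P = λ x → ∀ y → Dec (x <P y)} (λ x → ¬¬-∀ (λ y → ¬¬-excluded-middle))
      λ _<P?_ → ¬bound (at-scale _<P?_ (bracket n n 1≤n n<))
    where
    1≤n : 1 ≤ n
    1≤n = ≤-trans (m^n>0 2 (11 * u₀)) large
    n< : n < 2 ^ (11 * suc n)
    n< = ≤-trans (n<2^n n) (^-monoʳ-≤ 2 (≤-trans (n≤1+n n) (m≤n*m (suc n) 11)))
    at-scale : (∀ x y → Dec (x <P y)) → (∃ λ u → 2 ^ (11 * u) ≤ n × n < 2 ^ (11 * suc u)) →
               length Fs ^ suc m ≤ 2 ^ (((k ∸ 1) * suc m + 1) * (n C (n / 2)))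
    at-scale _<P?_ (u , lower , upper) = count-free-families′ _<P?_ tree short n u
      (proj₂ (linear≤2^ Y) u (≮⇒≥ (λ u<u₀ → <⇒≱ upper (≤-trans (^-monoʳ-≤ 2 (*-monoʳ-≤ 11 u<u₀)) large))))
      lower upper Fs free
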